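{- Let $F$ be an integral binary quartic form with $\Delta(F)\neq 0$. Then the following are equivalent. (1) $\mathcal{Q}_F(x)$ is reducible (over $\mathbb{Q}$). (2) $F_T=F$ for some $T\in \mathrm{GL}_2(\mathbb{Q})$ which is not a scalar multiple of $I_{2\times 2}$. (3) $F_{M_f}=F$ for an integral and primitive binary quadratic form $f$ with $\Delta(f)\neq 0$. Moreover, in the case that $\mathcal{Q}_F(x)$ is reducible: (a) if $\Delta(F)$ is not a square, then there is a unique such $f$ (i.e. a unique $f$ as in (3)) up to sign; (b) if $\Delta(F)$ is a square, then there are exactly three such $f$ up to sign, among which one is definite and two are indefinite.
   Context: A binary form is integral if its coefficients lie in $\mathbb{Z}$; an integral binary quadratic form is primitive if its coefficients are coprime. For a binary form $\xi(x,y)$ and $T=\begin{pmatrix} t_1&t_2\\t_3&t_4\end{pmatrix}\in\mathrm{GL}_2(\mathbb{R})$, put $\xi_T(x,y)=\det(T)^{ -\deg\xi/2}\,\xi(t_1x+t_2y,\,t_3x+t_4y)$ (twisted action). For $f(x,y)=\alpha x^2+\beta xy+\gamma y^2$, put $\Delta(f)=\beta^2-4\alpha\gamma$ and $M_f=\begin{pmatrix}\beta&2\gamma\\-2\alpha&-\beta\end{pmatrix}$. For $F(x,y)=a_4x^4+a_3x^3y+a_2x^2y^2+a_1xy^3+a_0y^4$, put $I(F)=12a_4a_0-3a_3a_1+a_2^2$, $J(F)=72a_4a_2a_0+9a_3a_2a_1-27a_4a_1^2-27a_3^2a_0-2a_2^3$, $\Delta(F)=(4I(F)^3-J(F)^2)/27$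 (the discriminant of $F$), and let $\mathcal{Q}_F(x)=x^3-3I(F)x+J(F)$ be the cubic resolvent of $F$. -}

module Defs where

open import Algebra.Definitions.RawSemiring using () renaming (_^_ to pow)
open import Data.Integer using (ℤ; +_; 0ℤ; 1ℤ; _+_; _*_; _-_; -_; _^_; _≤_; _<_; _/ℕ_) renaming (suc to sucℤ)
open import Data.Integer.DivMod using ([n/ℕd]*d≤n; n<s[n/ℕd]*d)
open import Data.Integer.GCD using (gcd)
import Data.Integer.Properties as ℤₚ
open import Data.Integer.Tactic.RingSolver using (solve-∀)
open import Data.List as List using (List; []; _∷_)
open import Data.Nat as ℕ using (ℕ; zero; suc)
open import Data.Product using (_×_; Σ; ∃; ∃₂)
open import Data.Rational as ℚ using (ℚ; 0ℚ; 1ℚ; 1/_; toℚᵘ)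
import Data.Rational.Properties as ℚₚ
open import Data.Rational.Unnormalised as ℚᵘ using (mkℚᵘ; *≡*)
import Data.Rational.Unnormalised.Properties as ℚᵘₚ
open import Data.Sum using (_⊎_)
open import Data.Vec as Vec using (Vec; []; _∷_; _∷ʳ_)
open import Relation.Binary.PropositionalEquality
  using (_≡_; _≢_; sym; trans; cong; cong₂; subst; subst₂)
open import Relation.Nullary using (¬_)

ι : ℤ → ℚ
ι i = i ℚ./ 1

infixr 8 _^ℚ_
_^ℚ_ : ℚ → ℕ → ℚ
_^ℚ_ = pow ℚ.+-*-rawSemiring

ι-toℚᵘ : ∀ i → toℚᵘ (ι i) ℚᵘ.≃ mkℚᵘ i 0
ι-toℚᵘ i = ℚₚ.toℚᵘ-fromℚᵘ (mkℚᵘ i 0)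

ι-injective : ∀ {i j} → ι i ≡ ι j → i ≡ j
ι-injective {i} {j} eq with ℚₚ.fromℚᵘ-injective {mkℚᵘ i 0} {mkℚᵘ j 0} eq
... | *≡* i1≡j1 = trans (sym (ℤₚ.*-identityʳ i)) (trans i1≡j1 (ℤₚ.*-identityʳ j))

ι-* : ∀ i j → ι i ℚ.* ι j ≡ ι (i * j)
ι-* i j = ℚₚ.toℚᵘ-injective (ℚᵘₚ.≃-trans (ℚₚ.toℚᵘ-homo-* (ι i) (ι j))
  (ℚᵘₚ.≃-trans (ℚᵘₚ.*-cong (ι-toℚᵘ i) (ι-toℚᵘ j)) (ℚᵘₚ.≃-sym (ι-toℚᵘ (i * j)))))

ι-- : ∀ i j → ι i ℚ.- ι j ≡ ι (i - j)
ι-- i j = ℚₚ.toℚᵘ-injective (ℚᵘₚ.≃-trans (ℚₚ.toℚᵘ-homo-+ (ι i) (ℚ.- ι j))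
  (ℚᵘₚ.≃-trans
    (ℚᵘₚ.+-cong (ι-toℚᵘ i)
      (ℚᵘₚ.≃-trans (ℚₚ.toℚᵘ-homo‿- (ι j)) (ℚᵘₚ.-‿cong (ι-toℚᵘ j))))
    (ℚᵘₚ.≃-trans
      (*≡* (cong (_* 1ℤ) (cong₂ _+_ (ℤₚ.*-identityʳ i) (ℤₚ.*-identityʳ (- j)))))
      (ℚᵘₚ.≃-sym (ι-toℚᵘ (i - j))))))

-- Polynomials over ℚ as coefficient lists, constant term first.  Trailing
-- zeros are allowed, so the equality of polynomials is _≈_ and not _≡_.

Poly : Set
Poly = List ℚ

coeff : Poly → ℕ → ℚ
coeff []      _       = 0ℚ
coeff (a ∷ _) zero    = a
coeff (_ ∷ p) (suc n) = coeff p n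

infix 4 _≈_
_≈_ : Poly → Poly → Set
p ≈ q = ∀ n → coeff p n ≡ coeff q n

infixl 6 _⊕_
_⊕_ : Poly → Poly → Poly
[]      ⊕ q       = q
(a ∷ p) ⊕ []      = a ∷ p
(a ∷ p) ⊕ (b ∷ q) = (a ℚ.+ b) ∷ (p ⊕ q)

infixl 7 _⊗_
_⊗_ : Poly → Poly → Poly
[]      ⊗ q = []
(a ∷ p) ⊗ q = List.map (a ℚ.*_) q ⊕ (0ℚ ∷ (p ⊗ q))

NonConstant : Poly → Set
NonConstant p = ∃ λ n → coeff p (suc n) ≢ 0ℚ

Reducible : Poly → Set
Reducible p = ∃₂ λ g h → NonConstant g × NonConstant h × p ≈ g ⊗ h

-- Binary forms of degree n; the coefficients are listed in the order
-- xⁿ, xⁿ⁻¹y, …, yⁿ.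

Form : Set → ℕ → Set
Form A n = Vec A (suc n)

infixl 6 _+ᶠ_
_+ᶠ_ : ∀ {n} → Form ℚ n → Form ℚ n → Form ℚ n
_+ᶠ_ = Vec.zipWith ℚ._+_

infixr 7 _·ᶠ_ _*ˡ_ _^ˡ_
_·ᶠ_ : ∀ {n} → ℚ → Form ℚ n → Form ℚ n
c ·ᶠ ξ = Vec.map (c ℚ.*_) ξ

-- (p x + q y) ξ(x,y)
_*ˡ_ : ∀ {n} → Form ℚ 1 → Form ℚ n → Form ℚ (suc n)
(p ∷ q ∷ []) *ˡ ξ = (p ·ᶠ (ξ ∷ʳ 0ℚ)) +ᶠ (q ·ᶠ (0ℚ ∷ ξ))

_^ˡ_ : Form ℚ 1 → (n : ℕ) → Form ℚ n
ℓ ^ˡ zero  = 1ℚ ∷ []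
ℓ ^ˡ suc n = ℓ *ˡ (ℓ ^ˡ n)

record Mat₂ : Set where
  constructor mat
  field t₁ t₂ t₃ t₄ : ℚ

det : Mat₂ → ℚ
det (mat t₁ t₂ t₃ t₄) = t₁ ℚ.* t₄ ℚ.- t₂ ℚ.* t₃

record GL₂ : Set where
  constructor gl
  field
    matrix : Mat₂
    det≢0  : det matrix ≢ 0ℚ

open GL₂ public

IsScalar : Mat₂ → Set
IsScalar T = ∃ λ c → T ≡ mat c 0ℚ 0ℚ c

-- ξ(t₁x + t₂y, t₃x + t₄y), computed from ξ(x,y) = a xⁿ + y ξ′(x,y)
-- where a is the leading coefficient and ξ′ is a form of degree n - 1.
substitute : ∀ {n} → Mat₂ → Form ℚ n → Form ℚ n
substitute {zero}  T                    ξ       = ξ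
substitute {suc n} T@(mat t₁ t₂ t₃ t₄) (a ∷ ξ) =
  (a ·ᶠ ((t₁ ∷ t₂ ∷ []) ^ˡ suc n)) +ᶠ ((t₃ ∷ t₄ ∷ []) *ˡ substitute T ξ)

-- The twisted action on forms of even degree 2k, where the factor
-- det(T)^(-deg/2) is the integral power det(T)⁻ᵏ.
twist : ∀ k → GL₂ → Form ℚ (k ℕ.* 2) → Form ℚ (k ℕ.* 2)
twist k (gl T d≢0) ξ = (((1/ det T) {{ℚ.≢-nonZero d≢0}}) ^ℚ k) ·ᶠ substitute T ξ

Fixes : GL₂ → Form ℤ 4 → Set
Fixes T F = twist 2 T (Vec.map ι F) ≡ Vec.map ι F

Primitive : Form ℤ 2 → Set
Primitive (α ∷ β ∷ γ ∷ []) = gcd α (gcd β γ) ≡ 1ℤ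

disc₂ : Form ℤ 2 → ℤ
disc₂ (α ∷ β ∷ γ ∷ []) = β ^ 2 - + 4 * α * γ

M : Form ℤ 2 → Mat₂
M (α ∷ β ∷ γ ∷ []) = mat (ι β) (ι (+ 2 * γ)) (ι (- (+ 2 * α))) (ι (- β))

private
  det-M≡ : ∀ α β γ → β * - β - (+ 2 * γ) * (- (+ 2 * α)) ≡ - (β * (β * 1ℤ) - + 4 * α * γ)
  det-M≡ = solve-∀

det-M : ∀ f → det (M f) ≡ ι (- disc₂ f)
det-M (α ∷ β ∷ γ ∷ []) =
  trans (cong₂ ℚ._-_ (ι-* β (- β)) (ι-* (+ 2 * γ) (- (+ 2 * α))))
 (trans (ι-- (β * - β) ((+ 2 * γ) * (- (+ 2 * α))))
        (cong ι (det-M≡ α β γ)))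

M-GL₂ : ∀ f → disc₂ f ≢ 0ℤ → GL₂
M-GL₂ f Δ≢0 = gl (M f) λ d≡0 →
  Δ≢0 (ℤₚ.neg-injective (ι-injective (trans (sym (det-M f)) d≡0)))

negᶠ : ∀ {n} → Form ℤ n → Form ℤ n
negᶠ = Vec.map (λ a → - a)

infix 4 _≡±_
_≡±_ : ∀ {n} → Form ℤ n → Form ℤ n → Set
f ≡± g = f ≡ g ⊎ f ≡ negᶠ g

value : Form ℤ 2 → ℤ → ℤ → ℤ
value (α ∷ β ∷ γ ∷ []) x y = α * x ^ 2 + β * x * y + γ * y ^ 2

-- For integral binary forms it makes no difference whether the signs of
-- the values are tested at integral, rational or real points: a singular
-- form has a nontrivial integral zero, and strict inequalities persist
-- near a real point and under scaling.

Definite : Form ℤ 2 → Set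
Definite f =
    (∀ x y → ¬ (x ≡ 0ℤ × y ≡ 0ℤ) → 0ℤ < value f x y)
  ⊎ (∀ x y → ¬ (x ≡ 0ℤ × y ≡ 0ℤ) → value f x y < 0ℤ)

Indefinite : Form ℤ 2 → Set
Indefinite f =
    (∃₂ λ x y → 0ℤ < value f x y)
  × (∃₂ λ x y → value f x y < 0ℤ)

I J disc₄ : Form ℤ 4 → ℤ

I (a₄ ∷ a₃ ∷ a₂ ∷ a₁ ∷ a₀ ∷ []) =
  + 12 * a₄ * a₀ - + 3 * a₃ * a₁ + a₂ ^ 2

J (a₄ ∷ a₃ ∷ a₂ ∷ a₁ ∷ a₀ ∷ []) =
    + 72 * a₄ * a₂ * a₀ + + 9 * a₃ * a₂ * a₁
  - + 27 * a₄ * a₁ ^ 2 - + 27 * a₃ ^ 2 * a₀ - + 2 * a₂ ^ 3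

-- The division is exact, see disc₄-exact.
disc₄ F = (+ 4 * I F ^ 3 - J F ^ 2) /ℕ 27

IsSquare : ℤ → Set
IsSquare n = ∃ λ m → m ^ 2 ≡ n

resolvent : Form ℤ 4 → Poly
resolvent F = List.map ι (J F ∷ - (+ 3 * I F) ∷ 0ℤ ∷ 1ℤ ∷ [])

private
  /27-exact : ∀ n q → n ≡ q * + 27 → (n /ℕ 27) * + 27 ≡ n
  /27-exact n q n≡27q = trans (cong (_* + 27) (ℤₚ.≤-antisym lower upper)) (sym n≡27q)
    where
    lower : n /ℕ 27 ≤ q
    lower = ℤₚ.*-cancelʳ-≤-pos (n /ℕ 27) q (+ 27)
      (subst ((n /ℕ 27) * + 27 ≤_) n≡27q ([n/ℕd]*d≤n n 27))

    27q<27[1+n/27] : q * + 27 < sucℤ (n /ℕ 27) * + 27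
    27q<27[1+n/27] = subst (_< sucℤ (n /ℕ 27) * + 27) n≡27q (n<s[n/ℕd]*d n 27)

    upper : q ≤ n /ℕ 27
    upper = ℤₚ.≮⇒≥ λ n/27<q → ℤₚ.<⇒≱
      (ℤₚ.*-cancelʳ-<-nonNeg {q} {sucℤ (n /ℕ 27)} (+ 27) 27q<27[1+n/27])
      (ℤₚ.i<j⇒suc[i]≤j n/27<q)

  -- Written without _^_, which the ring solver does not see through.

  I≡ : ∀ a b c d e →
    + 12 * a * e - + 3 * b * d + c * (c * 1ℤ)
    ≡ c * c + + 3 * (+ 4 * a * e - b * d)
  I≡ = solve-∀

  J≡ : ∀ a b c d e →
    + 72 * a * c * e + + 9 * b * c * d - + 27 * a * (d * (d * 1ℤ))
      - + 27 * (b * (b * 1ℤ)) * e - + 2 * (c * (c * (c * 1ℤ)))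
    ≡ + 27 * (+ 4 * a * c * e - a * d * d - b * b * e)
      - + 9 * c * (+ 4 * a * e - b * d) - + 2 * c * c * c
  J≡ = solve-∀

  4I³-J²≡ : ∀ c u v →
      + 4 * ((c * c + + 3 * u) * ((c * c + + 3 * u) * ((c * c + + 3 * u) * 1ℤ)))
      - (+ 27 * v - + 9 * c * u - + 2 * c * c * c)
        * ((+ 27 * v - + 9 * c * u - + 2 * c * c * c) * 1ℤ)
    ≡ (+ 4 * c * c * c * v + + 4 * c * c * u * u + + 4 * u * u * u
       - + 3 * (+ 3 * v - c * u) * (+ 3 * v - c * u)) * + 27
  4I³-J²≡ = solve-∀

disc₄-exact : ∀ F → disc₄ F * + 27 ≡ + 4 * I F ^ 3 - J F ^ 2
disc₄-exact F@(a ∷ b ∷ c ∷ d ∷ e ∷ []) = /27-exact (+ 4 * I F ^ 3 - J F ^ 2)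
  (+ 4 * c * c * c * v + + 4 * c * c * u * u + + 4 * u * u * u
    - + 3 * (+ 3 * v - c * u) * (+ 3 * v - c * u))
  (trans (cong₂ (λ i j → + 4 * i ^ 3 - j ^ 2) (I≡ a b c d e) (J≡ a b c d e))
         (4I³-J²≡ c u v))
  where
  u v : ℤ
  u = + 4 * a * e - b * d
  v = + 4 * a * c * e - a * d * d - b * b * e

-- Fixes needs M f as an element of GL₂, hence the dependence on Δ(f) ≠ 0.
Stabilises : Form ℤ 2 → Form ℤ 4 → Set
Stabilises f F =
  Primitive f × Σ (disc₂ f ≢ 0ℤ) λ Δ≢0 → Fixes (M-GL₂ f Δ≢0) F

{-# OPTIONS --safe #-}

-- The second transvectant f ↦ (F,f)₂ is a linear operator φ on binary quadratic
-- forms, symmetric for the polar form of Δ, and up to scaling its characteristic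
-- polynomial is the resolvent of F.  By equivariance F_T = F makes φ commute with
-- f ↦ f∘T, so the form given by the traceless part of T, which spans the forms
-- with f∘T = det T · f, is an eigenvector of φ; conversely every eigenvector f
-- with Δ(f) ≠ 0 satisfies F_{M_f} = F.  Since Δ(F) ≠ 0 every root of the resolvent
-- is simple; its eigenspace is then a line, spanned by a form of nonzero
-- discriminant, so the forms f up to sign correspond to the rational roots, which
-- are integers.  A second root makes Δ(F) a square, and conversely.  Eigenvectors
-- for different roots are orthogonal for the discriminant, which has signature
-- (2,1), so exactly one of three is definite.

module Submission where

open import Defs
open import Data.Fin using (Fin; zero; suc; #_)
open import Data.Integer as ℤ using (ℤ; +_; -[1+_]; 0ℤ; 1ℤ; _≤_; _<_; +≤+; +<+)
import Data.Integer.Divisibility.Signed as Signed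
import Data.Integer.Properties as ℤₚ
import Data.Integer.Tactic.RingSolver as ℤRing
open import Data.List as List using (List; []; _∷_)
open import Data.Nat as ℕ using (ℕ; zero; suc; z≤n; s≤s)
open import Data.Nat.Coprimality as Coprimality using (Coprime; coprime-divisor)
import Data.Nat.Divisibility as ℕ
import Data.Nat.GCD as ℕ
import Data.Nat.Properties as ℕₚ
open import Data.Product using (_×_; _,_; proj₁; proj₂; ∃; ∃₂)
open import Data.Rational as ℚ using (ℚ; mkℚ; 0ℚ; 1ℚ; ½; 1/_)
import Data.Rational.Properties as ℚₚ
open import Data.Rational.Unnormalised using (mkℚᵘ; *≡*)
import Data.Rational.Unnormalised.Properties as ℚᵘₚ
open import Data.Sum using (_⊎_; inj₁; inj₂; [_,_]′)
open import Data.Vec as Vec using (Vec; []; _∷_; lookup)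
open import Data.Vec.Properties using (map-∘; map-cong; map-id)
open import Function using (id)
open import Function.Bundles using (_⇔_; mk⇔)
open import Level using (0ℓ)
open import Relation.Binary.Definitions using (tri<; tri≈; tri>)
open import Relation.Binary.PropositionalEquality
  using (_≡_; _≢_; refl; sym; trans; cong; cong₂; subst; subst₂)
open import Relation.Nullary using (¬_; Dec; yes; no; contradiction)
open import Relation.Nullary.Decidable using (dec⇒maybe)
open import Tactic.RingSolver using (solve-∀)
open import Tactic.RingSolver.Core.AlmostCommutativeRing
  using (AlmostCommutativeRing; fromCommutativeRing)
open import Tactic.RingSolver.Core.Expression using (Expr; Κ)
  renaming (_⊕_ to infixl 6 _:+_; _⊗_ to infixl 7 _:*_; ⊝_ to infix 8 :-_)

-- At a root n one has J = 3In - n³, and 27Δ(F) becomes (I - n²)²(4I - n²). The two factors carry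
-- the whole use of Δ(F). Up to the constant -3, I - n² is the derivative of the resolvent at n, so
-- the root is simple. Also, 12(I - n²) is the contraction of the cofactor matrix with the
-- discriminant form; at a root that matrix has rank one, and this number decides that a nonzero
-- column has nonzero discriminant. The factor 4I - n² is a third of the discriminant of the
-- complementary quadratic, which ties squareness of Δ(F) to the splitting of the resolvent.
-- Normalising the eigenvalue as -2x makes the resolvent the characteristic polynomial without a
-- change of variable. Pairing `φ F f + 2x f` with -½ of the polar form gives a symmetric integral
-- matrix, whose cofactors provide eigenforms by explicit formulas. What remains is polynomial
-- identities modulo the resolvent, divisions by nonzero numbers, and integrality of rational roots.

ℚ-ring : AlmostCommutativeRing 0ℓ 0ℓ
ℚ-ring = fromCommutativeRing ℚₚ.+-*-commutativeRing (λ p → dec⇒maybe (0ℚ ℚ.≟ p))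

open import Tactic.RingSolver.NonReflective ℤRing.ring using () renaming (solve to ℤ-solve)
open import Tactic.RingSolver.NonReflective ℚ-ring using () renaming (solve to ℚ-solve)

-- Polynomial expressions used over ℤ, over ℚ, as input of the ring solver, and
-- as syntax trees through which equations are transported along ι.  The primed
-- names evaluate to the notions of Defs that they are called after.
module Polynomials {A : Set} (k : ℤ → A) (_+′_ _*′_ : A → A → A) (-′_ : A → A) where

  infixl 6 _+_ _-_
  infixl 7 _*_
  infixr 8 _^_
  infixr 7 _·_

  private
    _+_ _*_ _-_ : A → A → A
    _+_ = _+′_
    _*_ = _*′_
    x - y = x +′ (-′ y)

    nat : ℕ → A
    nat n = k (+ n)

  -- The trailing factor `nat 1` matches the standard powers, so that `Pℤ.invI F` is `I F` by
  -- computation once `F` is given by its coefficients.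
  _^_ : A → ℕ → A
  x ^ zero  = nat 1
  x ^ suc n = x * x ^ n

  invI invJ : Form A 4 → A
  invI (a ∷ b ∷ c ∷ d ∷ e ∷ []) = nat 12 * a * e - nat 3 * b * d + c ^ 2
  invJ (a ∷ b ∷ c ∷ d ∷ e ∷ []) =
    nat 72 * a * c * e + nat 9 * b * c * d
    - nat 27 * a * d ^ 2 - nat 27 * b ^ 2 * e - nat 2 * c ^ 3

  disc : Form A 2 → A
  disc (α ∷ β ∷ γ ∷ []) = β ^ 2 - nat 4 * α * γ

  cubic : A → A → A → A
  cubic u w x = x * x * x - u * x + w

  resolventAt : Form A 4 → A → A
  resolventAt F = cubic (nat 3 * invI F) (invJ F)

  -- The rows of the symmetric matrix of the eigenvalue problem
  -- φ F f = -2x f, applied to f; its determinant is four times the resolvent at x.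
  row₁ row₂ row₃ : Form A 4 → A → Form A 2 → A
  row₁ (a ∷ b ∷ c ∷ d ∷ e ∷ []) x (α ∷ β ∷ γ ∷ []) =
    nat 12 * e * α - nat 3 * d * β + nat 2 * (c + x) * γ
  row₂ (a ∷ b ∷ c ∷ d ∷ e ∷ []) x (α ∷ β ∷ γ ∷ []) =
    (nat 2 * c - x) * β - nat 3 * d * α - nat 3 * b * γ
  row₃ (a ∷ b ∷ c ∷ d ∷ e ∷ []) x (α ∷ β ∷ γ ∷ []) =
    nat 2 * (c + x) * α - nat 3 * b * β + nat 12 * a * γ

  -- The cofactors of that matrix.
  S₁₁ S₁₂ S₁₃ S₂₂ S₂₃ S₃₃ : Form A 4 → A → A
  S₁₁ (a ∷ b ∷ c ∷ d ∷ e ∷ []) x = nat 12 * a * (nat 2 * c - x) - nat 9 * b * b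
  S₁₂ (a ∷ b ∷ c ∷ d ∷ e ∷ []) x = nat 36 * a * d - nat 6 * b * (c + x)
  S₁₃ (a ∷ b ∷ c ∷ d ∷ e ∷ []) x = nat 9 * b * d - nat 2 * (c + x) * (nat 2 * c - x)
  S₂₂ (a ∷ b ∷ c ∷ d ∷ e ∷ []) x = nat 144 * a * e - nat 4 * (c + x) * (c + x)
  S₂₃ (a ∷ b ∷ c ∷ d ∷ e ∷ []) x = nat 36 * b * e - nat 6 * d * (c + x)
  S₃₃ (a ∷ b ∷ c ∷ d ∷ e ∷ []) x = nat 12 * e * (nat 2 * c - x) - nat 9 * d * d

  -- Half of F_xx f_yy - 2 F_xy f_xy + F_yy f_xx.
  φ₁ φ₂ φ₃ : Form A 4 → Form A 2 → A
  φ : Form A 4 → Form A 2 → Form A 2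
  φ F f = φ₁ F f ∷ φ₂ F f ∷ φ₃ F f ∷ []
  φ₁ (a ∷ b ∷ c ∷ d ∷ e ∷ []) (α ∷ β ∷ γ ∷ []) = nat 2 * c * α - nat 3 * b * β + nat 12 * a * γ
  φ₂ (a ∷ b ∷ c ∷ d ∷ e ∷ []) (α ∷ β ∷ γ ∷ []) = nat 6 * d * α - nat 4 * c * β + nat 6 * b * γ
  φ₃ (a ∷ b ∷ c ∷ d ∷ e ∷ []) (α ∷ β ∷ γ ∷ []) = nat 12 * e * α - nat 3 * d * β + nat 2 * c * γ

  polar : Form A 2 → Form A 2 → A
  polar (α ∷ β ∷ γ ∷ []) (α′ ∷ β′ ∷ γ′ ∷ []) = β * β′ - nat 2 * α * γ′ - nat 2 * γ * α′

  value′ : Form A 2 → A → A → A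
  value′ (α ∷ β ∷ γ ∷ []) x y = α * x ^ 2 + β * x * y + γ * y ^ 2

  column₁ column₂ : Form A 4 → A → Form A 2
  column₁ F x = S₁₁ F x ∷ S₁₂ F x ∷ S₁₃ F x ∷ []
  column₂ F x = S₁₂ F x ∷ S₂₂ F x ∷ S₂₃ F x ∷ []

  _·_ : ∀ {n} → A → Form A n → Form A n
  c · ξ = Vec.map (c *_) ξ

  neg : ∀ {n} → Form A n → Form A n
  neg = Vec.map -′_

  minor₁₂ minor₁₃ minor₃₂ : Form A 2 → Form A 2 → A
  minor₁₂ (h₁ ∷ h₂ ∷ h₃ ∷ []) (α ∷ β ∷ γ ∷ []) = h₁ * β - h₂ * α
  minor₁₃ (h₁ ∷ h₂ ∷ h₃ ∷ []) (α ∷ β ∷ γ ∷ []) = h₁ * γ - h₃ * α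
  minor₃₂ (h₁ ∷ h₂ ∷ h₃ ∷ []) (α ∷ β ∷ γ ∷ []) = h₃ * β - h₂ * γ

  Matrix : Set
  Matrix = Vec A 4

  det′ : Matrix → A
  det′ (p ∷ q ∷ r ∷ s ∷ []) = p * s - q * r

  axis : Matrix → Form A 2
  axis (p ∷ q ∷ r ∷ s ∷ []) = (-′ r) ∷ (p - s) ∷ q ∷ []

  rotation : Form A 2 → Matrix
  rotation (α ∷ β ∷ γ ∷ []) = β ∷ nat 2 * γ ∷ (-′ (nat 2 * α)) ∷ (-′ β) ∷ []

  substitute′ : ∀ {n} → Matrix → Form A n → Form A n
  substitute′ {zero}  T                       ξ       = ξ
  substitute′ {suc n} T@(p ∷ q ∷ r ∷ s ∷ []) (a ∷ ξ) =
    Vec.zipWith _+_ (a · power (p ∷ q ∷ []) (suc n)) (times (r ∷ s ∷ []) (substitute′ T ξ))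
    where
    times : ∀ {n} → Form A 1 → Form A n → Form A (suc n)
    times (p ∷ q ∷ []) ξ = Vec.zipWith _+_ (p · (ξ Vec.∷ʳ nat 0)) (q · (nat 0 ∷ ξ))

    power : Form A 1 → (n : ℕ) → Form A n
    power ℓ zero    = nat 1 ∷ []
    power ℓ (suc n) = times ℓ (power ℓ n)

  -- The coefficients of f∘T.
  transform₁ transform₂ transform₃ : Matrix → Form A 2 → A
  transform₁ (p ∷ q ∷ r ∷ s ∷ []) (α ∷ β ∷ γ ∷ []) = α * p * p + β * p * r + γ * r * r
  transform₂ (p ∷ q ∷ r ∷ s ∷ []) (α ∷ β ∷ γ ∷ []) =
    nat 2 * α * p * q + β * (p * s + q * r) + nat 2 * γ * r * s
  transform₃ (p ∷ q ∷ r ∷ s ∷ []) (α ∷ β ∷ γ ∷ []) = α * q * q + β * q * s + γ * s * s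

module Pℤ = Polynomials id ℤ._+_ ℤ._*_ ℤ.-_
module Pℚ = Polynomials ι ℚ._+_ ℚ._*_ ℚ.-_

infixl 6 _:-_
_:-_ : ∀ {A : Set} {n} → Expr A n → Expr A n → Expr A n
x :- y = x :+ :- y

infix 4 _:≡_
_:≡_ : ∀ {A : Set} {n} → Expr A n → Expr A n → Expr A n × Expr A n
_:≡_ = _,_

κ : ∀ {n} → ℤ → Expr ℚ n
κ i = Κ (ι i)

-- The ring solver does not unfold definitions, so identities between named
-- polynomials are passed to it as expressions that evaluate to their two sides.
module Sℤ {n : ℕ} = Polynomials {Expr ℤ n} Κ _:+_ _:*_ :-_
module Sℚ {n : ℕ} = Polynomials {Expr ℚ n} κ _:+_ _:*_ :-_

-- Transport of polynomial equations along ι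

infixl 6 _⊞_
infixl 7 _⊠_
infix 8 ⊟_

data Expression : Set where
  leaf      : ℤ → Expression
  _⊞_ _⊠_   : Expression → Expression → Expression
  ⊟_        : Expression → Expression

⟦_⟧ℤ : Expression → ℤ
⟦ leaf i ⟧ℤ = i
⟦ e ⊞ e′ ⟧ℤ = ⟦ e ⟧ℤ ℤ.+ ⟦ e′ ⟧ℤ
⟦ e ⊠ e′ ⟧ℤ = ⟦ e ⟧ℤ ℤ.* ⟦ e′ ⟧ℤ
⟦ ⊟ e ⟧ℤ = ℤ.- ⟦ e ⟧ℤ

⟦_⟧ℚ : Expression → ℚ
⟦ leaf i ⟧ℚ = ι i
⟦ e ⊞ e′ ⟧ℚ = ⟦ e ⟧ℚ ℚ.+ ⟦ e′ ⟧ℚ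
⟦ e ⊠ e′ ⟧ℚ = ⟦ e ⟧ℚ ℚ.* ⟦ e′ ⟧ℚ
⟦ ⊟ e ⟧ℚ = ℚ.- ⟦ e ⟧ℚ

ι-neg : ∀ i → ι (ℤ.- i) ≡ ℚ.- ι i
ι-neg i = trans (cong ι (sym (ℤₚ.+-identityˡ (ℤ.- i))))
  (trans (sym (ι-- 0ℤ i)) (ℚₚ.+-identityˡ (ℚ.- ι i)))

ι-+ : ∀ i j → ι (i ℤ.+ j) ≡ ι i ℚ.+ ι j
ι-+ i j = trans (cong (λ j′ → ι (i ℤ.+ j′)) (sym (ℤₚ.neg-involutive j)))
  (trans (sym (ι-- i (ℤ.- j)))
    (cong (ι i ℚ.+_) (trans (sym (ι-neg (ℤ.- j))) (cong ι (ℤₚ.neg-involutive j)))))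

ι-homo : ∀ e → ι ⟦ e ⟧ℤ ≡ ⟦ e ⟧ℚ
ι-homo (leaf i) = refl
ι-homo (e ⊞ e′) = trans (ι-+ ⟦ e ⟧ℤ ⟦ e′ ⟧ℤ) (cong₂ ℚ._+_ (ι-homo e) (ι-homo e′))
ι-homo (e ⊠ e′) = trans (sym (ι-* ⟦ e ⟧ℤ ⟦ e′ ⟧ℤ)) (cong₂ ℚ._*_ (ι-homo e) (ι-homo e′))
ι-homo (⊟ e) = trans (ι-neg ⟦ e ⟧ℤ) (cong ℚ.-_ (ι-homo e))

module Pᴱ = Polynomials leaf _⊞_ _⊠_ ⊟_

ιᶠ : ∀ {n} → Form ℤ n → Form ℚ n
ιᶠ = Vec.map ι

Root : Form ℤ 4 → ℤ → Set
Root F n = Pℤ.cubic (+ 3 ℤ.* I F) (J F) n ≡ 0ℤ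

Eigenformℤ : Form ℤ 4 → ℤ → Form ℤ 2 → Set
Eigenformℤ F x f = Pℤ.row₁ F x f ≡ 0ℤ × Pℤ.row₂ F x f ≡ 0ℤ × Pℤ.row₃ F x f ≡ 0ℤ

Eigenformℚ : Form ℚ 4 → ℚ → Form ℚ 2 → Set
Eigenformℚ F x f = Pℚ.row₁ F x f ≡ 0ℚ × Pℚ.row₂ F x f ≡ 0ℚ × Pℚ.row₃ F x f ≡ 0ℚ

Eigenform-ι : ∀ F n f → Eigenformℤ F n f → Eigenformℚ (ιᶠ F) (ι n) (ιᶠ f)
Eigenform-ι F@(a ∷ b ∷ c ∷ d ∷ e ∷ []) n f@(α ∷ β ∷ γ ∷ []) (r₁ , r₂ , r₃) =
    trans (sym (ι-homo (Pᴱ.row₁ (Vec.map leaf F) (leaf n) (Vec.map leaf f)))) (cong ι r₁)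
  , trans (sym (ι-homo (Pᴱ.row₂ (Vec.map leaf F) (leaf n) (Vec.map leaf f)))) (cong ι r₂)
  , trans (sym (ι-homo (Pᴱ.row₃ (Vec.map leaf F) (leaf n) (Vec.map leaf f)))) (cong ι r₃)

Eigenform-ι⁻¹ : ∀ F n f → Eigenformℚ (ιᶠ F) (ι n) (ιᶠ f) → Eigenformℤ F n f
Eigenform-ι⁻¹ F@(a ∷ b ∷ c ∷ d ∷ e ∷ []) n f@(α ∷ β ∷ γ ∷ []) (r₁ , r₂ , r₃) =
    ι-injective (trans (ι-homo (Pᴱ.row₁ (Vec.map leaf F) (leaf n) (Vec.map leaf f))) r₁)
  , ι-injective (trans (ι-homo (Pᴱ.row₂ (Vec.map leaf F) (leaf n) (Vec.map leaf f))) r₂)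
  , ι-injective (trans (ι-homo (Pᴱ.row₃ (Vec.map leaf F) (leaf n) (Vec.map leaf f))) r₃)

resolvent-ι : ∀ F n → ι (Pℤ.cubic (+ 3 ℤ.* I F) (J F) n) ≡ Pℚ.resolventAt (ιᶠ F) (ι n)
resolvent-ι F@(a ∷ b ∷ c ∷ d ∷ e ∷ []) n = ι-homo (Pᴱ.resolventAt (Vec.map leaf F) (leaf n))

-- Forms fixed by a matrix

-- The sign is chosen for the uses: `x` is minus the eigenvalue in `Multiple`, and the root of a
-- linear polynomial.
ℚ-quotient : ∀ {p} → p ≢ 0ℚ → ∀ q → ∃ λ x → q ℚ.+ x ℚ.* p ≡ 0ℚ
ℚ-quotient {p} p≢0 q = (ℚ.- q) ℚ.* i ,
  trans (regroup q i p) (trans (cong (λ t → q ℚ.+ (ℚ.- q) ℚ.* t) (ℚₚ.*-inverseˡ p)) (cancel q))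
  where
  instance _ = ℚ.≢-nonZero p≢0
  i = 1/ p
  regroup : ∀ q i p → q ℚ.+ (ℚ.- q) ℚ.* i ℚ.* p ≡ q ℚ.+ (ℚ.- q) ℚ.* (i ℚ.* p)
  regroup = solve-∀ ℚ-ring
  cancel : ∀ q → q ℚ.+ (ℚ.- q) ℚ.* 1ℚ ≡ 0ℚ
  cancel = solve-∀ ℚ-ring

ℚ-cancel : ∀ {p q} → p ≢ 0ℚ → p ℚ.* q ≡ 0ℚ → q ≡ 0ℚ
ℚ-cancel {p} {q} p≢0 pq≡0 = trans (sym (ℚₚ.*-identityˡ q))
  (trans (cong (ℚ._* q) (sym (ℚₚ.*-inverseˡ p)))
    (trans (ℚₚ.*-assoc i p q) (trans (cong (i ℚ.*_) pq≡0) (ℚₚ.*-zeroʳ i))))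
  where
  instance _ = ℚ.≢-nonZero p≢0
  i = 1/ p

difference≡0ℚ : ∀ {p q} → p ≡ q → p ℚ.- q ≡ 0ℚ
difference≡0ℚ {p} refl = ℚₚ.+-inverseʳ p

difference≡0⇒≡ : ∀ {p q} → p ℚ.- q ≡ 0ℚ → p ≡ q
difference≡0⇒≡ {p} {q} eq = trans (split p q) (trans (cong (ℚ._+ q) eq) (ℚₚ.+-identityˡ q))
  where
  split : ∀ p q → p ≡ p ℚ.- q ℚ.+ q
  split = solve-∀ ℚ-ring

-- Closes the recurring argument: a solver identity writes the target as a combination of quantities
-- known to vanish.
combine₂ℚ : ∀ u v {x y} → x ≡ 0ℚ → y ≡ 0ℚ → u ℚ.* x ℚ.+ v ℚ.* y ≡ 0ℚ
combine₂ℚ u v refl refl = lemma u v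
  where
  lemma : ∀ u v → u ℚ.* 0ℚ ℚ.+ v ℚ.* 0ℚ ≡ 0ℚ
  lemma = solve-∀ ℚ-ring

combine₃ℚ : ∀ u v w {x y z} → x ≡ 0ℚ → y ≡ 0ℚ → z ≡ 0ℚ →
            u ℚ.* x ℚ.+ v ℚ.* y ℚ.+ w ℚ.* z ≡ 0ℚ
combine₃ℚ u v w refl refl refl = lemma u v w
  where
  lemma : ∀ u v w → u ℚ.* 0ℚ ℚ.+ v ℚ.* 0ℚ ℚ.+ w ℚ.* 0ℚ ≡ 0ℚ
  lemma = solve-∀ ℚ-ring

private
  inverse-square : ∀ {δ} (δ≢0 : δ ≢ 0ℚ) → let i = (1/ δ) {{ℚ.≢-nonZero δ≢0}} in
    ∀ x → δ ℚ.* δ ℚ.* (i ^ℚ 2 ℚ.* x) ≡ x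
  inverse-square {δ} δ≢0 x = trans (regroup δ _ x)
    (trans (cong (λ t → t ℚ.* (t ℚ.* x)) (ℚₚ.*-inverseʳ δ {{ℚ.≢-nonZero δ≢0}}))
      (trans (ℚₚ.*-identityˡ (1ℚ ℚ.* x)) (ℚₚ.*-identityˡ x)))
    where
    regroup : ∀ δ i x → δ ℚ.* δ ℚ.* (i ^ℚ 2 ℚ.* x) ≡ (δ ℚ.* i) ℚ.* ((δ ℚ.* i) ℚ.* x)
    regroup = ℚ-solve 3 (λ δ i x →
      δ :* δ :* (i Sℚ.^ 2 :* x) :≡ (δ :* i) :* ((δ :* i) :* x)) refl

  map-cancel : ∀ {n} (f g : ℚ → ℚ) → (∀ x → f (g x) ≡ x) →
               (v : Vec ℚ n) → Vec.map f (Vec.map g v) ≡ v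
  map-cancel f g fg v = trans (sym (map-∘ f g v)) (trans (map-cong fg v) (map-id v))

-- Moves the inverse determinant to the other side, so that invariance becomes polynomial in the
-- entries of T.
twist-fixed⇒ : ∀ (T : GL₂) ξ → twist 2 T ξ ≡ ξ →
  substitute (matrix T) ξ ≡ (det (matrix T) ℚ.* det (matrix T)) ·ᶠ ξ
twist-fixed⇒ (gl T δ≢0) ξ eq = trans
  (sym (map-cancel (det T ℚ.* det T ℚ.*_) (i ^ℚ 2 ℚ.*_) (inverse-square δ≢0) (substitute T ξ)))
  (cong ((det T ℚ.* det T) ·ᶠ_) eq)
  where i = (1/ det T) {{ℚ.≢-nonZero δ≢0}}

twist-fixed⇐ : ∀ (T : GL₂) ξ →
  substitute (matrix T) ξ ≡ (det (matrix T) ℚ.* det (matrix T)) ·ᶠ ξ → twist 2 T ξ ≡ ξ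
twist-fixed⇐ (gl T δ≢0) ξ eq = trans (cong ((i ^ℚ 2) ·ᶠ_) eq)
  (map-cancel (i ^ℚ 2 ℚ.*_) (det T ℚ.* det T ℚ.*_)
    (λ x → trans (swap (det T) i x) (inverse-square δ≢0 x)) ξ)
  where
  i = (1/ det T) {{ℚ.≢-nonZero δ≢0}}
  swap : ∀ δ i x → i ^ℚ 2 ℚ.* (δ ℚ.* δ ℚ.* x) ≡ δ ℚ.* δ ℚ.* (i ^ℚ 2 ℚ.* x)
  swap = ℚ-solve 3 (λ δ i x →
    i Sℚ.^ 2 :* (δ :* δ :* x) :≡ δ :* δ :* (i Sℚ.^ 2 :* x)) refl

entries : Mat₂ → Pℚ.Matrix
entries (mat p q r s) = p ∷ q ∷ r ∷ s ∷ []

-- T = (tr T + M f)/2 for this form f.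
axis : Mat₂ → Form ℚ 2
axis T = Pℚ.axis (entries T)

Nonzero : Form ℚ 2 → Set
Nonzero (α ∷ β ∷ γ ∷ []) = α ≢ 0ℚ ⊎ β ≢ 0ℚ ⊎ γ ≢ 0ℚ

axis-nonzero : ∀ T → ¬ IsScalar T → Nonzero (axis T)
axis-nonzero (mat p q r s) ¬scalar with ℚ.- r ℚ.≟ 0ℚ | p ℚ.- s ℚ.≟ 0ℚ | q ℚ.≟ 0ℚ
... | no -r≢0 | _ | _ = inj₁ -r≢0
... | yes _ | no p-s≢0 | _ = inj₂ (inj₁ p-s≢0)
... | yes _ | yes _ | no q≢0 = inj₂ (inj₂ q≢0)
... | yes -r≡0 | yes p-s≡0 | yes refl = contradiction (s , scalar) ¬scalar
  where
  r≡0 : r ≡ 0ℚ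
  r≡0 = trans (double r) (cong ℚ.-_ -r≡0)
    where
    double : ∀ r → r ≡ ℚ.- (ℚ.- r)
    double = solve-∀ ℚ-ring
  p≡s : p ≡ s
  p≡s = difference≡0⇒≡ p-s≡0
  scalar : mat p 0ℚ r s ≡ mat s 0ℚ 0ℚ s
  scalar = cong₂ (λ p r → mat p 0ℚ r s) p≡s r≡0

-- Only one factor det T appears because axis T ∘ T = det T · axis T.
φ₁-equivariant : ∀ a b c d e p q r s →
  let F = a ∷ b ∷ c ∷ d ∷ e ∷ []; T = mat p q r s; f = axis T in
  Pℚ.φ₁ (substitute T F) f ≡ det T ℚ.* Pℚ.transform₁ (entries T) (Pℚ.φ F f)
φ₁-equivariant = ℚ-solve 9 (λ a b c d e p q r s →
  let F = a ∷ b ∷ c ∷ d ∷ e ∷ []; T = p ∷ q ∷ r ∷ s ∷ []; f = Sℚ.axis T in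
  Sℚ.φ₁ (Sℚ.substitute′ T F) f :≡ Sℚ.det′ T :* Sℚ.transform₁ T (Sℚ.φ F f)) refl

φ₂-equivariant : ∀ a b c d e p q r s →
  let F = a ∷ b ∷ c ∷ d ∷ e ∷ []; T = mat p q r s; f = axis T in
  Pℚ.φ₂ (substitute T F) f ≡ det T ℚ.* Pℚ.transform₂ (entries T) (Pℚ.φ F f)
φ₂-equivariant = ℚ-solve 9 (λ a b c d e p q r s →
  let F = a ∷ b ∷ c ∷ d ∷ e ∷ []; T = p ∷ q ∷ r ∷ s ∷ []; f = Sℚ.axis T in
  Sℚ.φ₂ (Sℚ.substitute′ T F) f :≡ Sℚ.det′ T :* Sℚ.transform₂ T (Sℚ.φ F f)) refl

φ₃-equivariant : ∀ a b c d e p q r s →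
  let F = a ∷ b ∷ c ∷ d ∷ e ∷ []; T = mat p q r s; f = axis T in
  Pℚ.φ₃ (substitute T F) f ≡ det T ℚ.* Pℚ.transform₃ (entries T) (Pℚ.φ F f)
φ₃-equivariant = ℚ-solve 9 (λ a b c d e p q r s →
  let F = a ∷ b ∷ c ∷ d ∷ e ∷ []; T = p ∷ q ∷ r ∷ s ∷ []; f = Sℚ.axis T in
  Sℚ.φ₃ (Sℚ.substitute′ T F) f :≡ Sℚ.det′ T :* Sℚ.transform₃ T (Sℚ.φ F f)) refl

-- Linear dependence as vanishing 2×2 minors, the form in which the commutation identities deliver
-- it; no factor has to be named.
Parallel : Form ℚ 2 → Form ℚ 2 → Set
Parallel h f = Pℚ.minor₁₂ h f ≡ 0ℚ × Pℚ.minor₁₃ h f ≡ 0ℚ × Pℚ.minor₃₂ h f ≡ 0ℚ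

2≢0 : ι (+ 2) ≢ 0ℚ
2≢0 ()

private
  φ₁-· : ∀ t a b c d e α β γ → let F = a ∷ b ∷ c ∷ d ∷ e ∷ []; f = α ∷ β ∷ γ ∷ [] in
    Pℚ.φ₁ (t ·ᶠ F) f ≡ t ℚ.* Pℚ.φ₁ F f
  φ₁-· = ℚ-solve 9 (λ t a b c d e α β γ →
    let F = a ∷ b ∷ c ∷ d ∷ e ∷ []; f = α ∷ β ∷ γ ∷ [] in
    Sℚ.φ₁ (t Sℚ.· F) f :≡ t :* Sℚ.φ₁ F f) refl

  φ₂-· : ∀ t a b c d e α β γ → let F = a ∷ b ∷ c ∷ d ∷ e ∷ []; f = α ∷ β ∷ γ ∷ [] in
    Pℚ.φ₂ (t ·ᶠ F) f ≡ t ℚ.* Pℚ.φ₂ F f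
  φ₂-· = ℚ-solve 9 (λ t a b c d e α β γ →
    let F = a ∷ b ∷ c ∷ d ∷ e ∷ []; f = α ∷ β ∷ γ ∷ [] in
    Sℚ.φ₂ (t Sℚ.· F) f :≡ t :* Sℚ.φ₂ F f) refl

  φ₃-· : ∀ t a b c d e α β γ → let F = a ∷ b ∷ c ∷ d ∷ e ∷ []; f = α ∷ β ∷ γ ∷ [] in
    Pℚ.φ₃ (t ·ᶠ F) f ≡ t ℚ.* Pℚ.φ₃ F f
  φ₃-· = ℚ-solve 9 (λ t a b c d e α β γ →
    let F = a ∷ b ∷ c ∷ d ∷ e ∷ []; f = α ∷ β ∷ γ ∷ [] in
    Sℚ.φ₃ (t Sℚ.· F) f :≡ t :* Sℚ.φ₃ F f) refl

  -- T M_{h∘T} = det T · M_h T, so M_h commutes with T when h∘T = det T · h.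
  commute₁₂ : ∀ p q r s h₁ h₂ h₃ → let T = mat p q r s; h = h₁ ∷ h₂ ∷ h₃ ∷ [] in
    ι (+ 2) ℚ.* (det T ℚ.* Pℚ.minor₁₂ h (axis T)) ≡
      r ℚ.* (det T ℚ.* h₂ ℚ.- Pℚ.transform₂ (entries T) h) ℚ.+ (ℚ.- ι (+ 2) ℚ.* s) ℚ.*
        (det T ℚ.* h₁ ℚ.- Pℚ.transform₁ (entries T) h)
  commute₁₂ = ℚ-solve 7 (λ p q r s h₁ h₂ h₃ →
    let T = p ∷ q ∷ r ∷ s ∷ []; h = h₁ ∷ h₂ ∷ h₃ ∷ [] in
    (κ (+ 2)) :* (Sℚ.det′ T :* Sℚ.minor₁₂ h (Sℚ.axis T)) :≡
    r :* (Sℚ.det′ T :* h₂ :- Sℚ.transform₂ T h) :+ (:- κ (+ 2) :* s) :*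
      (Sℚ.det′ T :* h₁ :- Sℚ.transform₁ T h)) refl

  commute₁₃ : ∀ p q r s h₁ h₂ h₃ → let T = mat p q r s; h = h₁ ∷ h₂ ∷ h₃ ∷ [] in
    ι (+ 2) ℚ.* (det T ℚ.* Pℚ.minor₁₃ h (axis T)) ≡
      (ℚ.- p) ℚ.* (det T ℚ.* h₂ ℚ.- Pℚ.transform₂ (entries T) h) ℚ.+ (ι (+ 2) ℚ.* q) ℚ.*
        (det T ℚ.* h₁ ℚ.- Pℚ.transform₁ (entries T) h)
  commute₁₃ = ℚ-solve 7 (λ p q r s h₁ h₂ h₃ →
    let T = p ∷ q ∷ r ∷ s ∷ []; h = h₁ ∷ h₂ ∷ h₃ ∷ [] in
    (κ (+ 2)) :* (Sℚ.det′ T :* Sℚ.minor₁₃ h (Sℚ.axis T)) :≡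
    (:- p) :* (Sℚ.det′ T :* h₂ :- Sℚ.transform₂ T h) :+ (κ (+ 2) :* q) :*
      (Sℚ.det′ T :* h₁ :- Sℚ.transform₁ T h)) refl

  commute₃₂ : ∀ p q r s h₁ h₂ h₃ → let T = mat p q r s; h = h₁ ∷ h₂ ∷ h₃ ∷ [] in
    ι (+ 2) ℚ.* (det T ℚ.* Pℚ.minor₃₂ h (axis T)) ≡
      (ι (+ 2) ℚ.* p) ℚ.* (det T ℚ.* h₃ ℚ.- Pℚ.transform₃ (entries T) h) ℚ.+ (ℚ.- q) ℚ.*
        (det T ℚ.* h₂ ℚ.- Pℚ.transform₂ (entries T) h)
  commute₃₂ = ℚ-solve 7 (λ p q r s h₁ h₂ h₃ →
    let T = p ∷ q ∷ r ∷ s ∷ []; h = h₁ ∷ h₂ ∷ h₃ ∷ [] in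
    (κ (+ 2)) :* (Sℚ.det′ T :* Sℚ.minor₃₂ h (Sℚ.axis T)) :≡
    (κ (+ 2) :* p) :* (Sℚ.det′ T :* h₃ :- Sℚ.transform₃ T h) :+ (:- q) :*
      (Sℚ.det′ T :* h₂ :- Sℚ.transform₂ T h)) refl

  distribute : ∀ δ h t → δ ℚ.* (δ ℚ.* h ℚ.- t) ≡ δ ℚ.* δ ℚ.* h ℚ.- δ ℚ.* t
  distribute = solve-∀ ℚ-ring

-- For h = φ F f with f the axis of T, equivariance and F∘T = δ²F give δ²h = δ(h∘T), hence h∘T = δh.
-- Then M_h commutes with T, that is with M_f, which forces h and f to be dependent.
fixed⇒parallel : ∀ T → det T ≢ 0ℚ → ∀ F → substitute T F ≡ (det T ℚ.* det T) ·ᶠ F →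
                 Parallel (Pℚ.φ F (axis T)) (axis T)
fixed⇒parallel T@(mat p q r s) δ≢0 F@(a ∷ b ∷ c ∷ d ∷ e ∷ []) fixed =
    halve (trans (commute₁₂ p q r s h₁ h₂ h₃) (combine₂ℚ r (ℚ.- ι (+ 2) ℚ.* s) e₂ e₁))
  , halve (trans (commute₁₃ p q r s h₁ h₂ h₃) (combine₂ℚ (ℚ.- p) (ι (+ 2) ℚ.* q) e₂ e₁))
  , halve (trans (commute₃₂ p q r s h₁ h₂ h₃) (combine₂ℚ (ι (+ 2) ℚ.* p) (ℚ.- q) e₃ e₂))
  where
  δ = det T
  f = axis T
  h₁ = Pℚ.φ₁ F f
  h₂ = Pℚ.φ₂ F f
  h₃ = Pℚ.φ₃ F f
  h = Pℚ.φ F f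

  halve : ∀ {x} → ι (+ 2) ℚ.* (δ ℚ.* x) ≡ 0ℚ → x ≡ 0ℚ
  halve eq = ℚ-cancel δ≢0 (ℚ-cancel 2≢0 eq)

  cancel-δ : ∀ {h t} → δ ℚ.* δ ℚ.* h ≡ δ ℚ.* t → δ ℚ.* h ℚ.- t ≡ 0ℚ
  cancel-δ {h} {t} eq = ℚ-cancel δ≢0 (trans (distribute δ h t) (difference≡0ℚ eq))

  e₁ : δ ℚ.* h₁ ℚ.- Pℚ.transform₁ (entries T) h ≡ 0ℚ
  e₁ = cancel-δ (trans (sym (φ₁-· (δ ℚ.* δ) a b c d e (ℚ.- r) (p ℚ.- s) q))
    (trans (cong (λ G → Pℚ.φ₁ G f) (sym fixed)) (φ₁-equivariant a b c d e p q r s)))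
  e₂ : δ ℚ.* h₂ ℚ.- Pℚ.transform₂ (entries T) h ≡ 0ℚ
  e₂ = cancel-δ (trans (sym (φ₂-· (δ ℚ.* δ) a b c d e (ℚ.- r) (p ℚ.- s) q))
    (trans (cong (λ G → Pℚ.φ₂ G f) (sym fixed)) (φ₂-equivariant a b c d e p q r s)))
  e₃ : δ ℚ.* h₃ ℚ.- Pℚ.transform₃ (entries T) h ≡ 0ℚ
  e₃ = cancel-δ (trans (sym (φ₃-· (δ ℚ.* δ) a b c d e (ℚ.- r) (p ℚ.- s) q))
    (trans (cong (λ G → Pℚ.φ₃ G f) (sym fixed)) (φ₃-equivariant a b c d e p q r s)))

Multiple : ℚ → Form ℚ 2 → Form ℚ 2 → Set
Multiple x (h₁ ∷ h₂ ∷ h₃ ∷ []) (α ∷ β ∷ γ ∷ []) =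
  h₁ ℚ.+ x ℚ.* α ≡ 0ℚ × h₂ ℚ.+ x ℚ.* β ≡ 0ℚ × h₃ ℚ.+ x ℚ.* γ ≡ 0ℚ

private
  next : ∀ {α} → α ≢ 0ℚ → ∀ x h h′ β → h ℚ.+ x ℚ.* α ≡ 0ℚ → h ℚ.* β ℚ.- h′ ℚ.* α ≡ 0ℚ →
         h′ ℚ.+ x ℚ.* β ≡ 0ℚ
  next {α} α≢0 x h h′ β eq minor≡0 = ℚ-cancel α≢0
    (trans (identity x h h′ α β) (combine₂ℚ β (ℚ.- 1ℚ) eq minor≡0))
    where
    identity : ∀ x h h′ α β → α ℚ.* (h′ ℚ.+ x ℚ.* β) ≡
      β ℚ.* (h ℚ.+ x ℚ.* α) ℚ.+ (ℚ.- 1ℚ) ℚ.* (h ℚ.* β ℚ.- h′ ℚ.* α)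
    identity = solve-∀ ℚ-ring

  flip : ∀ x y u v → x ℚ.* y ℚ.- u ℚ.* v ≡ 0ℚ → u ℚ.* v ℚ.- x ℚ.* y ≡ 0ℚ
  flip x y u v eq = trans (negate (x ℚ.* y) (u ℚ.* v)) (cong ℚ.-_ eq)
    where
    negate : ∀ s t → t ℚ.- s ≡ ℚ.- (s ℚ.- t)
    negate = solve-∀ ℚ-ring

-- The factor is read off at a nonzero coordinate of `f`; the two minors through that coordinate
-- carry it to the others.
parallel⇒multiple : ∀ h f → Nonzero f → Parallel h f → ∃ λ x → Multiple x h f
parallel⇒multiple (h₁ ∷ h₂ ∷ h₃ ∷ []) (α ∷ β ∷ γ ∷ []) nonzero (m₁₂ , m₁₃ , m₃₂) = split nonzero
  where
  split : α ≢ 0ℚ ⊎ β ≢ 0ℚ ⊎ γ ≢ 0ℚ → ∃ λ x → Multiple x (h₁ ∷ h₂ ∷ h₃ ∷ []) (α ∷ β ∷ γ ∷ [])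
  split (inj₁ α≢0) =
    let x , eq = ℚ-quotient α≢0 h₁ in
    x , eq , next α≢0 x h₁ h₂ β eq m₁₂ , next α≢0 x h₁ h₃ γ eq m₁₃
  split (inj₂ (inj₁ β≢0)) =
    let x , eq = ℚ-quotient β≢0 h₂ in
    x , next β≢0 x h₂ h₁ α eq (flip h₁ β h₂ α m₁₂) , eq , next β≢0 x h₂ h₃ γ eq (flip h₃ β h₂ γ m₃₂)
  split (inj₂ (inj₂ γ≢0)) =
    let x , eq = ℚ-quotient γ≢0 h₃ in
    x , next γ≢0 x h₃ h₁ α eq (flip h₁ γ h₃ α m₁₃) , next γ≢0 x h₃ h₂ β eq m₃₂ , eq

-- The eigenvalue -x is -2(½x), whence the half. The rows are φ₃, -½φ₂, φ₁ with the shift added: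
-- this order and scaling come from pairing with the polar form.
multiple⇒eigenform : ∀ F f x → Multiple x (Pℚ.φ F f) f → Eigenformℚ F (½ ℚ.* x) f
multiple⇒eigenform (a ∷ b ∷ c ∷ d ∷ e ∷ []) (α ∷ β ∷ γ ∷ []) x (m₁ , m₂ , m₃) =
    trans (identity₁ a b c d e α β γ x) m₃
  , trans (identity₂ a b c d e α β γ x) (cong ((ℚ.- ½) ℚ.*_) m₂)
  , trans (identity₃ a b c d e α β γ x) m₁
  where
  identity₁ : ∀ a b c d e α β γ x → let F = a ∷ b ∷ c ∷ d ∷ e ∷ []; f = α ∷ β ∷ γ ∷ [] in
    Pℚ.row₁ F (½ ℚ.* x) f ≡ Pℚ.φ₃ F f ℚ.+ x ℚ.* γ
  identity₁ = ℚ-solve 9 (λ a b c d e α β γ x →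
    let F = a ∷ b ∷ c ∷ d ∷ e ∷ []; f = α ∷ β ∷ γ ∷ [] in
    Sℚ.row₁ F (Κ ½ :* x) f :≡ Sℚ.φ₃ F f :+ x :* γ) refl
  identity₂ : ∀ a b c d e α β γ x → let F = a ∷ b ∷ c ∷ d ∷ e ∷ []; f = α ∷ β ∷ γ ∷ [] in
    Pℚ.row₂ F (½ ℚ.* x) f ≡ (ℚ.- ½) ℚ.* (Pℚ.φ₂ F f ℚ.+ x ℚ.* β)
  identity₂ = ℚ-solve 9 (λ a b c d e α β γ x →
    let F = a ∷ b ∷ c ∷ d ∷ e ∷ []; f = α ∷ β ∷ γ ∷ [] in
    Sℚ.row₂ F (Κ ½ :* x) f :≡ (:- Κ ½) :* (Sℚ.φ₂ F f :+ x :* β)) refl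
  identity₃ : ∀ a b c d e α β γ x → let F = a ∷ b ∷ c ∷ d ∷ e ∷ []; f = α ∷ β ∷ γ ∷ [] in
    Pℚ.row₃ F (½ ℚ.* x) f ≡ Pℚ.φ₁ F f ℚ.+ x ℚ.* α
  identity₃ = ℚ-solve 9 (λ a b c d e α β γ x →
    let F = a ∷ b ∷ c ∷ d ∷ e ∷ []; f = α ∷ β ∷ γ ∷ [] in
    Sℚ.row₃ F (Κ ½ :* x) f :≡ Sℚ.φ₁ F f :+ x :* α) refl

private
  -- A coordinate of adj(A) A f = det(A) f, where A f is the vector of rows and det A is four times
  -- the resolvent. A nonzero kernel vector therefore makes the resolvent vanish.
  adjugate₁ : ∀ a b c d e x α β γ → let F = a ∷ b ∷ c ∷ d ∷ e ∷ []; f = α ∷ β ∷ γ ∷ [] in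
    α ℚ.* (ι (+ 4) ℚ.* Pℚ.resolventAt F x) ≡
    Pℚ.S₁₁ F x ℚ.* Pℚ.row₁ F x f ℚ.+ Pℚ.S₁₂ F x ℚ.* Pℚ.row₂ F x f ℚ.+ Pℚ.S₁₃ F x ℚ.* Pℚ.row₃ F x f
  adjugate₁ = ℚ-solve 9 (λ a b c d e x α β γ →
    let F = a ∷ b ∷ c ∷ d ∷ e ∷ []; f = α ∷ β ∷ γ ∷ [] in
    α :* (κ (+ 4) :* Sℚ.resolventAt F x) :≡
    Sℚ.S₁₁ F x :* Sℚ.row₁ F x f :+ Sℚ.S₁₂ F x :* Sℚ.row₂ F x f :+ Sℚ.S₁₃ F x :* Sℚ.row₃ F x f) refl

  adjugate₂ : ∀ a b c d e x α β γ → let F = a ∷ b ∷ c ∷ d ∷ e ∷ []; f = α ∷ β ∷ γ ∷ [] in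
    β ℚ.* (ι (+ 4) ℚ.* Pℚ.resolventAt F x) ≡
    Pℚ.S₁₂ F x ℚ.* Pℚ.row₁ F x f ℚ.+ Pℚ.S₂₂ F x ℚ.* Pℚ.row₂ F x f ℚ.+ Pℚ.S₂₃ F x ℚ.* Pℚ.row₃ F x f
  adjugate₂ = ℚ-solve 9 (λ a b c d e x α β γ →
    let F = a ∷ b ∷ c ∷ d ∷ e ∷ []; f = α ∷ β ∷ γ ∷ [] in
    β :* (κ (+ 4) :* Sℚ.resolventAt F x) :≡
    Sℚ.S₁₂ F x :* Sℚ.row₁ F x f :+ Sℚ.S₂₂ F x :* Sℚ.row₂ F x f :+ Sℚ.S₂₃ F x :* Sℚ.row₃ F x f) refl

  adjugate₃ : ∀ a b c d e x α β γ → let F = a ∷ b ∷ c ∷ d ∷ e ∷ []; f = α ∷ β ∷ γ ∷ [] in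
    γ ℚ.* (ι (+ 4) ℚ.* Pℚ.resolventAt F x) ≡
    Pℚ.S₁₃ F x ℚ.* Pℚ.row₁ F x f ℚ.+ Pℚ.S₂₃ F x ℚ.* Pℚ.row₂ F x f ℚ.+ Pℚ.S₃₃ F x ℚ.* Pℚ.row₃ F x f
  adjugate₃ = ℚ-solve 9 (λ a b c d e x α β γ →
    let F = a ∷ b ∷ c ∷ d ∷ e ∷ []; f = α ∷ β ∷ γ ∷ [] in
    γ :* (κ (+ 4) :* Sℚ.resolventAt F x) :≡
    Sℚ.S₁₃ F x :* Sℚ.row₁ F x f :+ Sℚ.S₂₃ F x :* Sℚ.row₂ F x f :+ Sℚ.S₃₃ F x :* Sℚ.row₃ F x f) refl

  4≢0 : ι (+ 4) ≢ 0ℚ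
  4≢0 ()

eigenform⇒root : ∀ F x f → Nonzero f → Eigenformℚ F x f → Pℚ.resolventAt F x ≡ 0ℚ
eigenform⇒root F@(a ∷ b ∷ c ∷ d ∷ e ∷ []) x (α ∷ β ∷ γ ∷ []) nonzero (r₁ , r₂ , r₃) = ℚ-cancel 4≢0
  (det≡0 nonzero)
  where
  det≡0 : α ≢ 0ℚ ⊎ β ≢ 0ℚ ⊎ γ ≢ 0ℚ → ι (+ 4) ℚ.* Pℚ.resolventAt F x ≡ 0ℚ
  det≡0 (inj₁ α≢0) = ℚ-cancel α≢0 (trans (adjugate₁ a b c d e x α β γ)
    (combine₃ℚ (Pℚ.S₁₁ F x) (Pℚ.S₁₂ F x) (Pℚ.S₁₃ F x) r₁ r₂ r₃))
  det≡0 (inj₂ (inj₁ β≢0)) = ℚ-cancel β≢0 (trans (adjugate₂ a b c d e x α β γ)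
    (combine₃ℚ (Pℚ.S₁₂ F x) (Pℚ.S₂₂ F x) (Pℚ.S₂₃ F x) r₁ r₂ r₃))
  det≡0 (inj₂ (inj₂ γ≢0)) = ℚ-cancel γ≢0 (trans (adjugate₃ a b c d e x α β γ)
    (combine₃ℚ (Pℚ.S₁₃ F x) (Pℚ.S₂₃ F x) (Pℚ.S₃₃ F x) r₁ r₂ r₃))

fixed⇒eigenform : ∀ (T : GL₂) F → ¬ IsScalar (matrix T) → Fixes T F →
  ∃ λ x → Eigenformℚ (ιᶠ F) x (axis (matrix T)) × Pℚ.resolventAt (ιᶠ F) x ≡ 0ℚ
fixed⇒eigenform (gl T δ≢0) F ¬scalar fixes =
  ½ ℚ.* x , eigen , eigenform⇒root (ιᶠ F) (½ ℚ.* x) (axis T) nonzero eigen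
  where
  nonzero = axis-nonzero T ¬scalar
  parallel = fixed⇒parallel T δ≢0 (ιᶠ F) (twist-fixed⇒ (gl T δ≢0) (ιᶠ F) fixes)
  multiple = parallel⇒multiple (Pℚ.φ (ιᶠ F) (axis T)) (axis T) nonzero parallel
  x = proj₁ multiple
  eigen = multiple⇒eigenform (ιᶠ F) (axis T) x (proj₂ multiple)

-- `M` with the products formed in ℚ, so that the entries are polynomials in the rational
-- coefficients.
rotation : Form ℚ 2 → Mat₂
rotation (α ∷ β ∷ γ ∷ []) = mat β (ι (+ 2) ℚ.* γ) (ℚ.- (ι (+ 2) ℚ.* α)) (ℚ.- β)

private
  -- `φ F f` and `φ F f + 2x f` have the same minors with `f`, so `x` cancels on the right.
  minor₁₂-rows : ∀ a b c d e x α β γ → let F = a ∷ b ∷ c ∷ d ∷ e ∷ []; f = α ∷ β ∷ γ ∷ [] in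
    Pℚ.minor₁₂ (Pℚ.φ F f) f ≡ β ℚ.* Pℚ.row₃ F x f ℚ.+ (ι (+ 2) ℚ.* α) ℚ.* Pℚ.row₂ F x f
  minor₁₂-rows = ℚ-solve 9 (λ a b c d e x α β γ →
    let F = a ∷ b ∷ c ∷ d ∷ e ∷ []; f = α ∷ β ∷ γ ∷ [] in
    Sℚ.minor₁₂ (Sℚ.φ F f) f :≡ β :* Sℚ.row₃ F x f :+ (κ (+ 2) :* α) :* Sℚ.row₂ F x f) refl

  minor₁₃-rows : ∀ a b c d e x α β γ → let F = a ∷ b ∷ c ∷ d ∷ e ∷ []; f = α ∷ β ∷ γ ∷ [] in
    Pℚ.minor₁₃ (Pℚ.φ F f) f ≡ γ ℚ.* Pℚ.row₃ F x f ℚ.+ (ℚ.- α) ℚ.* Pℚ.row₁ F x f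
  minor₁₃-rows = ℚ-solve 9 (λ a b c d e x α β γ →
    let F = a ∷ b ∷ c ∷ d ∷ e ∷ []; f = α ∷ β ∷ γ ∷ [] in
    Sℚ.minor₁₃ (Sℚ.φ F f) f :≡ γ :* Sℚ.row₃ F x f :+ (:- α) :* Sℚ.row₁ F x f) refl

  minor₃₂-rows : ∀ a b c d e x α β γ → let F = a ∷ b ∷ c ∷ d ∷ e ∷ []; f = α ∷ β ∷ γ ∷ [] in
    Pℚ.minor₃₂ (Pℚ.φ F f) f ≡ β ℚ.* Pℚ.row₁ F x f ℚ.+ (ι (+ 2) ℚ.* γ) ℚ.* Pℚ.row₂ F x f
  minor₃₂-rows = ℚ-solve 9 (λ a b c d e x α β γ →
    let F = a ∷ b ∷ c ∷ d ∷ e ∷ []; f = α ∷ β ∷ γ ∷ [] in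
    Sℚ.minor₃₂ (Sℚ.φ F f) f :≡ β :* Sℚ.row₁ F x f :+ (κ (+ 2) :* γ) :* Sℚ.row₂ F x f) refl

  -- F∘M_f - det² F is the product of f with a form whose coefficients are
  -- combinations of these minors.
  excess₄ : ∀ a b c d e α β γ →
    let F = a ∷ b ∷ c ∷ d ∷ e ∷ []; f = α ∷ β ∷ γ ∷ []; T = rotation f; h = Pℚ.φ F f in
    ι (+ 3) ℚ.* (lookup (substitute T F) (# 0) ℚ.- det T ℚ.* det T ℚ.* a) ≡
    (ι (+ 2) ℚ.* α ℚ.* β) ℚ.* Pℚ.minor₁₂ h f ℚ.+ (ℚ.- ι (+ 4) ℚ.* α ℚ.* α) ℚ.* Pℚ.minor₁₃ h f ℚ.+
      0ℚ ℚ.* Pℚ.minor₃₂ h f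
  excess₄ = ℚ-solve 8 (λ a b c d e α β γ →
    let F = a ∷ b ∷ c ∷ d ∷ e ∷ []; f = α ∷ β ∷ γ ∷ []; T = Sℚ.rotation f; h = Sℚ.φ F f in
    (κ (+ 3)) :* (lookup (Sℚ.substitute′ T F) (# 0) :- Sℚ.det′ T :* Sℚ.det′ T :* a) :≡
    (κ (+ 2) :* α :* β) :* Sℚ.minor₁₂ h f :+ (:- κ (+ 4) :* α :* α) :* Sℚ.minor₁₃ h f :+
      κ (+ 0) :* Sℚ.minor₃₂ h f) refl

  excess₃ : ∀ a b c d e α β γ →
    let F = a ∷ b ∷ c ∷ d ∷ e ∷ []; f = α ∷ β ∷ γ ∷ []; T = rotation f; h = Pℚ.φ F f in
    ι (+ 3) ℚ.* (lookup (substitute T F) (# 1) ℚ.- det T ℚ.* det T ℚ.* b) ≡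
    (ι (+ 4) ℚ.* α ℚ.* γ ℚ.+ ι (+ 2) ℚ.* β ℚ.* β) ℚ.* Pℚ.minor₁₂ h f ℚ.+
      (ℚ.- ι (+ 4) ℚ.* α ℚ.* β) ℚ.* Pℚ.minor₁₃ h f ℚ.+ (ι (+ 4) ℚ.* α ℚ.* α) ℚ.* Pℚ.minor₃₂ h f
  excess₃ = ℚ-solve 8 (λ a b c d e α β γ →
    let F = a ∷ b ∷ c ∷ d ∷ e ∷ []; f = α ∷ β ∷ γ ∷ []; T = Sℚ.rotation f; h = Sℚ.φ F f in
    (κ (+ 3)) :* (lookup (Sℚ.substitute′ T F) (# 1) :- Sℚ.det′ T :* Sℚ.det′ T :* b) :≡
    (κ (+ 4) :* α :* γ :+ κ (+ 2) :* β :* β) :* Sℚ.minor₁₂ h f :+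
      (:- κ (+ 4) :* α :* β) :* Sℚ.minor₁₃ h f :+ (κ (+ 4) :* α :* α) :* Sℚ.minor₃₂ h f) refl

  excess₂ : ∀ a b c d e α β γ →
    let F = a ∷ b ∷ c ∷ d ∷ e ∷ []; f = α ∷ β ∷ γ ∷ []; T = rotation f; h = Pℚ.φ F f in
    ι (+ 3) ℚ.* (lookup (substitute T F) (# 2) ℚ.- det T ℚ.* det T ℚ.* c) ≡
    (ι (+ 6) ℚ.* β ℚ.* γ) ℚ.* Pℚ.minor₁₂ h f ℚ.+ 0ℚ ℚ.* Pℚ.minor₁₃ h f ℚ.+
      (ι (+ 6) ℚ.* α ℚ.* β) ℚ.* Pℚ.minor₃₂ h f
  excess₂ = ℚ-solve 8 (λ a b c d e α β γ →
    let F = a ∷ b ∷ c ∷ d ∷ e ∷ []; f = α ∷ β ∷ γ ∷ []; T = Sℚ.rotation f; h = Sℚ.φ F f in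
    (κ (+ 3)) :* (lookup (Sℚ.substitute′ T F) (# 2) :- Sℚ.det′ T :* Sℚ.det′ T :* c) :≡
    (κ (+ 6) :* β :* γ) :* Sℚ.minor₁₂ h f :+ κ (+ 0) :* Sℚ.minor₁₃ h f :+
      (κ (+ 6) :* α :* β) :* Sℚ.minor₃₂ h f) refl

  excess₁ : ∀ a b c d e α β γ →
    let F = a ∷ b ∷ c ∷ d ∷ e ∷ []; f = α ∷ β ∷ γ ∷ []; T = rotation f; h = Pℚ.φ F f in
    ι (+ 3) ℚ.* (lookup (substitute T F) (# 3) ℚ.- det T ℚ.* det T ℚ.* d) ≡
    (ι (+ 4) ℚ.* γ ℚ.* γ) ℚ.* Pℚ.minor₁₂ h f ℚ.+ (ι (+ 4) ℚ.* β ℚ.* γ) ℚ.* Pℚ.minor₁₃ h f ℚ.+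
      (ι (+ 2) ℚ.* β ℚ.* β ℚ.+ ι (+ 4) ℚ.* α ℚ.* γ) ℚ.* Pℚ.minor₃₂ h f
  excess₁ = ℚ-solve 8 (λ a b c d e α β γ →
    let F = a ∷ b ∷ c ∷ d ∷ e ∷ []; f = α ∷ β ∷ γ ∷ []; T = Sℚ.rotation f; h = Sℚ.φ F f in
    (κ (+ 3)) :* (lookup (Sℚ.substitute′ T F) (# 3) :- Sℚ.det′ T :* Sℚ.det′ T :* d) :≡
    (κ (+ 4) :* γ :* γ) :* Sℚ.minor₁₂ h f :+ (κ (+ 4) :* β :* γ) :* Sℚ.minor₁₃ h f :+
      (κ (+ 2) :* β :* β :+ κ (+ 4) :* α :* γ) :* Sℚ.minor₃₂ h f) refl

  excess₀ : ∀ a b c d e α β γ →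
    let F = a ∷ b ∷ c ∷ d ∷ e ∷ []; f = α ∷ β ∷ γ ∷ []; T = rotation f; h = Pℚ.φ F f in
    ι (+ 3) ℚ.* (lookup (substitute T F) (# 4) ℚ.- det T ℚ.* det T ℚ.* e) ≡
    0ℚ ℚ.* Pℚ.minor₁₂ h f ℚ.+ (ι (+ 4) ℚ.* γ ℚ.* γ) ℚ.* Pℚ.minor₁₃ h f ℚ.+
      (ι (+ 2) ℚ.* β ℚ.* γ) ℚ.* Pℚ.minor₃₂ h f
  excess₀ = ℚ-solve 8 (λ a b c d e α β γ →
    let F = a ∷ b ∷ c ∷ d ∷ e ∷ []; f = α ∷ β ∷ γ ∷ []; T = Sℚ.rotation f; h = Sℚ.φ F f in
    (κ (+ 3)) :* (lookup (Sℚ.substitute′ T F) (# 4) :- Sℚ.det′ T :* Sℚ.det′ T :* e) :≡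
    κ (+ 0) :* Sℚ.minor₁₂ h f :+ (κ (+ 4) :* γ :* γ) :* Sℚ.minor₁₃ h f :+
      (κ (+ 2) :* β :* γ) :* Sℚ.minor₃₂ h f) refl

  3≢0 : ι (+ 3) ≢ 0ℚ
  3≢0 ()

  cong₅ : ∀ {x₁ x₂ x₃ x₄ x₅ y₁ y₂ y₃ y₄ y₅ : ℚ} → x₁ ≡ y₁ → x₂ ≡ y₂ → x₃ ≡ y₃ → x₄ ≡ y₄ → x₅ ≡ y₅ →
          _≡_ {A = Form ℚ 4} (x₁ ∷ x₂ ∷ x₃ ∷ x₄ ∷ x₅ ∷ []) (y₁ ∷ y₂ ∷ y₃ ∷ y₄ ∷ y₅ ∷ [])
  cong₅ refl refl refl refl refl = refl

-- An eigenform is parallel to its image under φ, and the five coefficients of F∘M_f - det² F are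
-- combinations of the minors expressing this. The 3 in the excess identities clears the
-- denominators of these combinations.
eigenform⇒fixed : ∀ F x f → Eigenformℚ F x f →
  substitute (rotation f) F ≡ (det (rotation f) ℚ.* det (rotation f)) ·ᶠ F
eigenform⇒fixed F@(a ∷ b ∷ c ∷ d ∷ e ∷ []) x f@(α ∷ β ∷ γ ∷ []) (r₁ , r₂ , r₃) = cong₅
  (conclude (trans (excess₄ a b c d e α β γ)
    (combine₃ℚ (ι (+ 2) ℚ.* α ℚ.* β) (ℚ.- ι (+ 4) ℚ.* α ℚ.* α) 0ℚ m₁₂ m₁₃ m₃₂)))
  (conclude (trans (excess₃ a b c d e α β γ)
    (combine₃ℚ (ι (+ 4) ℚ.* α ℚ.* γ ℚ.+ ι (+ 2) ℚ.* β ℚ.* β) (ℚ.- ι (+ 4) ℚ.* α ℚ.* β)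
    (ι (+ 4) ℚ.* α ℚ.* α) m₁₂ m₁₃ m₃₂)))
  (conclude (trans (excess₂ a b c d e α β γ)
    (combine₃ℚ (ι (+ 6) ℚ.* β ℚ.* γ) 0ℚ (ι (+ 6) ℚ.* α ℚ.* β) m₁₂ m₁₃ m₃₂)))
  (conclude (trans (excess₁ a b c d e α β γ)
    (combine₃ℚ (ι (+ 4) ℚ.* γ ℚ.* γ) (ι (+ 4) ℚ.* β ℚ.* γ)
    (ι (+ 2) ℚ.* β ℚ.* β ℚ.+ ι (+ 4) ℚ.* α ℚ.* γ) m₁₂ m₁₃ m₃₂)))
  (conclude (trans (excess₀ a b c d e α β γ)
    (combine₃ℚ 0ℚ (ι (+ 4) ℚ.* γ ℚ.* γ) (ι (+ 2) ℚ.* β ℚ.* γ) m₁₂ m₁₃ m₃₂)))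
  where
  conclude : ∀ {p q} → ι (+ 3) ℚ.* (p ℚ.- q) ≡ 0ℚ → p ≡ q
  conclude eq = difference≡0⇒≡ (ℚ-cancel 3≢0 eq)
  m₁₂ = trans (minor₁₂-rows a b c d e x α β γ) (combine₂ℚ β (ι (+ 2) ℚ.* α) r₃ r₂)
  m₁₃ = trans (minor₁₃-rows a b c d e x α β γ) (combine₂ℚ γ (ℚ.- α) r₃ r₁)
  m₃₂ = trans (minor₃₂-rows a b c d e x α β γ) (combine₂ℚ β (ι (+ 2) ℚ.* γ) r₁ r₂)

-- Integrality of rational roots

clear-denominator : ∀ p d .(c : Coprime ℤ.∣ p ∣ (suc d)) → mkℚ p d c ℚ.* ι (+ suc d) ≡ ι p
clear-denominator p d c = ℚₚ.toℚᵘ-injective (ℚᵘₚ.≃-trans (ℚₚ.toℚᵘ-homo-* (mkℚ p d c) (ι (+ suc d)))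
  (ℚᵘₚ.≃-trans (ℚᵘₚ.*-congˡ {mkℚᵘ p d} (ι-toℚᵘ (+ suc d)))
    (ℚᵘₚ.≃-trans (*≡* (trans (ℤₚ.*-identityʳ (p ℤ.* + suc d))
        (cong (λ n → p ℤ.* + n) (sym (ℕₚ.*-identityʳ (suc d))))))
      (ℚᵘₚ.≃-sym (ι-toℚᵘ p)))))

denominator∣cube⇒denominator≡1 : ∀ {m d} → Coprime m (suc d) → suc d ℕ.∣ m ℕ.* (m ℕ.* m) → d ≡ 0
denominator∣cube⇒denominator≡1 {m} {d} c d∣m³ = ℕₚ.suc-injective (ℕ.∣1⇒≡1
  (strip (subst (suc d ℕ.∣_) (sym (ℕₚ.*-identityʳ m)) (strip (strip d∣m³)))))
  where
  strip : ∀ {o} → suc d ℕ.∣ m ℕ.* o → suc d ℕ.∣ o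
  strip = coprime-divisor (Coprimality.sym c)

-- With x = p/q in lowest terms the equation reads p³ = q(upq - wq²). So q divides p³, and being
-- coprime to p it is 1.
integral-root : ∀ u w x → Pℚ.cubic (ι u) (ι w) x ≡ 0ℚ → ∃ λ n → x ≡ ι n
integral-root u w x@(mkℚ p d c) root = p , x≡ιp
  where
  q = + suc d

  homogenise : ∀ x q u w → Pℚ.cubic u w x ℚ.* (q ℚ.* q ℚ.* q) ≡
    (x ℚ.* q) ℚ.* (x ℚ.* q) ℚ.* (x ℚ.* q) ℚ.+
      (ℚ.- (q ℚ.* (u ℚ.* (x ℚ.* q) ℚ.* q ℚ.+ ℚ.- (w ℚ.* q ℚ.* q))))
  homogenise = ℚ-solve 4 (λ x q u w →
    Sℚ.cubic u w x :* (q :* q :* q) :≡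
    (x :* q) :* (x :* q) :* (x :* q) :+ (:- (q :* (u :* (x :* q) :* q :+ :- (w :* q :* q))))) refl

  s = u ℤ.* p ℤ.* q ℤ.+ ℤ.- (w ℤ.* q ℤ.* q)

  difference : p ℤ.* p ℤ.* p ℤ.+ ℤ.- (q ℤ.* s) ≡ 0ℤ
  difference = ι-injective (trans
    (ι-homo (leaf p ⊠ leaf p ⊠ leaf p ⊞ ⊟
    (leaf q ⊠ (leaf u ⊠ leaf p ⊠ leaf q ⊞ ⊟ (leaf w ⊠ leaf q ⊠ leaf q)))))
    (trans (cong (λ t → t ℚ.* t ℚ.* t ℚ.+
      (ℚ.- (ι q ℚ.* (ι u ℚ.* t ℚ.* ι q ℚ.+ ℚ.- (ι w ℚ.* ι q ℚ.* ι q)))))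
             (sym (clear-denominator p d c)))
      (trans (sym (homogenise x (ι q) (ι u) (ι w)))
        (trans (cong (ℚ._* (ι q ℚ.* ι q ℚ.* ι q)) root) (ℚₚ.*-zeroˡ (ι q ℚ.* ι q ℚ.* ι q))))))

  p³≡qs : p ℤ.* p ℤ.* p ≡ q ℤ.* s
  p³≡qs = ℤₚ.i-j≡0⇒i≡j _ _ difference

  d≡0 : d ≡ 0
  -- The coprimality proof stored in a rational is irrelevant; decidability recovers a usable one.
  d≡0 = denominator∣cube⇒denominator≡1 (Coprimality.recompute c)
    (ℕ.divides ℤ.∣ s ∣ (trans (trans (cong (ℤ.∣ p ∣ ℕ.*_) (sym (ℤₚ.abs-* p p)))
      (trans (sym (ℤₚ.abs-* p (p ℤ.* p)))
      (cong ℤ.∣_∣ (trans (sym (ℤₚ.*-assoc p p p)) p³≡qs))))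
      (trans (ℤₚ.abs-* q s) (ℕₚ.*-comm (suc d) ℤ.∣ s ∣))))

  x≡ιp : x ≡ ι p
  -- `d ≡ 0` is applied to the multiplier only, where `ι 1ℤ` computes to `1ℚ`; rewriting inside
  -- `mkℚ p d c` would involve the proof `c`.
  x≡ιp = trans (sym (ℚₚ.*-identityʳ x))
    (trans (cong (λ d → x ℚ.* ι (+ suc d)) (sym d≡0)) (clear-denominator p d c))

resolvent-root-integral : ∀ F x → Pℚ.resolventAt (ιᶠ F) x ≡ 0ℚ → ∃ λ n → x ≡ ι n × Root F n
resolvent-root-integral F@(a ∷ b ∷ c ∷ d ∷ e ∷ []) x root = n , x≡n ,
  ι-injective (trans (resolvent-ι F n) (trans (cong (Pℚ.resolventAt (ιᶠ F)) (sym x≡n)) root))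
  where
  Fᴱ = Vec.map leaf F
  integral = integral-root (+ 3 ℤ.* Pℤ.invI F) (Pℤ.invJ F) x
    (trans (cong₂ (λ u w → Pℚ.cubic u w x) (ι-homo (leaf (+ 3) ⊠ Pᴱ.invI Fᴱ))
      (ι-homo (Pᴱ.invJ Fᴱ))) root)
  n = proj₁ integral
  x≡n = proj₂ integral

-- The matrices M_f of integral forms

M-rotation : ∀ f → M f ≡ rotation (ιᶠ f)
M-rotation (α ∷ β ∷ γ ∷ []) = cong₃ (sym (ι-* (+ 2) γ))
    (trans (ι-neg (+ 2 ℤ.* α)) (cong ℚ.-_ (sym (ι-* (+ 2) α)))) (ι-neg β)
  where
  cong₃ : ∀ {p q q′ r r′ s s′} → q ≡ q′ → r ≡ r′ → s ≡ s′ → mat p q r s ≡ mat p q′ r′ s′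
  cong₃ refl refl refl = refl

-- M_f has trace zero and so equals its own traceless part; since `axis` is normalised by T = (tr T
-- + M)/2 it returns 2f, and `eigenform-halve` removes the 2.
axis-rotation : ∀ α β γ → axis (rotation (α ∷ β ∷ γ ∷ [])) ≡ (ι (+ 2) ·ᶠ (α ∷ β ∷ γ ∷ []))
axis-rotation α β γ = cong₃ (entry₁ α) (entry₂ β)
  where
  entry₁ : ∀ α → ℚ.- (ℚ.- (ι (+ 2) ℚ.* α)) ≡ ι (+ 2) ℚ.* α
  entry₁ = solve-∀ ℚ-ring
  entry₂ : ∀ β → β ℚ.- (ℚ.- β) ≡ ι (+ 2) ℚ.* β
  entry₂ = solve-∀ ℚ-ring
  cong₃ : ∀ {p p′ q q′ r : ℚ} → p ≡ p′ → q ≡ q′ → _≡_ {A = Form ℚ 2} (p ∷ q ∷ r ∷ [])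
    (p′ ∷ q′ ∷ r ∷ [])
  cong₃ refl refl = refl

-- This turns (3) into (2). Equal diagonal entries give β = -β, and the upper right entry gives γ =
-- 0; together they kill β² - 4αγ.
M-not-scalar : ∀ f → disc₂ f ≢ 0ℤ → ¬ IsScalar (M f)
M-not-scalar f@(α ∷ β ∷ γ ∷ []) Δ≢0 (c , eq) = Δ≢0 (Δ≡0 β≡0 γ≡0)
  where
  ιβ≡ι-β : ι β ≡ ι (ℤ.- β)
  ιβ≡ι-β = trans (cong Mat₂.t₁ eq) (sym (cong Mat₂.t₄ eq))
  2β : ∀ β → + 2 ℤ.* β ≡ β ℤ.- (ℤ.- β)
  2β = ℤRing.solve-∀
  halve : ∀ i → + 2 ℤ.* i ≡ 0ℤ → i ≡ 0ℤ
  halve i eq = ℤₚ.*-cancelˡ-≡ (+ 2) i 0ℤ eq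
  β≡0 : β ≡ 0ℤ
  β≡0 = halve β (trans (2β β) (ℤₚ.i≡j⇒i-j≡0 (ι-injective {β} {ℤ.- β} ιβ≡ι-β)))
  γ≡0 : γ ≡ 0ℤ
  γ≡0 = halve γ (ι-injective (cong Mat₂.t₂ eq))
  Δ≡0 : β ≡ 0ℤ → γ ≡ 0ℤ → disc₂ f ≡ 0ℤ
  Δ≡0 refl refl = lemma α
    where
    lemma : ∀ α → disc₂ (α ∷ 0ℤ ∷ 0ℤ ∷ []) ≡ 0ℤ
    lemma = ℤ-solve 1 (λ α →
      Sℤ.disc (α ∷ Κ (+ 0) ∷ Κ (+ 0) ∷ []) :≡ Κ (+ 0)) refl

private
  row₁-double : ∀ a b c d e x α β γ → let F = a ∷ b ∷ c ∷ d ∷ e ∷ []; f = α ∷ β ∷ γ ∷ [] in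
    Pℚ.row₁ F x (ι (+ 2) ·ᶠ f) ≡ ι (+ 2) ℚ.* Pℚ.row₁ F x f
  row₁-double = ℚ-solve 9 (λ a b c d e x α β γ →
    let F = a ∷ b ∷ c ∷ d ∷ e ∷ []; f = α ∷ β ∷ γ ∷ [] in
    Sℚ.row₁ F x (κ (+ 2) Sℚ.· f) :≡ κ (+ 2) :* Sℚ.row₁ F x f) refl
  row₂-double : ∀ a b c d e x α β γ → let F = a ∷ b ∷ c ∷ d ∷ e ∷ []; f = α ∷ β ∷ γ ∷ [] in
    Pℚ.row₂ F x (ι (+ 2) ·ᶠ f) ≡ ι (+ 2) ℚ.* Pℚ.row₂ F x f
  row₂-double = ℚ-solve 9 (λ a b c d e x α β γ →
    let F = a ∷ b ∷ c ∷ d ∷ e ∷ []; f = α ∷ β ∷ γ ∷ [] in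
    Sℚ.row₂ F x (κ (+ 2) Sℚ.· f) :≡ κ (+ 2) :* Sℚ.row₂ F x f) refl
  row₃-double : ∀ a b c d e x α β γ → let F = a ∷ b ∷ c ∷ d ∷ e ∷ []; f = α ∷ β ∷ γ ∷ [] in
    Pℚ.row₃ F x (ι (+ 2) ·ᶠ f) ≡ ι (+ 2) ℚ.* Pℚ.row₃ F x f
  row₃-double = ℚ-solve 9 (λ a b c d e x α β γ →
    let F = a ∷ b ∷ c ∷ d ∷ e ∷ []; f = α ∷ β ∷ γ ∷ [] in
    Sℚ.row₃ F x (κ (+ 2) Sℚ.· f) :≡ κ (+ 2) :* Sℚ.row₃ F x f) refl

eigenform-halve : ∀ F x f → Eigenformℚ F x (ι (+ 2) ·ᶠ f) → Eigenformℚ F x f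
eigenform-halve (a ∷ b ∷ c ∷ d ∷ e ∷ []) x (α ∷ β ∷ γ ∷ []) (r₁ , r₂ , r₃) =
    ℚ-cancel 2≢0 (trans (sym (row₁-double a b c d e x α β γ)) r₁)
  , ℚ-cancel 2≢0 (trans (sym (row₂-double a b c d e x α β γ)) r₂)
  , ℚ-cancel 2≢0 (trans (sym (row₃-double a b c d e x α β γ)) r₃)

fixed⇒root : ∀ (T : GL₂) F → ¬ IsScalar (matrix T) → Fixes T F → ∃ (Root F)
fixed⇒root T F ¬scalar fixes =
  let x , _ , root = fixed⇒eigenform T F ¬scalar fixes
      n , _ , rootₙ = resolvent-root-integral F x root
  in n , rootₙ

-- Reads (3) as an instance of (2) with T = M_f, so that every form to be counted is attached to an
-- integral root.
stabilises⇒eigenform : ∀ f F → Stabilises f F → ∃ λ n → Root F n × Eigenformℤ F n f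
stabilises⇒eigenform f@(α ∷ β ∷ γ ∷ []) F (_ , Δ≢0 , fixes) =
  let x , eigen , root = fixed⇒eigenform (M-GL₂ f Δ≢0) F (M-not-scalar f Δ≢0) fixes
      n , x≡n , rootₙ = resolvent-root-integral F x root
      axis≡2f = trans (cong axis (M-rotation f)) (axis-rotation (ι α) (ι β) (ι γ))
  in n , rootₙ , Eigenform-ι⁻¹ F n f (eigenform-halve (ιᶠ F) (ι n) (ιᶠ f)
       (subst₂ (Eigenformℚ (ιᶠ F)) x≡n axis≡2f eigen))

eigenform⇒stabilises : ∀ f F n → Primitive f → disc₂ f ≢ 0ℤ → Eigenformℤ F n f → Stabilises f F
eigenform⇒stabilises f F n prim Δ≢0 eigen = prim , Δ≢0 ,
  twist-fixed⇐ (M-GL₂ f Δ≢0) (ιᶠ F)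
    (subst (λ T → substitute T (ιᶠ F) ≡ (det T ℚ.* det T) ·ᶠ ιᶠ F) (sym (M-rotation f))
      (eigenform⇒fixed (ιᶠ F) (ι n) (ιᶠ f) (Eigenform-ι F n f eigen)))

-- Polynomials over ℚ

coeff-⊕ : ∀ p q n → coeff (p ⊕ q) n ≡ coeff p n ℚ.+ coeff q n
coeff-⊕ []      q       n       = sym (ℚₚ.+-identityˡ (coeff q n))
coeff-⊕ (a ∷ p) []      n       = sym (ℚₚ.+-identityʳ (coeff (a ∷ p) n))
coeff-⊕ (a ∷ p) (b ∷ q) zero    = refl
coeff-⊕ (a ∷ p) (b ∷ q) (suc n) = coeff-⊕ p q n

coeff-map : ∀ a q n → coeff (List.map (a ℚ.*_) q) n ≡ a ℚ.* coeff q n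
coeff-map a []      n       = sym (ℚₚ.*-zeroʳ a)
coeff-map a (b ∷ q) zero    = refl
coeff-map a (b ∷ q) (suc n) = coeff-map a q n

coeff-⊗-suc : ∀ a p q n → coeff ((a ∷ p) ⊗ q) (suc n) ≡ a ℚ.* coeff q (suc n) ℚ.+ coeff (p ⊗ q) n
coeff-⊗-suc a p q n = trans (coeff-⊕ (List.map (a ℚ.*_) q) (0ℚ ∷ (p ⊗ q)) (suc n))
  (cong (ℚ._+ coeff (p ⊗ q) n) (coeff-map a q (suc n)))

coeff-⊗-zero : ∀ a p q → coeff ((a ∷ p) ⊗ q) zero ≡ a ℚ.* coeff q zero
coeff-⊗-zero a p q = trans (coeff-⊕ (List.map (a ℚ.*_) q) (0ℚ ∷ (p ⊗ q)) zero)
  (trans (ℚₚ.+-identityʳ _) (coeff-map a q zero))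

≈0-⊗ : ∀ p q → (∀ n → coeff p n ≡ 0ℚ) → ∀ n → coeff (p ⊗ q) n ≡ 0ℚ
≈0-⊗ []      q p≈0 n       = refl
≈0-⊗ (a ∷ p) q p≈0 zero    = trans (coeff-⊗-zero a p q)
  (trans (cong (ℚ._* coeff q zero) (p≈0 zero)) (ℚₚ.*-zeroˡ (coeff q zero)))
≈0-⊗ (a ∷ p) q p≈0 (suc n) = trans (coeff-⊗-suc a p q n)
  (trans (cong₂ ℚ._+_ (trans (cong (ℚ._* coeff q (suc n)) (p≈0 zero))
    (ℚₚ.*-zeroˡ (coeff q (suc n))))
                      (≈0-⊗ p q (λ m → p≈0 (suc m)) n))
    (ℚₚ.+-identityˡ 0ℚ))

VanishesAbove : Poly → ℕ → Set
VanishesAbove p d = ∀ n → d ℕ.< n → coeff p n ≡ 0ℚ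

-- Upper bounds in place of degrees survive the passage to the tail of `p`, and tolerate trailing
-- zeros.
coeff-⊗-top : ∀ p q d e → VanishesAbove p d → VanishesAbove q e →
              coeff (p ⊗ q) (d ℕ.+ e) ≡ coeff p d ℚ.* coeff q e
coeff-⊗-top []      q d       e       vp vq = sym (ℚₚ.*-zeroˡ (coeff q e))
coeff-⊗-top (a ∷ p) q zero    zero    vp vq = coeff-⊗-zero a p q
coeff-⊗-top (a ∷ p) q zero    (suc e) vp vq = trans (coeff-⊗-suc a p q e)
  (trans (cong (a ℚ.* coeff q (suc e) ℚ.+_) (≈0-⊗ p q (λ n → vp (suc n) (s≤s z≤n)) e))
    (ℚₚ.+-identityʳ (a ℚ.* coeff q (suc e))))
coeff-⊗-top (a ∷ p) q (suc d) e       vp vq = trans (coeff-⊗-suc a p q (d ℕ.+ e))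
  (trans (cong₂ ℚ._+_
      (trans (cong (a ℚ.*_) (vq (suc (d ℕ.+ e)) (s≤s (ℕₚ.m≤n+m e d)))) (ℚₚ.*-zeroʳ a))
      (coeff-⊗-top p q d e (λ n d<n → vp (suc n) (s≤s d<n)) vq))
    (ℚₚ.+-identityˡ (coeff p d ℚ.* coeff q e)))

HasDegree : Poly → ℕ → Set
HasDegree p d = coeff p d ≢ 0ℚ × VanishesAbove p d

degree-or-zero : ∀ p → ∃ (HasDegree p) ⊎ (∀ n → coeff p n ≡ 0ℚ)
degree-or-zero [] = inj₂ λ _ → refl
degree-or-zero (a ∷ p) with degree-or-zero p
... | inj₁ (d , p[d]≢0 , vanishes) = inj₁
  (suc d , p[d]≢0 , λ { (suc n) (s≤s d<n) → vanishes n d<n })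
... | inj₂ p≈0 with a ℚ.≟ 0ℚ
...   | yes a≡0 = inj₂ λ { zero → a≡0 ; (suc n) → p≈0 n }
...   | no  a≢0 = inj₁ (zero , a≢0 , λ { (suc n) _ → p≈0 n })

nonConstant⇒degree : ∀ p → NonConstant p → ∃ λ d → HasDegree p (suc d)
nonConstant⇒degree p (n , p[1+n]≢0) with degree-or-zero p
... | inj₁ (suc d , degree)        = d , degree
... | inj₁ (zero , _ , vanishes)   = contradiction (vanishes (suc n) (s≤s z≤n)) p[1+n]≢0
... | inj₂ p≈0                     = contradiction (p≈0 (suc n)) p[1+n]≢0

eval : Poly → ℚ → ℚ
eval []      x = 0ℚ
eval (a ∷ p) x = a ℚ.+ x ℚ.* eval p x

eval-≈0 : ∀ p x → (∀ n → coeff p n ≡ 0ℚ) → eval p x ≡ 0ℚ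
eval-≈0 []      x p≈0 = refl
eval-≈0 (a ∷ p) x p≈0 = trans
  (cong₂ ℚ._+_ (p≈0 zero) (trans (cong (x ℚ.*_) (eval-≈0 p x (λ n → p≈0 (suc n)))) (ℚₚ.*-zeroʳ x)))
  (ℚₚ.+-identityˡ 0ℚ)

eval-≈ : ∀ p q x → p ≈ q → eval p x ≡ eval q x
eval-≈ []      q       x p≈q = sym (eval-≈0 q x (λ n → sym (p≈q n)))
eval-≈ (a ∷ p) []      x p≈q = eval-≈0 (a ∷ p) x p≈q
eval-≈ (a ∷ p) (b ∷ q) x p≈q =
  cong₂ (λ s t → s ℚ.+ x ℚ.* t) (p≈q zero) (eval-≈ p q x (λ n → p≈q (suc n)))

eval-⊕ : ∀ p q x → eval (p ⊕ q) x ≡ eval p x ℚ.+ eval q x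
eval-⊕ []      q       x = sym (ℚₚ.+-identityˡ (eval q x))
eval-⊕ (a ∷ p) []      x = sym (ℚₚ.+-identityʳ (eval (a ∷ p) x))
eval-⊕ (a ∷ p) (b ∷ q) x = trans (cong (λ t → a ℚ.+ b ℚ.+ x ℚ.* t) (eval-⊕ p q x))
  (regroup a b x (eval p x) (eval q x))
  where
  regroup : ∀ a b x s t → a ℚ.+ b ℚ.+ x ℚ.* (s ℚ.+ t) ≡ (a ℚ.+ x ℚ.* s) ℚ.+ (b ℚ.+ x ℚ.* t)
  regroup = solve-∀ ℚ-ring

eval-map : ∀ a q x → eval (List.map (a ℚ.*_) q) x ≡ a ℚ.* eval q x
eval-map a []      x = sym (ℚₚ.*-zeroʳ a)
eval-map a (b ∷ q) x = trans (cong (λ t → a ℚ.* b ℚ.+ x ℚ.* t) (eval-map a q x))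
  (regroup a b x (eval q x))
  where
  regroup : ∀ a b x t → a ℚ.* b ℚ.+ x ℚ.* (a ℚ.* t) ≡ a ℚ.* (b ℚ.+ x ℚ.* t)
  regroup = solve-∀ ℚ-ring

eval-⊗ : ∀ p q x → eval (p ⊗ q) x ≡ eval p x ℚ.* eval q x
eval-⊗ []      q x = sym (ℚₚ.*-zeroˡ (eval q x))
eval-⊗ (a ∷ p) q x = trans (eval-⊕ (List.map (a ℚ.*_) q) (0ℚ ∷ (p ⊗ q)) x)
  (trans (cong₂ (λ s t → s ℚ.+ (0ℚ ℚ.+ x ℚ.* t)) (eval-map a q x) (eval-⊗ p q x))
    (regroup a x (eval p x) (eval q x)))
  where
  regroup : ∀ a x s t → a ℚ.* t ℚ.+ (0ℚ ℚ.+ x ℚ.* (s ℚ.* t)) ≡ (a ℚ.+ x ℚ.* s) ℚ.* t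
  regroup = solve-∀ ℚ-ring

linear-root : ∀ p → HasDegree p 1 → ∃ λ x → eval p x ≡ 0ℚ
linear-root []          (0≢0 , _) = contradiction refl 0≢0
linear-root (a ∷ [])    (0≢0 , _) = contradiction refl 0≢0
linear-root (a ∷ b ∷ p) (b≢0 , vanishes) =
  let x , eq = ℚ-quotient b≢0 a in x ,
    trans (cong (λ t → a ℚ.+ x ℚ.* (b ℚ.+ x ℚ.* t))
            (eval-≈0 p x (λ n → vanishes (suc (suc n)) (s≤s (s≤s z≤n)))))
      (trans (simplify a b x) eq)
  where
  simplify : ∀ a b x → a ℚ.+ x ℚ.* (b ℚ.+ x ℚ.* 0ℚ) ≡ a ℚ.+ x ℚ.* b
  simplify = solve-∀ ℚ-ring

-- Two factors of degree at least 2 would leave a nonzero coefficient in position 4 or higher; so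
-- one factor is linear, and its root is a root of `p`.
cubic-reducible⇒root : ∀ p → VanishesAbove p 3 → Reducible p → ∃ λ x → eval p x ≡ 0ℚ
cubic-reducible⇒root p vanishes (g , h , g-nonconst , h-nonconst , p≈gh) =
  split (nonConstant⇒degree g g-nonconst) (nonConstant⇒degree h h-nonconst)
  where
  eval-p : ∀ x → eval p x ≡ eval g x ℚ.* eval h x
  eval-p x = trans (eval-≈ p (g ⊗ h) x p≈gh) (eval-⊗ g h x)

  split : (∃ λ d → HasDegree g (suc d)) → (∃ λ e → HasDegree h (suc e)) → ∃ λ x → eval p x ≡ 0ℚ
  split (zero , degree-g) _ =
    let x , root = linear-root g degree-g in
    x , trans (eval-p x) (trans (cong (ℚ._* eval h x) root) (ℚₚ.*-zeroˡ (eval h x)))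
  split (suc d , _) (zero , degree-h) =
    let x , root = linear-root h degree-h in
    x , trans (eval-p x) (trans (cong (eval g x ℚ.*_) root) (ℚₚ.*-zeroʳ (eval g x)))
  split (suc d , g≢0 , vanishes-g) (suc e , h≢0 , vanishes-h) = contradiction
    (ℚ-cancel g≢0 (trans (sym (coeff-⊗-top g h (suc (suc d)) (suc (suc e)) vanishes-g vanishes-h))
      (trans (sym (p≈gh (suc (suc d) ℕ.+ suc (suc e))))
        (vanishes (suc (suc d) ℕ.+ suc (suc e))
          -- 3 < (2 + d) + (2 + e), read as 2 + 2 ≤ (2 + d) + (2 + e).
          (ℕₚ.+-mono-≤ {2} (s≤s (s≤s z≤n)) (s≤s (s≤s z≤n)))))))
    h≢0

depressed-root⇒reducible : ∀ u w x → Pℚ.cubic u w x ≡ 0ℚ → Reducible (w ∷ ℚ.- u ∷ 0ℚ ∷ 1ℚ ∷ [])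
depressed-root⇒reducible u w x root =
  -- Division by X - x: the quotient is X² + xX + (x² - u), and the remainder is the value
  -- `cubic u w x`.
  ℚ.- x ∷ 1ℚ ∷ [] , x ℚ.* x ℚ.- u ∷ x ∷ 1ℚ ∷ [] , (0 , λ ()) , (1 , λ ()) , coefficients
  where
  c₀ : ∀ u w x → w ≡ (ℚ.- x ℚ.* (x ℚ.* x ℚ.- u) ℚ.+ 0ℚ) ℚ.+ Pℚ.cubic u w x
  c₀ = ℚ-solve 3 (λ u w x →
    w :≡ (:- x :* (x :* x :- u) :+ κ (+ 0)) :+ Sℚ.cubic u w x) refl
  c₁ : ∀ u x → ℚ.- u ≡ ℚ.- x ℚ.* x ℚ.+ (1ℚ ℚ.* (x ℚ.* x ℚ.- u) ℚ.+ 0ℚ)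
  c₁ = solve-∀ ℚ-ring
  c₂ : ∀ x → 0ℚ ≡ ℚ.- x ℚ.* 1ℚ ℚ.+ 1ℚ ℚ.* x
  c₂ = solve-∀ ℚ-ring
  coefficients : (w ∷ ℚ.- u ∷ 0ℚ ∷ 1ℚ ∷ []) ≈ (ℚ.- x ∷ 1ℚ ∷ []) ⊗ (x ℚ.* x ℚ.- u ∷ x ∷ 1ℚ ∷ [])
  coefficients 0 = trans (c₀ u w x) (trans (cong ((ℚ.- x ℚ.* (x ℚ.* x ℚ.- u) ℚ.+ 0ℚ) ℚ.+_) root)
    (ℚₚ.+-identityʳ _))
  coefficients 1 = c₁ u x
  coefficients 2 = c₂ x
  coefficients 3 = refl
  coefficients (suc (suc (suc (suc n)))) = refl

private
  resolvent-list : ∀ F → resolvent F ≡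
    Pℚ.invJ (ιᶠ F) ∷ ℚ.- (ι (+ 3) ℚ.* Pℚ.invI (ιᶠ F)) ∷ 0ℚ ∷ 1ℚ ∷ []
  resolvent-list F@(a ∷ b ∷ c ∷ d ∷ e ∷ []) =
    cong₂ (λ s t → s ∷ t ∷ 0ℚ ∷ 1ℚ ∷ []) (ι-homo (Pᴱ.invJ Fᴱ))
      (ι-homo (⊟ (leaf (+ 3) ⊠ Pᴱ.invI Fᴱ)))
    where Fᴱ = Vec.map leaf F

  eval-depressed : ∀ u w x → eval (w ∷ ℚ.- u ∷ 0ℚ ∷ 1ℚ ∷ []) x ≡ Pℚ.cubic u w x
  eval-depressed = ℚ-solve 3 (λ u w x →
    w :+ x :* (:- u :+ x :* (κ (+ 0) :+ x :* (κ (+ 1) :+ x :* κ (+ 0)))) :≡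
      Sℚ.cubic u w x) refl

reducible⇒root : ∀ F → Reducible (resolvent F) → ∃ (Root F)
reducible⇒root F@(_ ∷ _ ∷ _ ∷ _ ∷ _ ∷ []) reducible =
  let x , eq = cubic-reducible⇒root (resolvent F)
                 (λ { _ (s≤s (s≤s (s≤s (s≤s _)))) → refl }) reducible
      n , _ , root = resolvent-root-integral F x
        (trans (sym (eval-depressed (ι (+ 3) ℚ.* Pℚ.invI (ιᶠ F)) (Pℚ.invJ (ιᶠ F)) x))
          (trans (cong (λ p → eval p x) (sym (resolvent-list F))) eq))
  in n , root

root⇒reducible : ∀ F → ∃ (Root F) → Reducible (resolvent F)
root⇒reducible F@(_ ∷ _ ∷ _ ∷ _ ∷ _ ∷ []) (n , root) = subst Reducible (sym (resolvent-list F))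
  (depressed-root⇒reducible _ _ (ι n) (trans (sym (resolvent-ι F n)) (cong ι root)))

-- The eigenform of a root

ℤ-cancel : ∀ {i j} → i ≢ 0ℤ → i ℤ.* j ≡ 0ℤ → j ≡ 0ℤ
ℤ-cancel {i} i≢0 ij≡0 = [ (λ i≡0 → contradiction i≡0 i≢0) , id ]′ (ℤₚ.i*j≡0⇒i≡0∨j≡0 i ij≡0)

product≢0 : ∀ i j → i ≢ 0ℤ → j ≢ 0ℤ → i ℤ.* j ≢ 0ℤ
product≢0 i j i≢0 j≢0 ij≡0 = j≢0 (ℤ-cancel i≢0 ij≡0)

combine₂ℤ : ∀ u v {x y} → x ≡ 0ℤ → y ≡ 0ℤ → u ℤ.* x ℤ.+ v ℤ.* y ≡ 0ℤ
combine₂ℤ u v refl refl = lemma u v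
  where
  lemma : ∀ u v → u ℤ.* 0ℤ ℤ.+ v ℤ.* 0ℤ ≡ 0ℤ
  lemma = ℤRing.solve-∀

multiple≡0 : ∀ u {x} → x ≡ 0ℤ → u ℤ.* x ≡ 0ℤ
multiple≡0 u refl = ℤₚ.*-zeroʳ u

-- For identities that hold only modulo the resolvent, with `z` its value at a root.
drop-multiple : ∀ {x y z} u → x ≡ y ℤ.+ u ℤ.* z → z ≡ 0ℤ → x ≡ y
drop-multiple {y = y} u eq z≡0 = trans eq
  (trans (cong (λ t → y ℤ.+ t) (multiple≡0 u z≡0)) (ℤₚ.+-identityʳ y))

gcd₃ : ℕ → ℕ → ℕ → ℕ
gcd₃ l m n = ℕ.gcd l (ℕ.gcd m n)

*-gcd₃ : ∀ c l m n → c ℕ.* gcd₃ l m n ≡ gcd₃ (c ℕ.* l) (c ℕ.* m) (c ℕ.* n)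
*-gcd₃ c l m n = trans (ℕ.c*gcd[m,n]≡gcd[cm,cn] c l (ℕ.gcd m n))
  (cong (ℕ.gcd (c ℕ.* l)) (ℕ.c*gcd[m,n]≡gcd[cm,cn] c m n))

infixr 7 _·ᶻ_
_·ᶻ_ : ∀ {n} → ℤ → Form ℤ n → Form ℤ n
k ·ᶻ f = Vec.map (k ℤ.*_) f

-- `k` is the content g of `v`. Since g·gcd(quotients) = gcd(v) = g, cancelling g shows the
-- quotients coprime; the nonzero coordinate gives g ≠ 0.
primitive-part : ∀ v → (j : Fin 3) → lookup v j ≢ 0ℤ → ∃₂ λ k f → k ≢ 0ℤ × Primitive f × v ≡ k ·ᶻ f
primitive-part v@(α ∷ β ∷ γ ∷ []) j v[j]≢0 = + g , α′ ∷ β′ ∷ γ′ ∷ [] , +g≢0 ,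
  cong +_ (ℕₚ.*-cancelˡ-≡ _ _ g {{ℕ.≢-nonZero g≢0}}
    (trans gcd-quotients (sym (ℕₚ.*-identityʳ g)))) ,
  cong₃ (trans (Signed._∣_.equality g∣α) (ℤₚ.*-comm α′ (+ g)))
        (trans (Signed._∣_.equality g∣β) (ℤₚ.*-comm β′ (+ g)))
        (trans (Signed._∣_.equality g∣γ) (ℤₚ.*-comm γ′ (+ g)))
  where
  cong₃ : ∀ {x x′ y y′ z z′ : ℤ} → x ≡ x′ → y ≡ y′ → z ≡ z′ →
          _≡_ {A = Form ℤ 2} (x ∷ y ∷ z ∷ []) (x′ ∷ y′ ∷ z′ ∷ [])
  cong₃ refl refl refl = refl

  g = gcd₃ ℤ.∣ α ∣ ℤ.∣ β ∣ ℤ.∣ γ ∣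
  g′∣ = ℕ.gcd[m,n]∣n ℤ.∣ α ∣ (ℕ.gcd ℤ.∣ β ∣ ℤ.∣ γ ∣)

  g∣α : + g Signed.∣ α
  g∣α = Signed.∣ᵤ⇒∣ (ℕ.gcd[m,n]∣m ℤ.∣ α ∣ (ℕ.gcd ℤ.∣ β ∣ ℤ.∣ γ ∣))
  g∣β : + g Signed.∣ β
  g∣β = Signed.∣ᵤ⇒∣ (ℕ.∣-trans g′∣ (ℕ.gcd[m,n]∣m ℤ.∣ β ∣ ℤ.∣ γ ∣))
  g∣γ : + g Signed.∣ γ
  g∣γ = Signed.∣ᵤ⇒∣ (ℕ.∣-trans g′∣ (ℕ.gcd[m,n]∣n ℤ.∣ β ∣ ℤ.∣ γ ∣))

  α′ = Signed.quotient g∣α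
  β′ = Signed.quotient g∣β
  γ′ = Signed.quotient g∣γ

  abs : ∀ {i} (g∣i : + g Signed.∣ i) → g ℕ.* ℤ.∣ Signed.quotient g∣i ∣ ≡ ℤ.∣ i ∣
  abs {i} (Signed.divides q eq) = trans (ℕₚ.*-comm g ℤ.∣ q ∣)
    (trans (sym (ℤₚ.abs-* q (+ g))) (cong ℤ.∣_∣ (sym eq)))

  gcd-quotients : g ℕ.* gcd₃ ℤ.∣ α′ ∣ ℤ.∣ β′ ∣ ℤ.∣ γ′ ∣ ≡ g
  gcd-quotients = trans (*-gcd₃ g ℤ.∣ α′ ∣ ℤ.∣ β′ ∣ ℤ.∣ γ′ ∣)
    (trans (cong₂ (λ m n → gcd₃ m n (g ℕ.* ℤ.∣ γ′ ∣)) (abs g∣α) (abs g∣β))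
      (cong (gcd₃ ℤ.∣ α ∣ ℤ.∣ β ∣) (abs g∣γ)))

  g≢0 : g ≢ 0
  g≢0 g≡0 = v[j]≢0 (all j)
    where
    multiple-of-zero : ∀ {i} → + g Signed.∣ i → i ≡ 0ℤ
    multiple-of-zero {i} g∣i = Signed.0∣⇒≡0 (subst (λ n → + n Signed.∣ i) g≡0 g∣i)
    all : ∀ j → lookup v j ≡ 0ℤ
    all zero             = multiple-of-zero g∣α
    all (suc zero)       = multiple-of-zero g∣β
    all (suc (suc zero)) = multiple-of-zero g∣γ

  +g≢0 : + g ≢ 0ℤ
  +g≢0 eq = g≢0 (ℤₚ.+-injective eq)

∣i∣≡∣j∣⇒i≡±j : ∀ i j → ℤ.∣ i ∣ ≡ ℤ.∣ j ∣ → i ≡ j ⊎ i ≡ ℤ.- j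
∣i∣≡∣j∣⇒i≡±j i j eq with ℤₚ.+∣i∣≡i⊎+∣i∣≡-i i | ℤₚ.+∣i∣≡i⊎+∣i∣≡-i j
... | inj₁ i⁺ | inj₁ j⁺ = inj₁ (trans (sym i⁺) (trans (cong +_ eq) j⁺))
... | inj₁ i⁺ | inj₂ j⁻ = inj₂ (trans (sym i⁺) (trans (cong +_ eq) j⁻))
... | inj₂ i⁻ | inj₁ j⁺ = inj₂
  (trans (sym (ℤₚ.neg-involutive i)) (cong ℤ.-_ (trans (sym i⁻) (trans (cong +_ eq) j⁺))))
... | inj₂ i⁻ | inj₂ j⁻ = inj₁ (ℤₚ.neg-injective (trans (sym i⁻) (trans (cong +_ eq) j⁻)))

private
  ext₃ : (f g : Form ℤ 2) → (∀ i → lookup f i ≡ lookup g i) → f ≡ g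
  ext₃ (_ ∷ _ ∷ _ ∷ []) (_ ∷ _ ∷ _ ∷ []) eq with eq zero | eq (suc zero) | eq (suc (suc zero))
  ... | refl | refl | refl = refl

  lookup-neg : ∀ (f : Form ℤ 2) i → lookup (negᶠ f) i ≡ ℤ.- lookup f i
  lookup-neg (_ ∷ _ ∷ _ ∷ []) zero             = refl
  lookup-neg (_ ∷ _ ∷ _ ∷ []) (suc zero)       = refl
  lookup-neg (_ ∷ _ ∷ _ ∷ []) (suc (suc zero)) = refl

  lookup-· : ∀ k (f : Form ℤ 2) i → lookup (k ·ᶻ f) i ≡ k ℤ.* lookup f i
  lookup-· k (_ ∷ _ ∷ _ ∷ []) zero             = refl
  lookup-· k (_ ∷ _ ∷ _ ∷ []) (suc zero)       = refl
  lookup-· k (_ ∷ _ ∷ _ ∷ []) (suc (suc zero)) = refl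

-- Comparing contents on both sides of p g = q f gives |p| = |q|, so q = ±p, and p cancels.
proportional⇒≡± : ∀ f g → Primitive f → Primitive g → ∀ p q → p ≢ 0ℤ →
  (∀ i → p ℤ.* lookup g i ≡ q ℤ.* lookup f i) → g ≡± f
proportional⇒≡± f@(α ∷ β ∷ γ ∷ []) g@(α′ ∷ β′ ∷ γ′ ∷ []) prim-f prim-g p q p≢0 prop =
  [ (λ q≡p → inj₁ (ext₃ g f λ i → cancel (trans (prop i) (cong (ℤ._* lookup f i) q≡p))))
  , (λ q≡-p → inj₂ (ext₃ g (negᶠ f) λ i → trans (cancel (trans (prop i)
      (trans (cong (ℤ._* lookup f i) q≡-p) (move p (lookup f i))))) (sym (lookup-neg f i))))
  ]′ (∣i∣≡∣j∣⇒i≡±j q p (sym ∣p∣≡∣q∣))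
  where
  cancel : ∀ {x y} → p ℤ.* x ≡ p ℤ.* y → x ≡ y
  cancel {x} {y} = ℤₚ.*-cancelˡ-≡ p x y {{ℤ.≢-nonZero p≢0}}
  move : ∀ p x → ℤ.- p ℤ.* x ≡ p ℤ.* ℤ.- x
  move = ℤRing.solve-∀
  abs : ∀ i → ℤ.∣ p ∣ ℕ.* ℤ.∣ lookup g i ∣ ≡ ℤ.∣ q ∣ ℕ.* ℤ.∣ lookup f i ∣
  abs i = trans (sym (ℤₚ.abs-* p (lookup g i)))
    (trans (cong ℤ.∣_∣ (prop i)) (ℤₚ.abs-* q (lookup f i)))
  ∣p∣≡∣q∣ : ℤ.∣ p ∣ ≡ ℤ.∣ q ∣
  ∣p∣≡∣q∣ = trans (sym (ℕₚ.*-identityʳ ℤ.∣ p ∣))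
    (trans (cong (ℤ.∣ p ∣ ℕ.*_) (sym (ℤₚ.+-injective prim-g)))
    (trans (*-gcd₃ ℤ.∣ p ∣ ℤ.∣ α′ ∣ ℤ.∣ β′ ∣ ℤ.∣ γ′ ∣)
    (trans (cong₂ (λ l m → gcd₃ l m (ℤ.∣ p ∣ ℕ.* ℤ.∣ γ′ ∣)) (abs zero) (abs (suc zero)))
    (trans (cong (gcd₃ (ℤ.∣ q ∣ ℕ.* ℤ.∣ α ∣) (ℤ.∣ q ∣ ℕ.* ℤ.∣ β ∣)) (abs (suc (suc zero))))
    (trans (sym (*-gcd₃ ℤ.∣ q ∣ ℤ.∣ α ∣ ℤ.∣ β ∣ ℤ.∣ γ ∣))
    (trans (cong (ℤ.∣ q ∣ ℕ.*_) (ℤₚ.+-injective prim-f))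
    (ℕₚ.*-identityʳ ℤ.∣ q ∣)))))))

-- Substituting J = 3In - n³ into 4I³ - J² leaves a polynomial in I and n² that factors.
disc-root : ∀ F n → Root F n →
  disc₄ F ℤ.* + 27 ≡ (I F ℤ.- n ℤ.* n) ℤ.* (I F ℤ.- n ℤ.* n) ℤ.* (+ 4 ℤ.* I F ℤ.- n ℤ.* n)
disc-root F@(_ ∷ _ ∷ _ ∷ _ ∷ _ ∷ []) n root = trans (disc₄-exact F)
  (drop-multiple (ℤ.- (J F ℤ.+ + 3 ℤ.* I F ℤ.* n ℤ.- n ℤ.* n ℤ.* n)) (identity (I F) (J F) n) root)
  where
  identity : ∀ i j x → + 4 ℤ.* i ℤ.^ 3 ℤ.- j ℤ.^ 2 ≡
    (i ℤ.- x ℤ.* x) ℤ.* (i ℤ.- x ℤ.* x) ℤ.* (+ 4 ℤ.* i ℤ.- x ℤ.* x)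
    ℤ.+ (ℤ.- (j ℤ.+ + 3 ℤ.* i ℤ.* x ℤ.- x ℤ.* x ℤ.* x)) ℤ.* Pℤ.cubic (+ 3 ℤ.* i) j x
  identity = ℤ-solve 3 (λ i j x →
    Κ (+ 4) :* i Sℤ.^ 3 :- j Sℤ.^ 2 :≡
    (i :- x :* x) :* (i :- x :* x) :* (Κ (+ 4) :* i :- x :* x)
    :+ (:- (j :+ Κ (+ 3) :* i :* x :- x :* x :* x)) :* Sℤ.cubic (Κ (+ 3) :* i) j x) refl

simple-root : ∀ F n → disc₄ F ≢ 0ℤ → Root F n → I F ℤ.- n ℤ.* n ≢ 0ℤ
simple-root F n Δ≢0 root eq = Δ≢0 (ℤₚ.*-cancelʳ-≡ (disc₄ F) 0ℤ (+ 27)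
  (trans (disc-root F n root) (cong (λ t → t ℤ.* t ℤ.* (+ 4 ℤ.* I F ℤ.- n ℤ.* n)) eq)))

private
  -- The symmetric matrix times a column of its adjugate: only the diagonal entry survives, and it
  -- is the determinant.
  row₁-column₁ : ∀ a b c d e x → let F = a ∷ b ∷ c ∷ d ∷ e ∷ [] in
    Pℤ.row₁ F x (Pℤ.column₁ F x) ≡ + 4 ℤ.* Pℤ.resolventAt F x
  row₁-column₁ = ℤ-solve 6 (λ a b c d e x →
    let F = a ∷ b ∷ c ∷ d ∷ e ∷ [] in
    Sℤ.row₁ F x (Sℤ.column₁ F x) :≡ Κ (+ 4) :* Sℤ.resolventAt F x) refl
  row₂-column₁ : ∀ a b c d e x → let F = a ∷ b ∷ c ∷ d ∷ e ∷ [] in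
    Pℤ.row₂ F x (Pℤ.column₁ F x) ≡ 0ℤ
  row₂-column₁ = ℤ-solve 6 (λ a b c d e x →
    let F = a ∷ b ∷ c ∷ d ∷ e ∷ [] in
    Sℤ.row₂ F x (Sℤ.column₁ F x) :≡ Κ (+ 0)) refl
  row₃-column₁ : ∀ a b c d e x → let F = a ∷ b ∷ c ∷ d ∷ e ∷ [] in
    Pℤ.row₃ F x (Pℤ.column₁ F x) ≡ 0ℤ
  row₃-column₁ = ℤ-solve 6 (λ a b c d e x →
    let F = a ∷ b ∷ c ∷ d ∷ e ∷ [] in
    Sℤ.row₃ F x (Sℤ.column₁ F x) :≡ Κ (+ 0)) refl
  row₁-column₂ : ∀ a b c d e x → let F = a ∷ b ∷ c ∷ d ∷ e ∷ [] in
    Pℤ.row₁ F x (Pℤ.column₂ F x) ≡ 0ℤ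
  row₁-column₂ = ℤ-solve 6 (λ a b c d e x →
    let F = a ∷ b ∷ c ∷ d ∷ e ∷ [] in
    Sℤ.row₁ F x (Sℤ.column₂ F x) :≡ Κ (+ 0)) refl
  row₂-column₂ : ∀ a b c d e x → let F = a ∷ b ∷ c ∷ d ∷ e ∷ [] in
    Pℤ.row₂ F x (Pℤ.column₂ F x) ≡ + 4 ℤ.* Pℤ.resolventAt F x
  row₂-column₂ = ℤ-solve 6 (λ a b c d e x →
    let F = a ∷ b ∷ c ∷ d ∷ e ∷ [] in
    Sℤ.row₂ F x (Sℤ.column₂ F x) :≡ Κ (+ 4) :* Sℤ.resolventAt F x) refl
  row₃-column₂ : ∀ a b c d e x → let F = a ∷ b ∷ c ∷ d ∷ e ∷ [] in
    Pℤ.row₃ F x (Pℤ.column₂ F x) ≡ 0ℤ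
  row₃-column₂ = ℤ-solve 6 (λ a b c d e x →
    let F = a ∷ b ∷ c ∷ d ∷ e ∷ [] in
    Sℤ.row₃ F x (Sℤ.column₂ F x) :≡ Κ (+ 0)) refl

  -- Modulo the resolvent S has rank one, so a column v with diagonal entry
  -- s has discriminant s (S₂₂ - 4 S₁₃), and S₂₂ - 4 S₁₃ = 12 (I - x²).
  disc-column₁ : ∀ a b c d e x → let F = a ∷ b ∷ c ∷ d ∷ e ∷ [] in
    disc₂ (Pℤ.column₁ F x) ≡ Pℤ.S₁₁ F x ℤ.* (+ 12 ℤ.* (I F ℤ.- x ℤ.* x))
                          ℤ.+ (ℤ.- (+ 48 ℤ.* a)) ℤ.* Pℤ.resolventAt F x
  disc-column₁ = ℤ-solve 6 (λ a b c d e x →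
    let F = a ∷ b ∷ c ∷ d ∷ e ∷ [] in
    Sℤ.disc (Sℤ.column₁ F x) :≡ Sℤ.S₁₁ F x :* (Κ (+ 12) :* (Sℤ.invI F :- x :* x))
    :+ (:- (Κ (+ 48) :* a)) :* Sℤ.resolventAt F x) refl
  disc-column₂ : ∀ a b c d e x → let F = a ∷ b ∷ c ∷ d ∷ e ∷ [] in
    disc₂ (Pℤ.column₂ F x) ≡ Pℤ.S₂₂ F x ℤ.* (+ 12 ℤ.* (I F ℤ.- x ℤ.* x))
                          ℤ.+ (ℤ.- (+ 32 ℤ.* (c ℤ.+ x))) ℤ.* Pℤ.resolventAt F x
  disc-column₂ = ℤ-solve 6 (λ a b c d e x →
    let F = a ∷ b ∷ c ∷ d ∷ e ∷ [] in
    Sℤ.disc (Sℤ.column₂ F x) :≡ Sℤ.S₂₂ F x :* (Κ (+ 12) :* (Sℤ.invI F :- x :* x))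
    :+ (:- (Κ (+ 32) :* (c :+ x))) :* Sℤ.resolventAt F x) refl

  trace : ∀ a b c d e x → let F = a ∷ b ∷ c ∷ d ∷ e ∷ [] in
    + 12 ℤ.* (I F ℤ.- x ℤ.* x) ≡ Pℤ.S₂₂ F x ℤ.- + 4 ℤ.* Pℤ.S₁₃ F x
  trace = ℤ-solve 6 (λ a b c d e x →
    let F = a ∷ b ∷ c ∷ d ∷ e ∷ [] in
    (Κ (+ 12)) :* (Sℤ.invI F :- x :* x) :≡ Sℤ.S₂₂ F x :- Κ (+ 4) :* Sℤ.S₁₃ F x) refl
  -- Jacobi's identity: the minor S₁₁S₃₃ - S₁₃² of the adjugate is the middle entry 2c - x times the
  -- determinant.
  S₁₃² : ∀ a b c d e x → let F = a ∷ b ∷ c ∷ d ∷ e ∷ [] in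
    Pℤ.S₁₃ F x ℤ.* Pℤ.S₁₃ F x ≡
    Pℤ.S₃₃ F x ℤ.* Pℤ.S₁₁ F x ℤ.+ (ℤ.- (+ 4 ℤ.* (+ 2 ℤ.* c ℤ.- x))) ℤ.* Pℤ.resolventAt F x
  S₁₃² = ℤ-solve 6 (λ a b c d e x →
    let F = a ∷ b ∷ c ∷ d ∷ e ∷ [] in
    Sℤ.S₁₃ F x :* Sℤ.S₁₃ F x :≡
    Sℤ.S₃₃ F x :* Sℤ.S₁₁ F x :+ (:-
      (Κ (+ 4) :* (Κ (+ 2) :* c :- x))) :* Sℤ.resolventAt F x) refl

  -- `column₁` is the cross product r₂ × r₃ of two rows of the matrix, and g × (r₂ × r₃) = (g·r₃) r₂
  -- - (g·r₂) r₃. So a `g` killed by both rows is proportional to it; likewise `column₂` is r₃ × r₁.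
  minor-column₁₂ : ∀ a b c d e x α β γ → let F = a ∷ b ∷ c ∷ d ∷ e ∷ []; g = α ∷ β ∷ γ ∷ [] in
    Pℤ.S₁₁ F x ℤ.* β ℤ.- α ℤ.* Pℤ.S₁₂ F x ≡
    (+ 3 ℤ.* b) ℤ.* Pℤ.row₃ F x g ℤ.+ (+ 12 ℤ.* a) ℤ.* Pℤ.row₂ F x g
  minor-column₁₂ = ℤ-solve 9 (λ a b c d e x α β γ →
    let F = a ∷ b ∷ c ∷ d ∷ e ∷ []; g = α ∷ β ∷ γ ∷ [] in
    Sℤ.S₁₁ F x :* β :- α :* Sℤ.S₁₂ F x :≡
    (Κ (+ 3) :* b) :* Sℤ.row₃ F x g :+ (Κ (+ 12) :* a) :* Sℤ.row₂ F x g) refl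
  minor-column₁₃ : ∀ a b c d e x α β γ → let F = a ∷ b ∷ c ∷ d ∷ e ∷ []; g = α ∷ β ∷ γ ∷ [] in
    Pℤ.S₁₁ F x ℤ.* γ ℤ.- α ℤ.* Pℤ.S₁₃ F x ≡
    (+ 2 ℤ.* c ℤ.- x) ℤ.* Pℤ.row₃ F x g ℤ.+ (+ 3 ℤ.* b) ℤ.* Pℤ.row₂ F x g
  minor-column₁₃ = ℤ-solve 9 (λ a b c d e x α β γ →
    let F = a ∷ b ∷ c ∷ d ∷ e ∷ []; g = α ∷ β ∷ γ ∷ [] in
    Sℤ.S₁₁ F x :* γ :- α :* Sℤ.S₁₃ F x :≡
    (Κ (+ 2) :* c :- x) :* Sℤ.row₃ F x g :+ (Κ (+ 3) :* b) :* Sℤ.row₂ F x g) refl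
  minor-column₂₁ : ∀ a b c d e x α β γ → let F = a ∷ b ∷ c ∷ d ∷ e ∷ []; g = α ∷ β ∷ γ ∷ [] in
    Pℤ.S₂₂ F x ℤ.* α ℤ.- β ℤ.* Pℤ.S₁₂ F x ≡
    (+ 12 ℤ.* a) ℤ.* Pℤ.row₁ F x g ℤ.+ (ℤ.- (+ 2 ℤ.* (c ℤ.+ x))) ℤ.* Pℤ.row₃ F x g
  minor-column₂₁ = ℤ-solve 9 (λ a b c d e x α β γ →
    let F = a ∷ b ∷ c ∷ d ∷ e ∷ []; g = α ∷ β ∷ γ ∷ [] in
    Sℤ.S₂₂ F x :* α :- β :* Sℤ.S₁₂ F x :≡
    (Κ (+ 12) :* a) :* Sℤ.row₁ F x g :+ (:- (Κ (+ 2) :* (c :+ x))) :* Sℤ.row₃ F x g) refl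
  minor-column₂₃ : ∀ a b c d e x α β γ → let F = a ∷ b ∷ c ∷ d ∷ e ∷ []; g = α ∷ β ∷ γ ∷ [] in
    Pℤ.S₂₂ F x ℤ.* γ ℤ.- β ℤ.* Pℤ.S₂₃ F x ≡
    (+ 12 ℤ.* e) ℤ.* Pℤ.row₃ F x g ℤ.+ (ℤ.- (+ 2 ℤ.* (c ℤ.+ x))) ℤ.* Pℤ.row₁ F x g
  minor-column₂₃ = ℤ-solve 9 (λ a b c d e x α β γ →
    let F = a ∷ b ∷ c ∷ d ∷ e ∷ []; g = α ∷ β ∷ γ ∷ [] in
    Sℤ.S₂₂ F x :* γ :- β :* Sℤ.S₂₃ F x :≡
    (Κ (+ 12) :* e) :* Sℤ.row₃ F x g :+ (:- (Κ (+ 2) :* (c :+ x))) :* Sℤ.row₁ F x g) refl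

-- Proportionality to v is expressed through its nonzero coordinate.
record Generator (F : Form ℤ 4) (n : ℤ) (v : Form ℤ 2) : Set where
  field
    eigen     : Eigenformℤ F n v
    disc≢0    : disc₂ v ≢ 0ℤ
    index     : Fin 3
    nonzero   : lookup v index ≢ 0ℤ
    spans     : ∀ g → Eigenformℤ F n g → ∀ i → lookup v index ℤ.* lookup g i ≡
      lookup g index ℤ.* lookup v i

-- A column with nonzero diagonal entry generates. If S₂₂ and S₁₁ both vanished, rank one would give
-- S₁₃ = 0, and then 12(I - n²) = S₂₂ - 4S₁₃ = 0, against simplicity of the root.
root⇒generator : ∀ F n → disc₄ F ≢ 0ℤ → Root F n → ∃ (Generator F n)
root⇒generator F@(a ∷ b ∷ c ∷ d ∷ e ∷ []) n Δ≢0 root = choose (Pℤ.S₂₂ F n ℤ.≟ 0ℤ)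
  where
  12D≢0 : + 12 ℤ.* (I F ℤ.- n ℤ.* n) ≢ 0ℤ
  12D≢0 = product≢0 (+ 12) (I F ℤ.- n ℤ.* n) (λ ()) (simple-root F n Δ≢0 root)

  S₁₁≢0 : Pℤ.S₂₂ F n ≡ 0ℤ → Pℤ.S₁₁ F n ≢ 0ℤ
  S₁₁≢0 S₂₂≡0 S₁₁≡0 = 12D≢0 (trans (trace a b c d e n)
    (cong₂ (λ s t → s ℤ.- + 4 ℤ.* t) S₂₂≡0 S₁₃≡0))
    where
    S₁₃²≡0 : Pℤ.S₁₃ F n ℤ.* Pℤ.S₁₃ F n ≡ 0ℤ
    S₁₃²≡0 = trans (drop-multiple (ℤ.- (+ 4 ℤ.* (+ 2 ℤ.* c ℤ.- n))) (S₁₃² a b c d e n) root)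
      (multiple≡0 (Pℤ.S₃₃ F n) S₁₁≡0)
    S₁₃≡0 : Pℤ.S₁₃ F n ≡ 0ℤ
    S₁₃≡0 = [ id , id ]′ (ℤₚ.i*j≡0⇒i≡0∨j≡0 (Pℤ.S₁₃ F n) S₁₃²≡0)

  choose : _ → ∃ (Generator F n)
  choose (no S₂₂≢0) = Pℤ.column₂ F n , record
    { eigen   = row₁-column₂ a b c d e n
              , trans (row₂-column₂ a b c d e n) (multiple≡0 (+ 4) root)
              , row₃-column₂ a b c d e n
    ; disc≢0  = λ eq → product≢0 (Pℤ.S₂₂ F n) (+ 12 ℤ.* (I F ℤ.- n ℤ.* n)) S₂₂≢0 12D≢0
      (trans (sym (drop-multiple (ℤ.- (+ 32 ℤ.* (c ℤ.+ n))) (disc-column₂ a b c d e n) root)) eq)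
    ; index   = suc zero
    ; nonzero = S₂₂≢0
    ; spans   = spans₂
    }
    where
    spans₂ : ∀ g → Eigenformℤ F n g → ∀ i →
             Pℤ.S₂₂ F n ℤ.* lookup g i ≡ lookup g (suc zero) ℤ.* lookup (Pℤ.column₂ F n) i
    spans₂ (α ∷ β ∷ γ ∷ []) (r₁ , r₂ , r₃) zero = ℤₚ.i-j≡0⇒i≡j _ _
      (trans (minor-column₂₁ a b c d e n α β γ)
        (combine₂ℤ (+ 12 ℤ.* a) (ℤ.- (+ 2 ℤ.* (c ℤ.+ n))) r₁ r₃))
    spans₂ (α ∷ β ∷ γ ∷ []) (r₁ , r₂ , r₃) (suc zero) = ℤₚ.*-comm (Pℤ.S₂₂ F n) β
    spans₂ (α ∷ β ∷ γ ∷ []) (r₁ , r₂ , r₃) (suc (suc zero)) = ℤₚ.i-j≡0⇒i≡j _ _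
      (trans (minor-column₂₃ a b c d e n α β γ)
        (combine₂ℤ (+ 12 ℤ.* e) (ℤ.- (+ 2 ℤ.* (c ℤ.+ n))) r₃ r₁))
  choose (yes S₂₂≡0) = Pℤ.column₁ F n , record
    { eigen   = trans (row₁-column₁ a b c d e n) (multiple≡0 (+ 4) root)
              , row₂-column₁ a b c d e n
              , row₃-column₁ a b c d e n
    ; disc≢0  = λ eq → product≢0 (Pℤ.S₁₁ F n) (+ 12 ℤ.* (I F ℤ.- n ℤ.* n)) (S₁₁≢0 S₂₂≡0) 12D≢0
      (trans (sym (drop-multiple (ℤ.- (+ 48 ℤ.* a)) (disc-column₁ a b c d e n) root)) eq)
    ; index   = zero
    ; nonzero = S₁₁≢0 S₂₂≡0
    ; spans   = spans₁
    }
    where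
    spans₁ : ∀ g → Eigenformℤ F n g → ∀ i →
             Pℤ.S₁₁ F n ℤ.* lookup g i ≡ lookup g zero ℤ.* lookup (Pℤ.column₁ F n) i
    spans₁ (α ∷ β ∷ γ ∷ []) (r₁ , r₂ , r₃) zero = ℤₚ.*-comm (Pℤ.S₁₁ F n) α
    spans₁ (α ∷ β ∷ γ ∷ []) (r₁ , r₂ , r₃) (suc zero) = ℤₚ.i-j≡0⇒i≡j _ _
      (trans (minor-column₁₂ a b c d e n α β γ) (combine₂ℤ (+ 3 ℤ.* b) (+ 12 ℤ.* a) r₃ r₂))
    spans₁ (α ∷ β ∷ γ ∷ []) (r₁ , r₂ , r₃) (suc (suc zero)) = ℤₚ.i-j≡0⇒i≡j _ _
      (trans (minor-column₁₃ a b c d e n α β γ) (combine₂ℤ (+ 2 ℤ.* c ℤ.- n) (+ 3 ℤ.* b) r₃ r₂))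

private
  row₁-· : ∀ k a b c d e x α β γ → let F = a ∷ b ∷ c ∷ d ∷ e ∷ []; f = α ∷ β ∷ γ ∷ [] in
    k ℤ.* Pℤ.row₁ F x f ≡ Pℤ.row₁ F x (k ·ᶻ f)
  row₁-· = ℤ-solve 10 (λ k a b c d e x α β γ →
    let F = a ∷ b ∷ c ∷ d ∷ e ∷ []; f = α ∷ β ∷ γ ∷ [] in
    k :* Sℤ.row₁ F x f :≡ Sℤ.row₁ F x (k Sℤ.· f)) refl
  row₂-· : ∀ k a b c d e x α β γ → let F = a ∷ b ∷ c ∷ d ∷ e ∷ []; f = α ∷ β ∷ γ ∷ [] in
    k ℤ.* Pℤ.row₂ F x f ≡ Pℤ.row₂ F x (k ·ᶻ f)
  row₂-· = ℤ-solve 10 (λ k a b c d e x α β γ →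
    let F = a ∷ b ∷ c ∷ d ∷ e ∷ []; f = α ∷ β ∷ γ ∷ [] in
    k :* Sℤ.row₂ F x f :≡ Sℤ.row₂ F x (k Sℤ.· f)) refl
  row₃-· : ∀ k a b c d e x α β γ → let F = a ∷ b ∷ c ∷ d ∷ e ∷ []; f = α ∷ β ∷ γ ∷ [] in
    k ℤ.* Pℤ.row₃ F x f ≡ Pℤ.row₃ F x (k ·ᶻ f)
  row₃-· = ℤ-solve 10 (λ k a b c d e x α β γ →
    let F = a ∷ b ∷ c ∷ d ∷ e ∷ []; f = α ∷ β ∷ γ ∷ [] in
    k :* Sℤ.row₃ F x f :≡ Sℤ.row₃ F x (k Sℤ.· f)) refl
  disc-· : ∀ k α β γ → disc₂ (k ·ᶻ (α ∷ β ∷ γ ∷ [])) ≡ k ℤ.* k ℤ.* disc₂ (α ∷ β ∷ γ ∷ [])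
  disc-· = ℤ-solve 4 (λ k α β γ →
    Sℤ.disc (k Sℤ.· (α ∷ β ∷ γ ∷ [])) :≡ k :* k :* Sℤ.disc (α ∷ β ∷ γ ∷ [])) refl

generator-primitive : ∀ F n k f → k ≢ 0ℤ → Generator F n (k ·ᶻ f) → Generator F n f
generator-primitive F@(a ∷ b ∷ c ∷ d ∷ e ∷ []) n k f@(α ∷ β ∷ γ ∷ []) k≢0 G = record
  { eigen   = let r₁ , r₂ , r₃ = Generator.eigen G in
              ℤ-cancel k≢0 (trans (row₁-· k a b c d e n α β γ) r₁)
            , ℤ-cancel k≢0 (trans (row₂-· k a b c d e n α β γ) r₂)
            , ℤ-cancel k≢0 (trans (row₃-· k a b c d e n α β γ) r₃)
  ; disc≢0  = λ eq → Generator.disc≢0 G (trans (disc-· k α β γ) (multiple≡0 (k ℤ.* k) eq))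
  ; index   = j
  ; nonzero = λ eq → Generator.nonzero G (trans (lookup-· k f j) (multiple≡0 k eq))
  ; spans   = λ g eigen-g i → ℤₚ.*-cancelˡ-≡ k _ _ {{ℤ.≢-nonZero k≢0}}
      (trans (sym (ℤₚ.*-assoc k (lookup f j) (lookup g i)))
      (trans (cong (ℤ._* lookup g i) (sym (lookup-· k f j)))
      (trans (Generator.spans G g eigen-g i)
      (trans (cong (lookup g j ℤ.*_) (lookup-· k f i))
        (swap (lookup g j) k (lookup f i))))))
  }
  where
  j = Generator.index G
  swap : ∀ x k y → x ℤ.* (k ℤ.* y) ≡ k ℤ.* (x ℤ.* y)
  swap = ℤRing.solve-∀

root⇒primitive-generator : ∀ F n → disc₄ F ≢ 0ℤ → Root F n → ∃ λ f → Primitive f × Generator F n f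
root⇒primitive-generator F n Δ≢0 root =
  let v , G = root⇒generator F n Δ≢0 root
      k , f , k≢0 , prim , v≡kf = primitive-part v (Generator.index G) (Generator.nonzero G)
  in f , prim , generator-primitive F n k f k≢0 (subst (Generator F n) v≡kf G)

generator-unique : ∀ F n f g → Primitive f → Generator F n f → Primitive g → Eigenformℤ F n g →
  g ≡± f
generator-unique F n f g prim-f G prim-g eigen-g = proportional⇒≡± f g prim-f prim-g
  (lookup f (Generator.index G)) (lookup g (Generator.index G)) (Generator.nonzero G)
    (Generator.spans G g eigen-g)

-- Signs of discriminants

0≤square : ∀ i → 0ℤ ≤ i ℤ.* i
0≤square (+ zero)  = +≤+ z≤n
0≤square (+ suc n) = +≤+ z≤n
0≤square -[1+ n ]  = +≤+ z≤n

0<square : ∀ i → i ≢ 0ℤ → 0ℤ < i ℤ.* i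
0<square i i≢0 = ℤₚ.≤∧≢⇒< (0≤square i) (λ eq → product≢0 i i i≢0 i≢0 (sym eq))

0<product : ∀ i j → 0ℤ < i → 0ℤ < j → 0ℤ < i ℤ.* j
0<product (+ suc m) (+ suc n) _ _ = +<+ (s≤s z≤n)
0<product (+ zero) _ (+<+ ()) _
0<product (+ suc _) (+ zero) _ (+<+ ())

0≤product : ∀ i j → 0ℤ ≤ i → 0ℤ ≤ j → 0ℤ ≤ i ℤ.* j
0≤product (+ m) (+ n) _ _ = subst (0ℤ ≤_) (ℤₚ.pos-* m n) (+≤+ z≤n)

0<⇒0<cofactor : ∀ i j → 0ℤ < i → 0ℤ < i ℤ.* j → 0ℤ < j
0<⇒0<cofactor i j 0<i 0<ij = ℤₚ.*-cancelˡ-<-nonNeg i {{ℤ.nonNegative (ℤₚ.<⇒≤ 0<i)}}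
  (subst (_< i ℤ.* j) (sym (ℤₚ.*-zeroʳ i)) 0<ij)

<0⇒cofactor<0 : ∀ i j → i < 0ℤ → 0ℤ < i ℤ.* j → j < 0ℤ
<0⇒cofactor<0 i j i<0 0<ij = ℤₚ.*-cancelˡ-<-nonPos i {{ℤ.nonPositive (ℤₚ.<⇒≤ i<0)}}
  (subst (_< i ℤ.* j) (sym (ℤₚ.*-zeroʳ i)) 0<ij)

private
  leading≢0 : ∀ α β γ → disc₂ (α ∷ β ∷ γ ∷ []) < 0ℤ → α ≢ 0ℤ
  leading≢0 α β γ Δ<0 refl = ℤₚ.<⇒≱ Δ<0 (subst (0ℤ ≤_) (sym (lemma β γ)) (0≤square β))
    where
    lemma : ∀ β γ → disc₂ (0ℤ ∷ β ∷ γ ∷ []) ≡ β ℤ.* β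
    lemma = ℤ-solve 2 (λ β γ →
      Sℤ.disc (Κ (+ 0) ∷ β ∷ γ ∷ []) :≡ β :* β) refl

-- 4αf(x,y) = (2αx + βy)² - Δy² is positive, so `f` has the sign of α. For y ≠ 0 strictness comes
-- from the second term, for y = 0 from the square.
negative-disc⇒definite : ∀ f → disc₂ f < 0ℤ → Definite f
negative-disc⇒definite f@(α ∷ β ∷ γ ∷ []) Δ<0 = split (ℤₚ.<-cmp 0ℤ α)
  where
  α≢0 = leading≢0 α β γ Δ<0

  complete-square : ∀ α β γ x y → α ℤ.* (+ 4 ℤ.* value (α ∷ β ∷ γ ∷ []) x y) ≡
    (+ 2 ℤ.* α ℤ.* x ℤ.+ β ℤ.* y) ℤ.* (+ 2 ℤ.* α ℤ.* x ℤ.+ β ℤ.* y)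
    ℤ.+ (ℤ.- disc₂ (α ∷ β ∷ γ ∷ [])) ℤ.* (y ℤ.* y)
  complete-square = ℤ-solve 5 (λ α β γ x y →
    α :* (Κ (+ 4) :* Sℤ.value′ (α ∷ β ∷ γ ∷ []) x y) :≡
    (Κ (+ 2) :* α :* x :+ β :* y) :* (Κ (+ 2) :* α :* x :+ β :* y)
    :+ (:- Sℤ.disc (α ∷ β ∷ γ ∷ [])) :* (y :* y)) refl

  on-axis : ∀ α β γ x → α ℤ.* (+ 4 ℤ.* value (α ∷ β ∷ γ ∷ []) x 0ℤ) ≡
    (+ 2 ℤ.* α ℤ.* x) ℤ.* (+ 2 ℤ.* α ℤ.* x)
  on-axis = ℤ-solve 4 (λ α β γ x →
    α :* (Κ (+ 4) :* Sℤ.value′ (α ∷ β ∷ γ ∷ []) x (Κ (+ 0))) :≡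
    (Κ (+ 2) :* α :* x) :* (Κ (+ 2) :* α :* x)) refl

  positive : ∀ x y → ¬ (x ≡ 0ℤ × y ≡ 0ℤ) → 0ℤ < α ℤ.* (+ 4 ℤ.* value f x y)
  positive x y xy≢0 = split-y (y ℤ.≟ 0ℤ)
    where
    split-y : _ → 0ℤ < α ℤ.* (+ 4 ℤ.* value f x y)
    split-y (yes refl) = subst (0ℤ <_) (sym (on-axis α β γ x)) (0<square (+ 2 ℤ.* α ℤ.* x)
      (product≢0 (+ 2 ℤ.* α) x (product≢0 (+ 2) α (λ ()) α≢0) (λ x≡0 → xy≢0 (x≡0 , refl))))
    split-y (no y≢0) = subst (0ℤ <_) (sym (complete-square α β γ x y))
      (ℤₚ.+-mono-≤-< (0≤square (+ 2 ℤ.* α ℤ.* x ℤ.+ β ℤ.* y))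
        (0<product (ℤ.- disc₂ f) (y ℤ.* y) (ℤₚ.neg-mono-< Δ<0) (0<square y y≢0)))

  split : _ → Definite f
  split (tri< 0<α _ _) = inj₁ λ x y xy≢0 → 0<⇒0<cofactor (+ 4) (value f x y) (+<+ (s≤s z≤n))
    (0<⇒0<cofactor α (+ 4 ℤ.* value f x y) 0<α (positive x y xy≢0))
  split (tri≈ _ 0≡α _) = contradiction (sym 0≡α) α≢0
  split (tri> _ _ α<0) = inj₂ λ x y xy≢0 → ℤₚ.*-cancelˡ-<-nonNeg (+ 4)
    (<0⇒cofactor<0 α (+ 4 ℤ.* value f x y) α<0 (positive x y xy≢0))

-- The values α at (1, 0) and -αΔ at (-β, 2α) have opposite signs. If α = 0 then f = y(βx + γy),
-- which takes the values ±β² = ±Δ at (±1 - γ, β).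
positive-disc⇒indefinite : ∀ f → 0ℤ < disc₂ f → Indefinite f
positive-disc⇒indefinite f@(α ∷ β ∷ γ ∷ []) 0<Δ = split (ℤₚ.<-cmp 0ℤ α)
  where
  at-infinity : ∀ α β γ → α ≡ value (α ∷ β ∷ γ ∷ []) 1ℤ 0ℤ
  at-infinity = ℤ-solve 3 (λ α β γ →
    α :≡ Sℤ.value′ (α ∷ β ∷ γ ∷ []) (Κ (+ 1)) (Κ (+ 0))) refl
  at-vertex : ∀ α β γ → ℤ.- (α ℤ.* disc₂ (α ∷ β ∷ γ ∷ [])) ≡ value (α ∷ β ∷ γ ∷ []) (ℤ.- β)
    (+ 2 ℤ.* α)
  at-vertex = ℤ-solve 3 (λ α β γ →
    :- (α :* Sℤ.disc (α ∷ β ∷ γ ∷ [])) :≡ Sℤ.value′ (α ∷ β ∷ γ ∷ []) (:- β) (Κ (+ 2) :* α)) refl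
  isotropic⁺ : ∀ β γ → disc₂ (0ℤ ∷ β ∷ γ ∷ []) ≡ value (0ℤ ∷ β ∷ γ ∷ []) (1ℤ ℤ.- γ) β
  isotropic⁺ = ℤ-solve 2 (λ β γ →
    Sℤ.disc (Κ (+ 0) ∷ β ∷ γ ∷ []) :≡ Sℤ.value′ (Κ (+ 0) ∷ β ∷ γ ∷ []) (Κ (+ 1) :- γ) β) refl
  isotropic⁻ : ∀ β γ → ℤ.- disc₂ (0ℤ ∷ β ∷ γ ∷ []) ≡ value (0ℤ ∷ β ∷ γ ∷ []) (ℤ.- 1ℤ ℤ.- γ) β
  isotropic⁻ = ℤ-solve 2 (λ β γ →
    :- Sℤ.disc (Κ (+ 0) ∷ β ∷ γ ∷ []) :≡ Sℤ.value′ (Κ (+ 0) ∷ β ∷ γ ∷ [])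
      (:- Κ (+ 1) :- γ) β) refl
  neg-neg : ∀ i j → (ℤ.- i) ℤ.* j ≡ ℤ.- (i ℤ.* j)
  neg-neg = ℤRing.solve-∀

  split : _ → Indefinite f
  split (tri< 0<α _ _) =
      (1ℤ , 0ℤ , subst (0ℤ <_) (at-infinity α β γ) 0<α)
    , (ℤ.- β , + 2 ℤ.* α , subst (_< 0ℤ) (at-vertex α β γ)
        (ℤₚ.neg-mono-< (0<product α (disc₂ f) 0<α 0<Δ)))
  split (tri> _ _ α<0) =
      (ℤ.- β , + 2 ℤ.* α , subst (0ℤ <_) (trans (neg-neg α (disc₂ f)) (at-vertex α β γ))
        (0<product (ℤ.- α) (disc₂ f) (ℤₚ.neg-mono-< α<0) 0<Δ))
    , (1ℤ , 0ℤ , subst (_< 0ℤ) (at-infinity α β γ) α<0)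
  split (tri≈ _ refl _) =
      (1ℤ ℤ.- γ , β , subst (0ℤ <_) (isotropic⁺ β γ) 0<Δ)
    , (ℤ.- 1ℤ ℤ.- γ , β , subst (_< 0ℤ) (isotropic⁻ β γ) (ℤₚ.neg-mono-< 0<Δ))

-- The matrices of rows at n and m differ by n - m times that of the polar form.
eigenforms-orthogonal : ∀ F n m f g → n ≢ m → Eigenformℤ F n f → Eigenformℤ F m g → Pℤ.polar f g ≡
  0ℤ
eigenforms-orthogonal F@(a ∷ b ∷ c ∷ d ∷ e ∷ []) n m f@(α ∷ β ∷ γ ∷ []) g@(α′ ∷ β′ ∷ γ′ ∷ []) n≢m
  (r₁ , r₂ , r₃) (s₁ , s₂ , s₃) =
  ℤ-cancel (λ eq → n≢m (ℤₚ.i-j≡0⇒i≡j n m eq)) (trans (identity a b c d e n m α β γ α′ β′ γ′) vanish)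
  where
  identity : ∀ a b c d e n m α β γ α′ β′ γ′ →
    let F = a ∷ b ∷ c ∷ d ∷ e ∷ []; f = α ∷ β ∷ γ ∷ []; g = α′ ∷ β′ ∷ γ′ ∷ [] in
    (n ℤ.- m) ℤ.* Pℤ.polar f g ≡
      (α ℤ.* Pℤ.row₁ F m g ℤ.+ β ℤ.* Pℤ.row₂ F m g ℤ.+ γ ℤ.* Pℤ.row₃ F m g)
      ℤ.- (α′ ℤ.* Pℤ.row₁ F n f ℤ.+ β′ ℤ.* Pℤ.row₂ F n f ℤ.+ γ′ ℤ.* Pℤ.row₃ F n f)
  identity = ℤ-solve 13 (λ a b c d e n m α β γ α′ β′ γ′ →
    let F = a ∷ b ∷ c ∷ d ∷ e ∷ []; f = α ∷ β ∷ γ ∷ []; g = α′ ∷ β′ ∷ γ′ ∷ [] in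
    (n :- m) :* Sℤ.polar f g :≡
    (α :* Sℤ.row₁ F m g :+ β :* Sℤ.row₂ F m g :+ γ :* Sℤ.row₃ F m g)
    :- (α′ :* Sℤ.row₁ F n f :+ β′ :* Sℤ.row₂ F n f :+ γ′ :* Sℤ.row₃ F n f)) refl
  zeros : ∀ α β γ α′ β′ γ′ → (α ℤ.* 0ℤ ℤ.+ β ℤ.* 0ℤ ℤ.+ γ ℤ.* 0ℤ) ℤ.-
    (α′ ℤ.* 0ℤ ℤ.+ β′ ℤ.* 0ℤ ℤ.+ γ′ ℤ.* 0ℤ) ≡ 0ℤ
  zeros = ℤRing.solve-∀
  substitute-zeros : ∀ {x₁ x₂ x₃ y₁ y₂ y₃} → x₁ ≡ 0ℤ → x₂ ≡ 0ℤ → x₃ ≡ 0ℤ → y₁ ≡ 0ℤ → y₂ ≡ 0ℤ → y₃ ≡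
    0ℤ →
    (α ℤ.* x₁ ℤ.+ β ℤ.* x₂ ℤ.+ γ ℤ.* x₃) ℤ.- (α′ ℤ.* y₁ ℤ.+ β′ ℤ.* y₂ ℤ.+ γ′ ℤ.* y₃) ≡ 0ℤ
  substitute-zeros refl refl refl refl refl refl = zeros α β γ α′ β′ γ′
  vanish = substitute-zeros s₁ s₂ s₃ r₁ r₂ r₃

-- `polar g g` is `disc₂ g`, so f = ±g would make the polar form of the pair ±Δ(g), which is
-- nonzero.
orthogonal⇒not≡± : ∀ f g → disc₂ g ≢ 0ℤ → Pℤ.polar f g ≡ 0ℤ → ¬ f ≡± g
orthogonal⇒not≡± f g@(α ∷ β ∷ γ ∷ []) Δ≢0 f⊥g (inj₁ refl) = Δ≢0 (trans (lemma α β γ) f⊥g)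
  where
  lemma : ∀ α β γ → let g = α ∷ β ∷ γ ∷ [] in disc₂ g ≡ Pℤ.polar g g
  lemma = ℤ-solve 3 (λ α β γ →
    let g = α ∷ β ∷ γ ∷ [] in Sℤ.disc g :≡ Sℤ.polar g g) refl
orthogonal⇒not≡± f g@(α ∷ β ∷ γ ∷ []) Δ≢0 f⊥g (inj₂ refl) =
  Δ≢0 (trans (lemma α β γ) (cong ℤ.-_ f⊥g))
  where
  lemma : ∀ α β γ → let g = α ∷ β ∷ γ ∷ [] in disc₂ g ≡ ℤ.- Pℤ.polar (negᶠ g) g
  lemma = ℤ-solve 3 (λ α β γ →
    let g = α ∷ β ∷ γ ∷ [] in Sℤ.disc g :≡ :- Sℤ.polar (Sℤ.neg g) g) refl

-- There is only one negative direction: orthogonality makes -α²Δ(g) + (αβ′ - βα′)² - Δ(f)α′²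
-- vanish, while Δ(f) < 0 forces α ≠ 0. With Δ(g) < 0 the first term would be positive and the
-- others nonnegative.
orthogonal-to-negative : ∀ f g → disc₂ f < 0ℤ → disc₂ g ≢ 0ℤ → Pℤ.polar f g ≡ 0ℤ → 0ℤ < disc₂ g
orthogonal-to-negative f@(α ∷ β ∷ γ ∷ []) g@(α′ ∷ β′ ∷ γ′ ∷ []) Δf<0 Δg≢0 f⊥g = split
  (ℤₚ.<-cmp 0ℤ (disc₂ g))
  where
  identity : ∀ α β γ α′ β′ γ′ → let f = α ∷ β ∷ γ ∷ []; g = α′ ∷ β′ ∷ γ′ ∷ [] in
    (α ℤ.* α) ℤ.* (ℤ.- disc₂ g) ℤ.+ ((α ℤ.* β′ ℤ.- β ℤ.* α′) ℤ.* (α ℤ.* β′ ℤ.- β ℤ.* α′)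
      ℤ.+ (ℤ.- disc₂ f) ℤ.* (α′ ℤ.* α′)) ≡ (ℤ.- (+ 2 ℤ.* α ℤ.* α′)) ℤ.* Pℤ.polar f g
  identity = ℤ-solve 6 (λ α β γ α′ β′ γ′ →
    let f = α ∷ β ∷ γ ∷ []; g = α′ ∷ β′ ∷ γ′ ∷ [] in
    (α :* α) :* (:- Sℤ.disc g) :+ ((α :* β′ :- β :* α′) :* (α :* β′ :- β :* α′)
    :+ (:- Sℤ.disc f) :* (α′ :* α′)) :≡ (:- (Κ (+ 2) :* α :* α′)) :* Sℤ.polar f g) refl
  split : _ → 0ℤ < disc₂ g
  split (tri< 0<Δg _ _) = 0<Δg
  split (tri≈ _ 0≡Δg _) = contradiction (sym 0≡Δg) Δg≢0
  split (tri> _ _ Δg<0) = contradiction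
    (sym (trans (identity α β γ α′ β′ γ′) (multiple≡0 (ℤ.- (+ 2 ℤ.* α ℤ.* α′)) f⊥g)))
    (λ eq → ℤₚ.<-irrefl eq (ℤₚ.+-mono-<-≤
      (0<product (α ℤ.* α) (ℤ.- disc₂ g) (0<square α (leading≢0 α β γ Δf<0)) (ℤₚ.neg-mono-< Δg<0))
      (ℤₚ.+-mono-≤ (0≤square (α ℤ.* β′ ℤ.- β ℤ.* α′))
        (0≤product (ℤ.- disc₂ f) (α′ ℤ.* α′) (ℤₚ.<⇒≤ (ℤₚ.neg-mono-< Δf<0)) (0≤square α′)))))

-- The Gram determinant of three forms is -4 times the square of their determinant.
orthogonal-not-all-positive : ∀ f g h → Pℤ.polar f g ≡ 0ℤ → Pℤ.polar f h ≡ 0ℤ → Pℤ.polar g h ≡ 0ℤ →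
  0ℤ < disc₂ f → 0ℤ < disc₂ g → ¬ 0ℤ < disc₂ h
orthogonal-not-all-positive f@(α₁ ∷ β₁ ∷ γ₁ ∷ []) g@(α₂ ∷ β₂ ∷ γ₂ ∷ []) h@(α₃ ∷ β₃ ∷ γ₃ ∷ []) fg fh
  gh 0<f 0<g 0<h =
  ℤₚ.<-irrefl (sym (trans (gram α₁ β₁ γ₁ α₂ β₂ γ₂ α₃ β₃ γ₃) (vanish fg fh gh)))
    (ℤₚ.+-mono-<-≤ (0<product (disc₂ f ℤ.* disc₂ g) (disc₂ h)
      (0<product (disc₂ f) (disc₂ g) 0<f 0<g) 0<h)
      (0≤product (+ 4) (δ ℤ.* δ) (+≤+ z≤n) (0≤square δ)))
  where
  δ = α₁ ℤ.* (β₂ ℤ.* γ₃ ℤ.- γ₂ ℤ.* β₃) ℤ.- β₁ ℤ.* (α₂ ℤ.* γ₃ ℤ.- γ₂ ℤ.* α₃) ℤ.+ γ₁ ℤ.*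
    (α₂ ℤ.* β₃ ℤ.- β₂ ℤ.* α₃)
  gram : ∀ α₁ β₁ γ₁ α₂ β₂ γ₂ α₃ β₃ γ₃ →
    let f = α₁ ∷ β₁ ∷ γ₁ ∷ []; g = α₂ ∷ β₂ ∷ γ₂ ∷ []; h = α₃ ∷ β₃ ∷ γ₃ ∷ []
        δ = α₁ ℤ.* (β₂ ℤ.* γ₃ ℤ.- γ₂ ℤ.* β₃) ℤ.- β₁ ℤ.* (α₂ ℤ.* γ₃ ℤ.- γ₂ ℤ.* α₃) ℤ.+ γ₁ ℤ.*
          (α₂ ℤ.* β₃ ℤ.- β₂ ℤ.* α₃) in
    disc₂ f ℤ.* disc₂ g ℤ.* disc₂ h ℤ.+ + 4 ℤ.* (δ ℤ.* δ) ≡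
      (disc₂ h ℤ.* Pℤ.polar f g ℤ.- + 2 ℤ.* Pℤ.polar f h ℤ.* Pℤ.polar g h) ℤ.* Pℤ.polar f g
      ℤ.+ (disc₂ g ℤ.* Pℤ.polar f h) ℤ.* Pℤ.polar f h ℤ.+
        (disc₂ f ℤ.* Pℤ.polar g h) ℤ.* Pℤ.polar g h
  gram = ℤ-solve 9 (λ α₁ β₁ γ₁ α₂ β₂ γ₂ α₃ β₃ γ₃ →
    let f = α₁ ∷ β₁ ∷ γ₁ ∷ []; g = α₂ ∷ β₂ ∷ γ₂ ∷ []; h = α₃ ∷ β₃ ∷ γ₃ ∷ []
        δ = α₁ :* (β₂ :* γ₃ :- γ₂ :* β₃) :- β₁ :* (α₂ :* γ₃ :- γ₂ :* α₃) :+ γ₁ :*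
          (α₂ :* β₃ :- β₂ :* α₃) in
    Sℤ.disc f :* Sℤ.disc g :* Sℤ.disc h :+ Κ (+ 4) :* (δ :* δ) :≡
    (Sℤ.disc h :* Sℤ.polar f g :- Κ (+ 2) :* Sℤ.polar f h :* Sℤ.polar g h) :* Sℤ.polar f g
    :+ (Sℤ.disc g :* Sℤ.polar f h) :* Sℤ.polar f h :+
      (Sℤ.disc f :* Sℤ.polar g h) :* Sℤ.polar g h) refl
  zeros : ∀ x y z → (x ℤ.* 0ℤ ℤ.- + 2 ℤ.* 0ℤ ℤ.* 0ℤ) ℤ.* 0ℤ ℤ.+ (y ℤ.* 0ℤ) ℤ.* 0ℤ ℤ.+
    (z ℤ.* 0ℤ) ℤ.* 0ℤ ≡ 0ℤ
  zeros = ℤRing.solve-∀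
  vanish : ∀ {p q r} → p ≡ 0ℤ → q ≡ 0ℤ → r ≡ 0ℤ →
    (disc₂ h ℤ.* p ℤ.- + 2 ℤ.* q ℤ.* r) ℤ.* p ℤ.+ (disc₂ g ℤ.* q) ℤ.* q ℤ.+ (disc₂ f ℤ.* r) ℤ.* r ≡
      0ℤ
  vanish refl refl refl = zeros (disc₂ h) (disc₂ g) (disc₂ f)

-- The number of roots

-- A rational square root of D is an integer, being a root of x³ - D x.
quotient-square : ∀ p k D → k ≢ 0ℤ → p ℤ.* p ≡ k ℤ.* k ℤ.* D → IsSquare D
quotient-square p k D k≢0 p²≡k²D = n , ι-injective
  (trans (ι-homo (leaf n ⊠ (leaf n ⊠ leaf 1ℤ))) n²≡D)
  where
  ιk≢0 : ι k ≢ 0ℚ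
  ιk≢0 eq = k≢0 (ι-injective eq)

  quotient = ℚ-quotient ιk≢0 (ℚ.- ι p)
  x = proj₁ quotient

  homogenised : ∀ p k D x → k ℚ.* (k ℚ.* (x ℚ.* x ℚ.- D)) ≡
    (k ℚ.* x ℚ.+ p) ℚ.* (ℚ.- p ℚ.+ x ℚ.* k) ℚ.+ 1ℚ ℚ.* (p ℚ.* p ℚ.- k ℚ.* k ℚ.* D)
  homogenised = solve-∀ ℚ-ring

  x²-D≡0 : x ℚ.* x ℚ.- ι D ≡ 0ℚ
  x²-D≡0 = ℚ-cancel ιk≢0 (ℚ-cancel ιk≢0 (trans (homogenised (ι p) (ι k) (ι D) x)
    (combine₂ℚ (ι k ℚ.* x ℚ.+ ι p) 1ℚ (proj₂ quotient)
      (difference≡0ℚ (trans (ι-* p p)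
        (trans (cong ι p²≡k²D) (ι-homo (leaf k ⊠ leaf k ⊠ leaf D))))))))

  factor : ∀ D x → Pℚ.cubic D 0ℚ x ≡ x ℚ.* (x ℚ.* x ℚ.- D)
  factor = ℚ-solve 2 (λ D x →
    Sℚ.cubic D (κ (+ 0)) x :≡ x :* (x :* x :- D)) refl

  integral = integral-root D 0ℤ x
    (trans (factor (ι D) x) (trans (cong (x ℚ.*_) x²-D≡0) (ℚₚ.*-zeroʳ x)))
  n = proj₁ integral

  n²≡D : ι n ℚ.* (ι n ℚ.* ι 1ℤ) ≡ ι D
  n²≡D = trans (cong (ι n ℚ.*_) (ℚₚ.*-identityʳ (ι n)))
    (trans (cong (λ t → t ℚ.* t) (sym (proj₂ integral))) (difference≡0⇒≡ x²-D≡0))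

-- The third root is -n - m, so (n - m)(2n + m)(n + 2m) is the product of the differences of the
-- roots. Its square is the discriminant of the resolvent, 27(4I³ - J²) = 27²Δ(F).
two-roots⇒square : ∀ F n m → n ≢ m → Root F n → Root F m → IsSquare (disc₄ F)
two-roots⇒square F@(_ ∷ _ ∷ _ ∷ _ ∷ _ ∷ []) n m n≢m root-n root-m =
  quotient-square ((n ℤ.- m) ℤ.* (+ 2 ℤ.* n ℤ.+ m) ℤ.* (n ℤ.+ + 2 ℤ.* m)) (+ 27) (disc₄ F) (λ ())
    (trans (ℤₚ.i-j≡0⇒i≡j _ _ (trans (vieta (I F) (J F) n m)
        (combine₂ℤ (+ 4 ℤ.* ((n ℤ.* n ℤ.+ n ℤ.* m ℤ.+ m ℤ.* m) ℤ.*
          (n ℤ.* n ℤ.+ n ℤ.* m ℤ.+ m ℤ.* m) ℤ.+ (n ℤ.* n ℤ.+ n ℤ.* m ℤ.+ m ℤ.* m) ℤ.* (+ 3 ℤ.* I F)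
          ℤ.+ (+ 3 ℤ.* I F) ℤ.* (+ 3 ℤ.* I F)))
          (+ 27 ℤ.* (J F ℤ.+ n ℤ.* m ℤ.* (n ℤ.+ m))) q≡0 root′)))
      (trans (cong (+ 27 ℤ.*_) (sym (disc₄-exact F))) (regroup (disc₄ F))))
  where
  difference : ∀ i j n m → (n ℤ.- m) ℤ.* (n ℤ.* n ℤ.+ n ℤ.* m ℤ.+ m ℤ.* m ℤ.- + 3 ℤ.* i) ≡
    1ℤ ℤ.* Pℤ.cubic (+ 3 ℤ.* i) j n ℤ.+ (ℤ.- 1ℤ) ℤ.* Pℤ.cubic (+ 3 ℤ.* i) j m
  difference = ℤ-solve 4 (λ i j n m →
    (n :- m) :* (n :* n :+ n :* m :+ m :* m :- Κ (+ 3) :* i) :≡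
    Κ (+ 1) :* Sℤ.cubic (Κ (+ 3) :* i) j n :+ (:- Κ (+ 1)) :* Sℤ.cubic
      (Κ (+ 3) :* i) j m) refl

  q≡0 : n ℤ.* n ℤ.+ n ℤ.* m ℤ.+ m ℤ.* m ℤ.- + 3 ℤ.* I F ≡ 0ℤ
  q≡0 = ℤ-cancel (λ eq → n≢m (ℤₚ.i-j≡0⇒i≡j n m eq))
    (trans (difference (I F) (J F) n m) (combine₂ℤ 1ℤ (ℤ.- 1ℤ) root-n root-m))

  j-value : ∀ i j n m → j ℤ.- n ℤ.* m ℤ.* (n ℤ.+ m) ≡ 1ℤ ℤ.* Pℤ.cubic (+ 3 ℤ.* i) j n ℤ.+
    (ℤ.- n) ℤ.* (n ℤ.* n ℤ.+ n ℤ.* m ℤ.+ m ℤ.* m ℤ.- + 3 ℤ.* i)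
  j-value = ℤ-solve 4 (λ i j n m →
    j :- n :* m :* (n :+ m) :≡ Κ (+ 1) :* Sℤ.cubic (Κ (+ 3) :* i) j n :+ (:- n) :*
      (n :* n :+ n :* m :+ m :* m :- Κ (+ 3) :* i)) refl

  root′ : J F ℤ.- n ℤ.* m ℤ.* (n ℤ.+ m) ≡ 0ℤ
  root′ = trans (j-value (I F) (J F) n m) (combine₂ℤ 1ℤ (ℤ.- n) root-n q≡0)

  -- With a = n² + nm + m² and b = nm(n + m) one has p² = 4a³ - 27b². The left side is 4(a³ - (3i)³)
  -- + 27(j² - b²), here factored by the Vieta relations a = 3i and b = j.
  vieta : ∀ i j n m → let p = (n ℤ.- m) ℤ.* (+ 2 ℤ.* n ℤ.+ m) ℤ.* (n ℤ.+ + 2 ℤ.* m) in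
    p ℤ.* p ℤ.- + 27 ℤ.* (+ 4 ℤ.* i ℤ.^ 3 ℤ.- j ℤ.^ 2) ≡
    (+ 4 ℤ.* ((n ℤ.* n ℤ.+ n ℤ.* m ℤ.+ m ℤ.* m) ℤ.* (n ℤ.* n ℤ.+ n ℤ.* m ℤ.+ m ℤ.* m) ℤ.+
      (n ℤ.* n ℤ.+ n ℤ.* m ℤ.+ m ℤ.* m) ℤ.* (+ 3 ℤ.* i) ℤ.+ (+ 3 ℤ.* i) ℤ.* (+ 3 ℤ.* i))) ℤ.*
      (n ℤ.* n ℤ.+ n ℤ.* m ℤ.+ m ℤ.* m ℤ.- + 3 ℤ.* i) ℤ.+
      (+ 27 ℤ.* (j ℤ.+ n ℤ.* m ℤ.* (n ℤ.+ m))) ℤ.* (j ℤ.- n ℤ.* m ℤ.* (n ℤ.+ m))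
  vieta = ℤ-solve 4 (λ i j n m →
    let p = (n :- m) :* (Κ (+ 2) :* n :+ m) :* (n :+ Κ (+ 2) :* m) in
    p :* p :- Κ (+ 27) :* (Κ (+ 4) :* i Sℤ.^ 3 :- j Sℤ.^ 2) :≡
    (Κ (+ 4) :* ((n :* n :+ n :* m :+ m :* m) :* (n :* n :+ n :* m :+ m :* m) :+
      (n :* n :+ n :* m :+ m :* m) :* (Κ (+ 3) :* i) :+ (Κ (+ 3) :* i) :* (Κ (+ 3) :* i))) :*
      (n :* n :+ n :* m :+ m :* m :- Κ (+ 3) :* i) :+
      (Κ (+ 27) :* (j :+ n :* m :* (n :+ m))) :* (j :- n :* m :* (n :+ m))) refl

  regroup : ∀ D → + 27 ℤ.* (D ℤ.* + 27) ≡ + 27 ℤ.* + 27 ℤ.* D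
  regroup = ℤRing.solve-∀

record ThreeRoots (F : Form ℤ 4) : Set where
  field
    n₁ n₂ n₃       : ℤ
    root₁          : Root F n₁
    root₂          : Root F n₂
    root₃          : Root F n₃
    n₁≢n₂          : n₁ ≢ n₂
    n₁≢n₃          : n₁ ≢ n₃
    n₂≢n₃          : n₂ ≢ n₃
    complete       : ∀ m → Root F m → m ≡ n₁ ⊎ m ≡ n₂ ⊎ m ≡ n₃

module _ (F : Form ℤ 4) (Δ≢0 : disc₄ F ≢ 0ℤ) (n : ℤ) (root : Root F n) where
  private
    u = + 3 ℤ.* I F

    -- The resolvent is (x - n)(x² + n x + n² - u), with quadratic factor of
    -- discriminant D.
    D : ℤ
    D = + 4 ℤ.* u ℤ.- + 3 ℤ.* (n ℤ.* n)

    -- Minus the value of the quadratic factor at n, so that k²D is the discriminant 27²Δ(F) of the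
    -- resolvent.
    k = + 3 ℤ.* (I F ℤ.- n ℤ.* n)

    k≢0 : k ≢ 0ℤ
    k≢0 = product≢0 (+ 3) (I F ℤ.- n ℤ.* n) (λ ()) (simple-root F n Δ≢0 root)

    k²D : ∀ Δ → Δ ℤ.* + 27 ≡ (I F ℤ.- n ℤ.* n) ℤ.* (I F ℤ.- n ℤ.* n) ℤ.* (+ 4 ℤ.* I F ℤ.- n ℤ.* n) →
          + 27 ℤ.* + 27 ℤ.* Δ ≡ k ℤ.* k ℤ.* D
    k²D Δ eq = trans (regroup Δ) (trans (cong (+ 27 ℤ.*_) eq) (expand (I F) n))
      where
      regroup : ∀ D → + 27 ℤ.* + 27 ℤ.* D ≡ + 27 ℤ.* (D ℤ.* + 27)
      regroup = ℤRing.solve-∀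
      expand : ∀ i n → + 27 ℤ.* ((i ℤ.- n ℤ.* n) ℤ.* (i ℤ.- n ℤ.* n) ℤ.* (+ 4 ℤ.* i ℤ.- n ℤ.* n)) ≡
        (+ 3 ℤ.* (i ℤ.- n ℤ.* n)) ℤ.* (+ 3 ℤ.* (i ℤ.- n ℤ.* n)) ℤ.*
          (+ 4 ℤ.* (+ 3 ℤ.* i) ℤ.- + 3 ℤ.* (n ℤ.* n))
      expand = ℤRing.solve-∀

    729Δ≡k²D : + 27 ℤ.* + 27 ℤ.* disc₄ F ≡ k ℤ.* k ℤ.* D
    729Δ≡k²D = k²D (disc₄ F) (disc-root F n root)

    D≢0 : D ≢ 0ℤ
    D≢0 D≡0 = product≢0 (+ 27 ℤ.* + 27) (disc₄ F) (λ ()) Δ≢0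
      (trans 729Δ≡k²D (multiple≡0 (k ℤ.* k) D≡0))

    square-D : IsSquare (disc₄ F) → IsSquare D
    square-D (m , m²≡Δ) = quotient-square (+ 27 ℤ.* m) k D k≢0
      (trans (regroup m) (trans (cong (+ 27 ℤ.* + 27 ℤ.*_) m²≡Δ) 729Δ≡k²D))
      where
      regroup : ∀ m → (+ 27 ℤ.* m) ℤ.* (+ 27 ℤ.* m) ≡ + 27 ℤ.* + 27 ℤ.* m ℤ.^ 2
      regroup = ℤ-solve 1 (λ m →
        (Κ (+ 27) :* m) :* (Κ (+ 27) :* m) :≡ Κ (+ 27) :* Κ (+ 27) :* m Sℤ.^ 2) refl

    -- (s - x)/2 is the quadratic formula for the complementary factor. As a rational root of a
    -- monic integral polynomial it is an integer, which replaces a parity argument for s - n.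
    half-root : ∀ s u w x → Pℚ.cubic u w (½ ℚ.* (s ℚ.- x)) ≡
      1ℚ ℚ.* Pℚ.cubic u w x ℚ.+
      (½ ℚ.* ½ ℚ.* ½ ℚ.* (s ℚ.- ι (+ 3) ℚ.* x)) ℚ.*
        (s ℚ.* (s ℚ.* ι 1ℤ) ℚ.- (ι (+ 4) ℚ.* u ℚ.- ι (+ 3) ℚ.* (x ℚ.* x)))
    half-root = ℚ-solve 4 (λ s u w x →
      Sℚ.cubic u w (Κ ½ :* (s :- x)) :≡
      κ (+ 1) :* Sℚ.cubic u w x :+
      (Κ ½ :* Κ ½ :* Κ ½ :* (s :- κ (+ 3) :* x)) :*
        (s :* (s :* κ (+ 1)) :- (κ (+ 4) :* u :- κ (+ 3) :* (x :* x)))) refl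

  module _ (s : ℤ) (s²≡D : s ℤ.^ 2 ≡ D) where
    private
      integral : ∃ λ n₂ → ½ ℚ.* (ι s ℚ.- ι n) ≡ ι n₂
      integral = integral-root u (J F) (½ ℚ.* (ι s ℚ.- ι n))
        (trans (half-root (ι s) (ι u) (ι (J F)) (ι n))
          (combine₂ℚ 1ℚ (½ ℚ.* ½ ℚ.* ½ ℚ.* (ι s ℚ.- ι (+ 3) ℚ.* ι n)) cubic≡0
            (difference≡0ℚ (trans (sym (ι-homo (leaf s ⊠ (leaf s ⊠ leaf 1ℤ))))
              (trans (cong ι s²≡D) (ι-homo (leaf (+ 4) ⊠ leaf u ⊞ ⊟
                (leaf (+ 3) ⊠ (leaf n ⊠ leaf n)))))))))
        where
        cubic≡0 : Pℚ.cubic (ι u) (ι (J F)) (ι n) ≡ 0ℚ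
        cubic≡0 = trans (sym (ι-homo (Pᴱ.cubic (leaf u) (leaf (J F)) (leaf n)))) (cong ι root)

      n₂ n₃ : ℤ
      n₂ = proj₁ integral
      -- The resolvent has no x² term, so its roots sum to zero.
      n₃ = ℤ.- n ℤ.- n₂

      2n₂+n≡s : + 2 ℤ.* n₂ ℤ.+ n ≡ s
      2n₂+n≡s = ι-injective (trans (ι-homo (leaf (+ 2) ⊠ leaf n₂ ⊞ leaf n))
        (trans (cong (λ t → ι (+ 2) ℚ.* t ℚ.+ ι n) (sym (proj₂ integral))) (double (ι s) (ι n))))
        where
        double : ∀ s n → ι (+ 2) ℚ.* (½ ℚ.* (s ℚ.- n)) ℚ.+ n ≡ s
        double = solve-∀ ℚ-ring

      q : ℤ → ℤ
      q m = m ℤ.* m ℤ.+ n ℤ.* m ℤ.+ n ℤ.* n ℤ.- u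

      q[n₂]≡0 : q n₂ ≡ 0ℤ
      q[n₂]≡0 = ℤ-cancel {+ 4} (λ ()) (trans (complete-square n₂ n u)
        (ℤₚ.i≡j⇒i-j≡0 (trans (cong (ℤ._^ 2) 2n₂+n≡s) s²≡D)))
        where
        complete-square : ∀ m n u → + 4 ℤ.* (m ℤ.* m ℤ.+ n ℤ.* m ℤ.+ n ℤ.* n ℤ.- u) ≡
          (+ 2 ℤ.* m ℤ.+ n) ℤ.^ 2 ℤ.- (+ 4 ℤ.* u ℤ.- + 3 ℤ.* (n ℤ.* n))
        complete-square = ℤ-solve 3 (λ m n u →
          Κ (+ 4) :* (m :* m :+ n :* m :+ n :* n :- u) :≡
          (Κ (+ 2) :* m :+ n) Sℤ.^ 2 :- (Κ (+ 4) :* u :- Κ (+ 3) :* (n :* n))) refl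

      q[n₃]≡0 : q n₃ ≡ 0ℤ
      q[n₃]≡0 = trans (symmetric n₂ n u) q[n₂]≡0
        where
        symmetric : ∀ m n u → let m′ = ℤ.- n ℤ.- m in
          m′ ℤ.* m′ ℤ.+ n ℤ.* m′ ℤ.+ n ℤ.* n ℤ.- u ≡ m ℤ.* m ℤ.+ n ℤ.* m ℤ.+ n ℤ.* n ℤ.- u
        symmetric = ℤRing.solve-∀

      factorise : ∀ u j m n → Pℤ.cubic u j m ≡
        1ℤ ℤ.* Pℤ.cubic u j n ℤ.+ (m ℤ.- n) ℤ.* (m ℤ.* m ℤ.+ n ℤ.* m ℤ.+ n ℤ.* n ℤ.- u)
      factorise = ℤ-solve 4 (λ u j m n →
        Sℤ.cubic u j m :≡
        Κ (+ 1) :* Sℤ.cubic u j n :+ (m :- n) :* (m :* m :+ n :* m :+ n :* n :- u)) refl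

      q⇒root : ∀ m → q m ≡ 0ℤ → Root F m
      q⇒root m q≡0 = trans (factorise u (J F) m n) (combine₂ℤ 1ℤ (m ℤ.- n) root q≡0)

      root⇒q : ∀ m → m ≢ n → Root F m → q m ≡ 0ℤ
      root⇒q m m≢n root-m = ℤ-cancel (λ eq → m≢n (ℤₚ.i-j≡0⇒i≡j m n eq))
        (trans (isolate u (J F) m n) (combine₂ℤ 1ℤ (ℤ.- 1ℤ) root-m root))
        where
        isolate : ∀ u j m n → (m ℤ.- n) ℤ.* (m ℤ.* m ℤ.+ n ℤ.* m ℤ.+ n ℤ.* n ℤ.- u) ≡
          1ℤ ℤ.* Pℤ.cubic u j m ℤ.+ (ℤ.- 1ℤ) ℤ.* Pℤ.cubic u j n
        isolate = ℤ-solve 4 (λ u j m n →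
          (m :- n) :* (m :* m :+ n :* m :+ n :* n :- u) :≡
          Κ (+ 1) :* Sℤ.cubic u j m :+ (:- Κ (+ 1)) :* Sℤ.cubic u j n) refl

      -- q(n) = -k is the derivative of the resolvent at n, nonzero because the root is simple.
      q≡0⇒≢n : ∀ m → q m ≡ 0ℤ → n ≢ m
      q≡0⇒≢n m q≡0 refl = k≢0 (trans (derivative (I F) n) (cong ℤ.-_ q≡0))
        where
        derivative : ∀ i n → + 3 ℤ.* (i ℤ.- n ℤ.* n) ≡
          ℤ.- (n ℤ.* n ℤ.+ n ℤ.* n ℤ.+ n ℤ.* n ℤ.- + 3 ℤ.* i)
        derivative = ℤRing.solve-∀

      -- Their difference is 2n₂ + n = s, whose square D is nonzero.
      n₂≢n₃ : n₂ ≢ n₃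
      n₂≢n₃ n₂≡n₃ = D≢0 (trans (sym s²≡D) (cong (ℤ._^ 2)
        (trans (sym 2n₂+n≡s) (trans (difference n₂ n) (ℤₚ.i≡j⇒i-j≡0 n₂≡n₃)))))
        where
        difference : ∀ m n → + 2 ℤ.* m ℤ.+ n ≡ m ℤ.- (ℤ.- n ℤ.- m)
        difference = ℤRing.solve-∀

      complete : ∀ m → Root F m → m ≡ n ⊎ m ≡ n₂ ⊎ m ≡ n₃
      complete m root-m = decide (m ℤ.≟ n)
        where
        factors : q m ≡ 0ℤ → (m ℤ.- n₂) ℤ.* (m ℤ.- n₃) ≡ 0ℤ
        factors q≡0 = trans (product m n₂ n u) (combine₂ℤ 1ℤ (ℤ.- 1ℤ) q≡0 q[n₂]≡0)
          where
          product : ∀ m m₂ n u → (m ℤ.- m₂) ℤ.* (m ℤ.- (ℤ.- n ℤ.- m₂)) ≡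
            1ℤ ℤ.* (m ℤ.* m ℤ.+ n ℤ.* m ℤ.+ n ℤ.* n ℤ.- u)
            ℤ.+ (ℤ.- 1ℤ) ℤ.* (m₂ ℤ.* m₂ ℤ.+ n ℤ.* m₂ ℤ.+ n ℤ.* n ℤ.- u)
          product = ℤRing.solve-∀
        decide : _ → m ≡ n ⊎ m ≡ n₂ ⊎ m ≡ n₃
        decide (yes m≡n) = inj₁ m≡n
        decide (no  m≢n) = inj₂ ([ (λ eq → inj₁ (ℤₚ.i-j≡0⇒i≡j m n₂ eq)) ,
          (λ eq → inj₂ (ℤₚ.i-j≡0⇒i≡j m n₃ eq)) ]′
          (ℤₚ.i*j≡0⇒i≡0∨j≡0 (m ℤ.- n₂) (factors (root⇒q m m≢n root-m))))

    split-roots : ThreeRoots F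
    split-roots = record
      { n₁ = n ; n₂ = n₂ ; n₃ = n₃
      ; root₁ = root ; root₂ = q⇒root n₂ q[n₂]≡0 ; root₃ = q⇒root n₃ q[n₃]≡0
      ; n₁≢n₂ = q≡0⇒≢n n₂ q[n₂]≡0 ; n₁≢n₃ = q≡0⇒≢n n₃ q[n₃]≡0 ; n₂≢n₃ = n₂≢n₃
      ; complete = complete
      }

  square⇒three-roots : IsSquare (disc₄ F) → ThreeRoots F
  square⇒three-roots square = let s , s²≡D = square-D square in split-roots s s²≡D

-- Lets the root whose form is definite be moved to the first place.
rotate : ∀ {F} → ThreeRoots F → ThreeRoots F
rotate R = record
  { n₁ = n₂ ; n₂ = n₃ ; n₃ = n₁
  ; root₁ = root₂ ; root₂ = root₃ ; root₃ = root₁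
  ; n₁≢n₂ = n₂≢n₃ ; n₁≢n₃ = λ eq → n₁≢n₂ (sym eq) ; n₂≢n₃ = λ eq → n₁≢n₃ (sym eq)
  ; complete = λ m root → [ (λ eq → inj₂ (inj₂ eq)) , [ inj₁ , (λ eq → inj₂ (inj₁ eq)) ]′ ]′
    (complete m root)
  }
  where open ThreeRoots R

-- Forms up to sign and roots of the resolvent

module _ (F : Form ℤ 4) (Δ≢0 : disc₄ F ≢ 0ℤ) where

  module Eigenform n (root : Root F n) where
    private generator = root⇒primitive-generator F n Δ≢0 root

    form : Form ℤ 2
    form = proj₁ generator

    eigen : Eigenformℤ F n form
    eigen = Generator.eigen (proj₂ (proj₂ generator))

    disc≢0 : disc₂ form ≢ 0ℤ
    disc≢0 = Generator.disc≢0 (proj₂ (proj₂ generator))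

    stabilises : Stabilises form F
    stabilises = eigenform⇒stabilises form F n (proj₁ (proj₂ generator)) disc≢0 eigen

    unique : ∀ g → Stabilises g F → Eigenformℤ F n g → g ≡± form
    unique g (prim-g , _) eigen-g =
      generator-unique F n form g (proj₁ (proj₂ generator)) (proj₂ (proj₂ generator)) prim-g eigen-g

  stabiliser-from-root : ∃ (Root F) → ∃ λ f → Stabilises f F
  stabiliser-from-root (n , root) = Eigenform.form n root , Eigenform.stabilises n root

  -- A form belonging to a different root would supply two distinct roots and make Δ(F) a square.
  nonsquare⇒unique : ∃ (Root F) → ¬ IsSquare (disc₄ F) →
                     ∃ λ f → Stabilises f F × (∀ g → Stabilises g F → g ≡± f)
  nonsquare⇒unique (n , root) nonsquare = form , stabilises , all
    where
    open Eigenform n root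
    all : ∀ g → Stabilises g F → g ≡± form
    all g stab = let m , root-m , eigen-g = stabilises⇒eigenform g F stab in
      same-root m root-m eigen-g (n ℤ.≟ m)
      where
      -- `m` is made a variable again, so that `n ≡ m` can be matched by `refl`.
      same-root : ∀ m → Root F m → Eigenformℤ F m g → Dec (n ≡ m) → g ≡± form
      same-root m root-m eigen-g (yes refl) = unique g stab eigen-g
      same-root m root-m eigen-g (no n≢m) =
        contradiction (two-roots⇒square F n m n≢m root root-m) nonsquare

  ExactlyThree : Set
  ExactlyThree = ∃ λ f₁ → ∃₂ λ f₂ f₃ →
      (Stabilises f₁ F × Stabilises f₂ F × Stabilises f₃ F)
    × (¬ f₁ ≡± f₂ × ¬ f₁ ≡± f₃ × ¬ f₂ ≡± f₃)
    × (∀ g → Stabilises g F → g ≡± f₁ ⊎ g ≡± f₂ ⊎ g ≡± f₃)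
    × Definite f₁ × Indefinite f₂ × Indefinite f₃

  module ThreeForms (R : ThreeRoots F) where
    open ThreeRoots R
    module E₁ = Eigenform n₁ root₁
    module E₂ = Eigenform n₂ root₂
    module E₃ = Eigenform n₃ root₃

    f₁⊥f₂ : Pℤ.polar E₁.form E₂.form ≡ 0ℤ
    f₁⊥f₂ = eigenforms-orthogonal F n₁ n₂ E₁.form E₂.form n₁≢n₂ E₁.eigen E₂.eigen
    f₁⊥f₃ : Pℤ.polar E₁.form E₃.form ≡ 0ℤ
    f₁⊥f₃ = eigenforms-orthogonal F n₁ n₃ E₁.form E₃.form n₁≢n₃ E₁.eigen E₃.eigen
    f₂⊥f₃ : Pℤ.polar E₂.form E₃.form ≡ 0ℤ
    f₂⊥f₃ = eigenforms-orthogonal F n₂ n₃ E₂.form E₃.form n₂≢n₃ E₂.eigen E₃.eigen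

    negative⇒exactlyThree : disc₂ E₁.form < 0ℤ → ExactlyThree
    negative⇒exactlyThree Δ₁<0 = E₁.form , E₂.form , E₃.form
      , (E₁.stabilises , E₂.stabilises , E₃.stabilises)
      , ( orthogonal⇒not≡± E₁.form E₂.form E₂.disc≢0 f₁⊥f₂
        , orthogonal⇒not≡± E₁.form E₃.form E₃.disc≢0 f₁⊥f₃
        , orthogonal⇒not≡± E₂.form E₃.form E₃.disc≢0 f₂⊥f₃)
      , all
      , negative-disc⇒definite E₁.form Δ₁<0
      , positive-disc⇒indefinite E₂.form
        (orthogonal-to-negative E₁.form E₂.form Δ₁<0 E₂.disc≢0 f₁⊥f₂)
      , positive-disc⇒indefinite E₃.form
        (orthogonal-to-negative E₁.form E₃.form Δ₁<0 E₃.disc≢0 f₁⊥f₃)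
      where
      all : ∀ g → Stabilises g F → g ≡± E₁.form ⊎ g ≡± E₂.form ⊎ g ≡± E₃.form
      all g stab = let m , root-m , eigen-g = stabilises⇒eigenform g F stab in
        match m eigen-g (complete m root-m)
        where
        match : ∀ m → Eigenformℤ F m g → m ≡ n₁ ⊎ m ≡ n₂ ⊎ m ≡ n₃ →
                g ≡± E₁.form ⊎ g ≡± E₂.form ⊎ g ≡± E₃.form
        match m eigen-g (inj₁ refl)        = inj₁ (E₁.unique g stab eigen-g)
        match m eigen-g (inj₂ (inj₁ refl)) = inj₂ (inj₁ (E₂.unique g stab eigen-g))
        match m eigen-g (inj₂ (inj₂ refl)) = inj₂ (inj₂ (E₃.unique g stab eigen-g))

  -- The Gram determinant excludes three positive discriminants, and none is zero; a negative one is
  -- rotated to the front and makes the other two positive.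
  three-roots⇒exactlyThree : ThreeRoots F → ExactlyThree
  three-roots⇒exactlyThree R = split
    (ℤₚ.<-cmp 0ℤ (disc₂ E₁.form)) (ℤₚ.<-cmp 0ℤ (disc₂ E₂.form)) (ℤₚ.<-cmp 0ℤ (disc₂ E₃.form))
    where
    open ThreeForms R
    split : _ → _ → _ → ExactlyThree
    split (tri> _ _ Δ₁<0) _ _ = negative⇒exactlyThree Δ₁<0
    split _ (tri> _ _ Δ₂<0) _ = ThreeForms.negative⇒exactlyThree (rotate R) Δ₂<0
    split _ _ (tri> _ _ Δ₃<0) = ThreeForms.negative⇒exactlyThree (rotate (rotate R)) Δ₃<0
    split (tri≈ _ eq _) _ _ = contradiction (sym eq) E₁.disc≢0
    split _ (tri≈ _ eq _) _ = contradiction (sym eq) E₂.disc≢0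
    split _ _ (tri≈ _ eq _) = contradiction (sym eq) E₃.disc≢0
    split (tri< 0<Δ₁ _ _) (tri< 0<Δ₂ _ _) (tri< 0<Δ₃ _ _) = contradiction 0<Δ₃
      (orthogonal-not-all-positive E₁.form E₂.form E₃.form f₁⊥f₂ f₁⊥f₃ f₂⊥f₃ 0<Δ₁ 0<Δ₂)

theorem1p1 : (F : Form ℤ 4) → disc₄ F ≢ 0ℤ →
    (Reducible (resolvent F) ⇔ (∃ λ T → Fixes T F × ¬ IsScalar (matrix T)))
    × (Reducible (resolvent F) ⇔ (∃ λ f → Stabilises f F))
    × (Reducible (resolvent F) →
    (¬ IsSquare (disc₄ F) →
    ∃ λ f → Stabilises f F × (∀ g → Stabilises g F → g ≡± f))
    × (IsSquare (disc₄ F) →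
    ∃ λ f₁ → ∃₂ λ f₂ f₃ →
    (Stabilises f₁ F × Stabilises f₂ F × Stabilises f₃ F)
    × (¬ f₁ ≡± f₂ × ¬ f₁ ≡± f₃ × ¬ f₂ ≡± f₃)
    × (∀ g → Stabilises g F → g ≡± f₁ ⊎ g ≡± f₂ ⊎ g ≡± f₃)
    × Definite f₁ × Indefinite f₂ × Indefinite f₃))
theorem1p1 F Δ≢0 =
    -- (1) ⇒ (2) passes through (3), with T = M_f.
    mk⇔ (λ reducible → stabiliser⇒matrix (reducible⇒stabiliser reducible))
        (λ (T , fixes , ¬scalar) → root⇒reducible F (fixed⇒root T F ¬scalar fixes))
  , mk⇔ reducible⇒stabiliser
        (λ (f , stab) → let n , root , _ = stabilises⇒eigenform f F stab in root⇒reducible F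
          (n , root))
  , λ reducible →
      let n , root = reducible⇒root F reducible in
      nonsquare⇒unique F Δ≢0 (n , root) ,
      λ square → three-roots⇒exactlyThree F Δ≢0 (square⇒three-roots F Δ≢0 n root square)
  where
  reducible⇒stabiliser : Reducible (resolvent F) → ∃ λ f → Stabilises f F
  reducible⇒stabiliser reducible = stabiliser-from-root F Δ≢0 (reducible⇒root F reducible)

  stabiliser⇒matrix : (∃ λ f → Stabilises f F) → ∃ λ T → Fixes T F × ¬ IsScalar (matrix T)
  stabiliser⇒matrix (f , _ , Δf≢0 , fixes) = M-GL₂ f Δf≢0 , fixes , M-not-scalar f Δf≢0
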